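{- There is an absolute constant $C>0$ such that the following holds. Let $\mathcal{F}$ be a system of $m$ sets on $[n]$ such that $\mathcal{F} = \mathcal{F}_1 \cup \mathcal{F}_2 \cup \cdots \cup \mathcal{F}_t$ for set systems $\mathcal{F}_1,\dots,\mathcal{F}_t$ on $[n]$. Then $$\mathsf{herdisc}(\mathcal{F}) \leq C \sqrt{ t \log (m) \log (n) } \cdot \max_{i \in [t]} \mathsf{herdisc}(\mathcal{F}_i).$$
   Context: For a matrix $A\in\mathbb{R}^{m\times n}$, $\mathsf{disc}(A) := \min_{\mathbf{x} \in \{ -1,+1\}^n} \|A \mathbf{x}\|_\infty$ and $\mathsf{herdisc}(A) := \max_{S \subseteq [n]} \mathsf{disc}(A_S)$, where $A_S$ is the restriction of $A$ to the columns in $S$. For a set system $\mathcal{F}$ on $[n]$, $\mathsf{herdisc}(\mathcal{F}) := \mathsf{herdisc}(A_\mathcal{F})$, where $A_{\mathcal{F}}\in\{0,1\}^{|\mathcal{F}|\times n}$ is the incidence matrix of $\mathcal{F}$ (rows indexed by sets, columns by elements).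
   Formalization: The formal theorem assumes m ≥ 2 and n ≥ 2; for m = 1 or n = 1 the logarithm vanishes and the stated bound fails (e.g. a single nonempty set has hereditary discrepancy 1 while the right-hand side is 0). -}

module Defs where

open import Data.Nat using (ℕ; zero; suc)
open import Data.Integer using (ℤ; +_; -_; _+_; _*_; ∣_∣)
open import Data.Fin using (Fin; zero; suc)
open import Data.Fin.Subset using (Subset)
open import Data.Vec using (lookup)
open import Data.Bool using (Bool; true; false; if_then_else_)
open import Data.Product using (∃)
import Data.Nat as ℕ

-- Real-valued matrices are replaced by integer matrices (all matrices here are
-- 0/1 incidence matrices). Rows indexed by Fin m, columns by Fin n.
Matrix : ℕ → ℕ → Set
Matrix m n = Fin m → Fin n → ℤ

∑ : ∀ {n} → (Fin n → ℤ) → ℤ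
∑ {zero}  f = + 0
∑ {suc n} f = f zero + ∑ (λ j → f (suc j))

sign : Bool → ℤ
sign true  = + 1
sign false = - (+ 1)

apply : ∀ {m n} → Matrix m n → (Fin n → Bool) → Fin m → ℤ
apply A x r = ∑ (λ j → A r j * sign (x j))

DiscLe : ∀ {m n} → Matrix m n → ℕ → Set
DiscLe A D = ∃ λ x → ∀ r → ∣ apply A x r ∣ ℕ.≤ D

-- A_S, realised by zeroing the columns outside S (equivalent to deleting them)
restrict : ∀ {m n} → Matrix m n → Subset n → Matrix m n
restrict A S r j = if lookup S j then A r j else + 0

HerdiscLe : ∀ {m n} → Matrix m n → ℕ → Set
HerdiscLe A D = ∀ S → DiscLe (restrict A S) D

incidence : ∀ {m n} → (Fin m → Subset n) → Matrix m n
incidence F r j = if lookup (F r) j then + 1 else + 0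

{-# OPTIONS --safe #-}
module Submission where

-- The colouring is found by a deterministic walk x in the cube [-1,1]^n that is controlled by the potential
-- Φ = Σ_r (S + u_r²)^p, where u_r is the current discrepancy of row r, p = ⌈log₂ m⌉ and S is of order
-- t log m log n H². While s coordinates are alive, the walk moves along y ⟂ x with
-- Σ_r w_r ⟨B_r,y⟩² ≤ C t H² ∣y∣² Σ_r w_r / s for the weights w_r = (S + u_r²)^p; of the two directions ±y one
-- increases Φ by no more than this quadratic form allows. The steps lengthen x and coordinates close to ±1 are
-- frozen, so that the total increase of log Φ is a harmonic sum of order p.
--
-- To find y, pick rows greedily, each far from the span of the previous ones. If no basis vector of the
-- remaining space is a suitable y, then an average row is far, so that the product of the Gram–Schmidt
-- lengths of the picked rows is large. Splitting the picked rows by the systems F_i can only lengthen their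
-- Gram–Schmidt vectors (Fischer's inequality), and the multinomial loss is at most t^s, which yields the factor
-- √t. Within one F_i the product is bounded by a volume form of the Lovász–Spencer–Vesztergombi bound:
-- hereditary colourings round all points of a fine grid on suitable k columns to 2^k classes, while few grid
-- points lie in one cell of the Gram–Schmidt frame.

-- Only squared lengths occur, so everything lives in ℚ; lengths enter as rational approximations
-- within a factor 2. Determinants never appear: products of Gram-Schmidt lengths replace them, and
-- volumes are compared by counting integer points. The walk moves along y ⟂ x because ∣x∣² then
-- grows equally for both signs, which leaves the sign free for controlling Φ. The factor 1/s in the
-- energy bound comes from two factorials. With k dimensions left, averaging over the k basis
-- vectors yields a row at squared distance above k μ / Σ w, hence K! μ^K over K stages; passing to
-- k of s columns by leverage costs only s^k / k!. Each factorial is worth (K/4)^K, so that μ of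
-- order t H² Σ w / s already leads to a contradiction. The two logarithms have different origins:
-- since 2^p ≥ m, the number of rows costs a factor 2 after a p-th root, while log n bounds the
-- harmonic sum produced by freezing. The volume argument needs H ≥ 1, which holds because two
-- distinct sets are not both empty.

module Discrepancy where

  open import Level using (0ℓ)
  open import Data.Nat using (ℕ; zero; suc; s≤s; z≤n)
  import Data.Nat as ℕ
  import Data.Nat.Properties as ℕP
  open import Data.Integer using (ℤ; -[1+_])
  import Data.Integer as ℤ
  import Data.Integer.Properties as ℤP
  open import Data.Rational using (ℚ; 0ℚ; 1ℚ; _+_; _*_; -_; _-_; _≤_; _<_; ∣_∣; mkℚ; toℚᵘ; fromℚᵘ; ↥_; ↧_; 1/_)
  import Data.Rational as ℚ
  open import Data.Rational.Properties using (+-comm; +-identityˡ; +-identityʳ; +-inverseʳ; *-assoc; *-comm; *-identityˡ; *-identityʳ; *-zeroˡ; *-zeroʳ; *-distribˡ-+; ≤-refl; ≤-reflexive; ≤-trans; ≤-antisym; ≤-total; <⇒≤; ≮⇒≥; ≰⇒>; <-irrefl; <-≤-trans; ≤-<-trans; <-trans; _≤?_; _<?_; _≟_; +-mono-≤; +-mono-<-≤; +-mono-≤-<; +-*-commutativeRing; neg-antimono-≤; ∣p+q∣≤∣p∣+∣q∣; ∣p*q∣≡∣p∣*∣q∣; ∣-p∣≡∣p∣; 0≤∣p∣; 0≤p⇒∣p∣≡p; ∣p∣≡p∨∣p∣≡-p; nonNegative⁻¹; positive⁻¹)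
  import Data.Rational.Properties as ℚP
  import Data.Rational.Unnormalised as ℚᵘ
  import Data.Rational.Unnormalised.Properties as ℚᵘP
  open import Data.Fin using (Fin; zero; suc; toℕ; punchIn)
  import Data.Fin as Fin
  import Data.Fin.Properties as FinP
  open import Data.Bool using (Bool; true; false; if_then_else_; _∧_)
  open import Data.Maybe using (Maybe; just; nothing)
  open import Data.Product using (∃; ∃₂; Σ-syntax; _×_; _,_; proj₁; proj₂)
  open import Data.Sum using (_⊎_; inj₁; inj₂; [_,_]′)
  open import Data.Empty using (⊥; ⊥-elim)
  open import Data.Vec using (Vec; []; _∷_)
  import Data.Vec as Vec
  import Data.Vec.Functional as VF
  open import Data.List using (List; []; _∷_; length; filter; map)
  import Data.List as List
  import Data.List.Properties as ListP
  open import Data.List.Membership.Propositional using (_∈_)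
  open import Data.List.Membership.Propositional.Properties using (∈-filter⁻; ∈-upTo⁻; ∈-cartesianProductWith⁻)
  open import Data.List.Relation.Unary.Any using (here; there)
  open import Data.List.Relation.Unary.All using (All; []; _∷_)
  import Data.List.Relation.Unary.All as All
  import Data.List.Relation.Unary.All.Properties as AllP
  open import Data.List.Relation.Unary.AllPairs using (AllPairs; []; _∷_)
  import Data.List.Relation.Unary.AllPairs.Properties as AllPairsP
  open import Data.List.Relation.Unary.Unique.Propositional using (Unique)
  import Data.List.Relation.Unary.Unique.Propositional.Properties as UniqueP
  open import Function using (_∘_)
  open import Relation.Nullary using (¬_; Dec; yes; no; does; contradiction)
  open import Relation.Nullary.Decidable using (¬?)
  open import Relation.Binary.PropositionalEquality using (_≡_; _≢_; refl; sym; trans; cong; cong₂; subst; subst₂)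
  open import Tactic.RingSolver.Core.AlmostCommutativeRing using (AlmostCommutativeRing; fromCommutativeRing)
  open import Tactic.RingSolver using (solve-∀)
  open import Relation.Binary.Definitions using (tri<; tri≈; tri>)
  open import Data.Nat.Tactic.RingSolver using () renaming (solve-∀ to ℕ-solve-∀)
  import Data.Vec.Properties as VecP
  import Data.Vec.Relation.Binary.Pointwise.Extensional as VPE
  import Data.Vec.Functional.Properties as VFP
  import Data.Nat.Logarithm as Log
  open import Data.Fin.Subset using (Subset) renaming (⊤ to ⊤ˢ)
  open import Data.Nat.Induction using (<-rec)
  import Defs

  -- Ordered field arithmetic in ℚ

  ℚ-ring : AlmostCommutativeRing 0ℓ 0ℓ
  ℚ-ring = fromCommutativeRing +-*-commutativeRing zero?
    where
    zero? : ∀ x → Maybe (0ℚ ≡ x)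
    zero? x with 0ℚ ≟ x
    ... | yes p = just p
    ... | no  _ = nothing

  2ℚ 4ℚ : ℚ
  2ℚ = 1ℚ + 1ℚ
  4ℚ = 2ℚ + 2ℚ

  ≤-by : ∀ {a b} d → 0ℚ ≤ d → b ≡ a + d → a ≤ b
  ≤-by {a} d 0≤d refl = subst (_≤ a + d) (+-identityʳ a) (+-mono-≤ (≤-refl {a}) 0≤d)

  <-by : ∀ {a b} d → 0ℚ < d → b ≡ a + d → a < b
  <-by {a} d 0<d refl = subst (_< a + d) (+-identityʳ a) (+-mono-≤-< (≤-refl {a}) 0<d)

  m≤n⇒0≤n-m : ∀ {a b} → a ≤ b → 0ℚ ≤ b - a
  m≤n⇒0≤n-m {a} {b} p = subst (_≤ b - a) (+-inverseʳ a) (+-mono-≤ p (≤-refl { - a}))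

  m<n⇒0<n-m : ∀ {a b} → a < b → 0ℚ < b - a
  m<n⇒0<n-m {a} {b} p = subst (_< b - a) (+-inverseʳ a) (+-mono-<-≤ p (≤-refl { - a}))

  0≤1 : 0ℚ ≤ 1ℚ
  0≤1 = nonNegative⁻¹ 1ℚ

  0<1 : 0ℚ < 1ℚ
  0<1 = positive⁻¹ 1ℚ

  0<2 : 0ℚ < 2ℚ
  0<2 = positive⁻¹ 2ℚ

  0<4 : 0ℚ < 4ℚ
  0<4 = positive⁻¹ 4ℚ

  0≤2 : 0ℚ ≤ 2ℚ
  0≤2 = <⇒≤ 0<2

  0≤4 : 0ℚ ≤ 4ℚ
  0≤4 = <⇒≤ 0<4

  0≤+ : ∀ {a b} → 0ℚ ≤ a → 0ℚ ≤ b → 0ℚ ≤ a + b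
  0≤+ {a} {b} p q = ≤-trans p (≤-by b q refl)

  0<+ : ∀ {a b} → 0ℚ < a → 0ℚ ≤ b → 0ℚ < a + b
  0<+ {a} {b} p q = <-≤-trans p (≤-by b q refl)

  *-monoˡ-≤ : ∀ {c a b} → 0ℚ ≤ c → a ≤ b → c * a ≤ c * b
  *-monoˡ-≤ {c} 0≤c = ℚP.*-monoˡ-≤-nonNeg c {{ℚ.nonNegative 0≤c}}

  *-monoʳ-≤ : ∀ {c a b} → 0ℚ ≤ c → a ≤ b → a * c ≤ b * c
  *-monoʳ-≤ {c} 0≤c = ℚP.*-monoʳ-≤-nonNeg c {{ℚ.nonNegative 0≤c}}

  *-mono-≤ : ∀ {a b c d} → 0ℚ ≤ a → 0ℚ ≤ d → a ≤ b → c ≤ d → a * c ≤ b * d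
  *-mono-≤ 0≤a 0≤d p q = ≤-trans (*-monoˡ-≤ 0≤a q) (*-monoʳ-≤ 0≤d p)

  0≤* : ∀ {a b} → 0ℚ ≤ a → 0ℚ ≤ b → 0ℚ ≤ a * b
  0≤* {a} {b} p q = subst (_≤ a * b) (*-zeroʳ a) (*-monoˡ-≤ p q)

  *-monoˡ-< : ∀ {c a b} → 0ℚ < c → a < b → c * a < c * b
  *-monoˡ-< {c} 0<c = ℚP.*-monoʳ-<-pos c {{ℚ.positive 0<c}}

  0<* : ∀ {a b} → 0ℚ < a → 0ℚ < b → 0ℚ < a * b
  0<* {a} {b} p q = subst (_< a * b) (*-zeroʳ a) (*-monoˡ-< p q)

  *-cancelˡ-≤ : ∀ {c a b} → 0ℚ < c → c * a ≤ c * b → a ≤ b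
  *-cancelˡ-≤ {c} 0<c = ℚP.*-cancelˡ-≤-pos c {{ℚ.positive 0<c}}

  *-cancelʳ-≤ : ∀ {c a b} → 0ℚ < c → a * c ≤ b * c → a ≤ b
  *-cancelʳ-≤ {c} 0<c = ℚP.*-cancelʳ-≤-pos c {{ℚ.positive 0<c}}

  0≤-neg : ∀ {a} → a ≤ 0ℚ → 0ℚ ≤ - a
  0≤-neg = neg-antimono-≤

  neg-sq : ∀ a → (- a) * (- a) ≡ a * a
  neg-sq = solve-∀ ℚ-ring

  0≤sq : ∀ a → 0ℚ ≤ a * a
  0≤sq a with ≤-total 0ℚ a
  ... | inj₁ p = 0≤* p p
  ... | inj₂ p = subst (0ℚ ≤_) (neg-sq a) (0≤* (0≤-neg p) (0≤-neg p))

  0≤∧≢0⇒0< : ∀ {a} → 0ℚ ≤ a → a ≢ 0ℚ → 0ℚ < a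
  0≤∧≢0⇒0< p ne = ≰⇒> (λ q → ne (≤-antisym q p))

  ≢0⇒0<sq : ∀ {a} → a ≢ 0ℚ → 0ℚ < a * a
  ≢0⇒0<sq {a} ne with ≤-total 0ℚ a
  ... | inj₁ p = 0<* (0≤∧≢0⇒0< p ne) (0≤∧≢0⇒0< p ne)
  ... | inj₂ p = subst (0ℚ <_) (neg-sq a) (0<* q q)
    where
    e' : ∀ a → - (- a) ≡ a
    e' = solve-∀ ℚ-ring
    q : 0ℚ < - a
    q = 0≤∧≢0⇒0< (0≤-neg p) (λ z → ne (trans (sym (e' a)) (cong -_ z)))

  sq-mono-≤ : ∀ {a b} → 0ℚ ≤ a → a ≤ b → a * a ≤ b * b
  sq-mono-≤ p q = *-mono-≤ p (≤-trans p q) q q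

  sq-cancel-≤ : ∀ {a b} → 0ℚ ≤ b → a * a ≤ b * b → a ≤ b
  sq-cancel-≤ {a} {b} 0≤b p with a ≤? b
  ... | yes q = q
  ... | no ¬q = contradiction p (λ r → <-irrefl refl (≤-<-trans r (≤-<-trans (*-monoˡ-≤ 0≤b (<⇒≤ q)) (subst (_< a * a) (*-comm a b) (*-monoˡ-< (≤-<-trans 0≤b q) q)))))
    where
    q : b < a
    q = ≰⇒> ¬q

  ∣∣-sq : ∀ a → ∣ a ∣ * ∣ a ∣ ≡ a * a
  ∣∣-sq a with ∣p∣≡p∨∣p∣≡-p a
  ... | inj₁ e = cong₂ _*_ e e
  ... | inj₂ e = trans (cong₂ _*_ e e) (neg-sq a)

  sq≤⇒∣∣≤ : ∀ {a b} → 0ℚ ≤ b → a * a ≤ b * b → ∣ a ∣ ≤ b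
  sq≤⇒∣∣≤ {a} {b} p q = sq-cancel-≤ p (subst (_≤ b * b) (sym (∣∣-sq a)) q)

  ∣∣≤⇒sq≤ : ∀ {a b} → ∣ a ∣ ≤ b → a * a ≤ b * b
  ∣∣≤⇒sq≤ {a} {b} p = subst (_≤ b * b) (∣∣-sq a) (sq-mono-≤ (0≤∣p∣ a) p)

  ∣∣≤-intro : ∀ {a b} → a ≤ b → - a ≤ b → ∣ a ∣ ≤ b
  ∣∣≤-intro {a} p q with ∣p∣≡p∨∣p∣≡-p a
  ... | inj₁ e = subst (_≤ _) (sym e) p
  ... | inj₂ e = subst (_≤ _) (sym e) q

  p≤∣p∣ : ∀ a → a ≤ ∣ a ∣
  p≤∣p∣ a = sq-cancel-≤ (0≤∣p∣ a) (≤-reflexive (sym (∣∣-sq a)))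

  -p≤∣p∣ : ∀ a → - a ≤ ∣ a ∣
  -p≤∣p∣ a = subst (- a ≤_) (∣-p∣≡∣p∣ a) (p≤∣p∣ (- a))

  ∣p-q∣-sym : ∀ a b → ∣ a - b ∣ ≡ ∣ b - a ∣
  ∣p-q∣-sym a b = trans (cong ∣_∣ (e a b)) (∣-p∣≡∣p∣ (b - a))
    where
    e : ∀ a b → a - b ≡ - (b - a)
    e = solve-∀ ℚ-ring

  -- Inverses, the embedding of the integers, integer parts

  opaque
    -- inv 0 = 0
    inv : ℚ → ℚ
    inv a with a ≟ 0ℚ
    ... | yes _ = 0ℚ
    ... | no  p = (1/ a) {{ℚ.≢-nonZero p}}

    inv-r : ∀ {a} → a ≢ 0ℚ → a * inv a ≡ 1ℚ
    inv-r {a} ne with a ≟ 0ℚ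
    ... | yes e = contradiction e ne
    ... | no  p = ℚP.*-inverseʳ a {{ℚ.≢-nonZero p}}

    >⇒≢ : ∀ {a} → 0ℚ < a → a ≢ 0ℚ
    >⇒≢ p e = <-irrefl (sym e) p

    inv-r⁺ : ∀ {a} → 0ℚ < a → a * inv a ≡ 1ℚ
    inv-r⁺ p = inv-r (>⇒≢ p)

    0<inv : ∀ {a} → 0ℚ < a → 0ℚ < inv a
    0<inv {a} 0<a with inv a ≤? 0ℚ
    ... | no ¬p = ≰⇒> ¬p
    ... | yes p = contradiction (subst (_≤ 0ℚ) (inv-r⁺ 0<a) (subst (a * inv a ≤_) (*-zeroʳ a) (*-monoˡ-≤ (<⇒≤ 0<a) p))) (λ q → <-irrefl refl (<-≤-trans 0<1 q))

    0≤inv : ∀ {a} → 0ℚ ≤ a → 0ℚ ≤ inv a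
    0≤inv {a} p with a ≟ 0ℚ
    ... | yes _ = ≤-refl
    ... | no ne = <⇒≤ (subst (0ℚ <_) e (0<inv (0≤∧≢0⇒0< p ne)))
      where
      e : inv a ≡ (1/ a) {{ℚ.≢-nonZero ne}}
      e with a ≟ 0ℚ
      ... | yes z = contradiction z ne
      ... | no  _ = refl

  opaque
    ιᶻ : ℤ → ℚ
    ιᶻ z = fromℚᵘ (ℚᵘ.mkℚᵘ z 0)

    private
      u : ∀ z → toℚᵘ (ιᶻ z) ℚᵘ.≃ ℚᵘ.mkℚᵘ z 0
      u z = ℚP.toℚᵘ-fromℚᵘ (ℚᵘ.mkℚᵘ z 0)

    ιᶻ-+ : ∀ a b → ιᶻ (a ℤ.+ b) ≡ ιᶻ a + ιᶻ b
    ιᶻ-+ a b = ℚP.toℚᵘ-injective (ℚᵘP.≃-trans (u (a ℤ.+ b)) (ℚᵘP.≃-trans (ℚᵘ.*≡* e)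
        (ℚᵘP.≃-sym (ℚᵘP.≃-trans (ℚP.toℚᵘ-homo-+ (ιᶻ a) (ιᶻ b)) (ℚᵘP.+-cong (u a) (u b))))))
      where
      e : (a ℤ.+ b) ℤ.* (ℤ.+ 1) ≡ (a ℤ.* (ℤ.+ 1) ℤ.+ b ℤ.* (ℤ.+ 1)) ℤ.* (ℤ.+ 1)
      e = cong (ℤ._* (ℤ.+ 1)) (cong₂ ℤ._+_ (sym (ℤP.*-identityʳ a)) (sym (ℤP.*-identityʳ b)))

    ιᶻ-* : ∀ a b → ιᶻ (a ℤ.* b) ≡ ιᶻ a * ιᶻ b
    ιᶻ-* a b = ℚP.toℚᵘ-injective (ℚᵘP.≃-trans (u (a ℤ.* b)) (ℚᵘP.≃-trans (ℚᵘ.*≡* refl)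
        (ℚᵘP.≃-sym (ℚᵘP.≃-trans (ℚP.toℚᵘ-homo-* (ιᶻ a) (ιᶻ b)) (ℚᵘP.*-cong (u a) (u b))))))

    ιᶻ-0 : ιᶻ (ℤ.+ 0) ≡ 0ℚ
    ιᶻ-0 = refl

    ιᶻ-1 : ιᶻ (ℤ.+ 1) ≡ 1ℚ
    ιᶻ-1 = refl

    ιᶻ-mono : ∀ {a b} → a ℤ.≤ b → ιᶻ a ≤ ιᶻ b
    ιᶻ-mono {a} {b} p = ℚP.toℚᵘ-cancel-≤ (ℚᵘP.≤-trans (ℚᵘP.≤-reflexive (u a)) (ℚᵘP.≤-trans
        (ℚᵘ.*≤* (ℤP.*-monoʳ-≤-nonNeg (ℤ.+ 1) p)) (ℚᵘP.≤-reflexive (ℚᵘP.≃-sym (u b)))))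

    ιᶻ-cancel : ∀ {a b} → ιᶻ a ≤ ιᶻ b → a ℤ.≤ b
    ιᶻ-cancel {a} {b} p with ℚᵘP.≤-trans (ℚᵘP.≤-reflexive (ℚᵘP.≃-sym (u a))) (ℚᵘP.≤-trans (ℚP.toℚᵘ-mono-≤ p) (ℚᵘP.≤-reflexive (u b)))
    ... | ℚᵘ.*≤* q = subst₂ ℤ._≤_ (ℤP.*-identityʳ a) (ℤP.*-identityʳ b) q

    -- The denominator is at least 1, so the numerator is an integer upper bound; this makes ℚ
    -- archimedean.
    ≤ιᶻ↥ : ∀ q → 0ℚ ≤ q → q ≤ ιᶻ (↥ q)
    ≤ιᶻ↥ q@(mkℚ (ℤ.+ n) d c) 0≤q = ℚP.toℚᵘ-cancel-≤ (ℚᵘP.≤-trans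
        (ℚᵘ.*≤* (ℤP.*-monoˡ-≤-nonNeg (ℤ.+ n) {ℤ.+ 1} {ℤ.+ suc d} (ℤ.+≤+ (s≤s z≤n)))) (ℚᵘP.≤-reflexive (ℚᵘP.≃-sym (u (ℤ.+ n)))))
    ≤ιᶻ↥ q@(mkℚ -[1+ n ] d c) 0≤q = contradiction (ℚ.nonNegative 0≤q) (λ ())

    *↧≡↥ : ∀ q → q * ιᶻ (↧ q) ≡ ιᶻ (↥ q)
    *↧≡↥ q@(mkℚ n d c) = ℚP.toℚᵘ-injective (ℚᵘP.≃-trans (ℚP.toℚᵘ-homo-* q (ιᶻ (ℤ.+ suc d)))
        (ℚᵘP.≃-trans (ℚᵘP.*-cong {toℚᵘ q} ℚᵘP.≃-refl (u (ℤ.+ suc d))) (ℚᵘP.≃-trans (ℚᵘ.*≡* e) (ℚᵘP.≃-sym (u n)))))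
      where
      e : n ℤ.* (ℤ.+ suc d) ℤ.* (ℤ.+ 1) ≡ n ℤ.* ((ℤ.+ suc d) ℤ.* (ℤ.+ 1))
      e = ℤP.*-assoc n (ℤ.+ suc d) (ℤ.+ 1)

  ι : ℕ → ℚ
  ι n = ιᶻ (ℤ.+ n)

  ι-0 : ι 0 ≡ 0ℚ
  ι-0 = ιᶻ-0

  ι-1 : ι 1 ≡ 1ℚ
  ι-1 = ιᶻ-1

  ι-+ : ∀ a b → ι (a ℕ.+ b) ≡ ι a + ι b
  ι-+ a b = ιᶻ-+ (ℤ.+ a) (ℤ.+ b)

  ι-* : ∀ a b → ι (a ℕ.* b) ≡ ι a * ι b
  ι-* a b = trans (cong ιᶻ (ℤP.pos-* a b)) (ιᶻ-* (ℤ.+ a) (ℤ.+ b))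

  ι-suc : ∀ n → ι (suc n) ≡ 1ℚ + ι n
  ι-suc n = trans (ι-+ 1 n) (cong (_+ ι n) ι-1)

  ι-mono : ∀ {a b} → a ℕ.≤ b → ι a ≤ ι b
  ι-mono p = ιᶻ-mono (ℤ.+≤+ p)

  ι-cancel : ∀ {a b} → ι a ≤ ι b → a ℕ.≤ b
  ι-cancel p = ℤP.drop‿+≤+ (ιᶻ-cancel p)

  ι-cancel-< : ∀ {a b} → ι a < ι b → a ℕ.< b
  ι-cancel-< {a} {b} p with b ℕ.≤? a
  ... | yes q = contradiction (<-≤-trans p (ι-mono q)) (<-irrefl refl)
  ... | no ¬q = ℕP.≰⇒> ¬q

  0≤ι : ∀ n → 0ℚ ≤ ι n
  0≤ι n = subst (_≤ ι n) ι-0 (ι-mono z≤n)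

  1≤ι : ∀ {n} → 1 ℕ.≤ n → 1ℚ ≤ ι n
  1≤ι {n} p = subst (_≤ ι n) ι-1 (ι-mono p)

  0<ι : ∀ {n} → 1 ℕ.≤ n → 0ℚ < ι n
  0<ι p = <-≤-trans 0<1 (1≤ι p)

  ι-2 : ι 2 ≡ 2ℚ
  ι-2 = trans (ι-+ 1 1) (cong₂ _+_ ι-1 ι-1)

  ι-4 : ι 4 ≡ 4ℚ
  ι-4 = trans (ι-+ 2 2) (cong₂ _+_ ι-2 ι-2)

  archimedean : ∀ q → Σ[ n ∈ ℕ ] q ≤ ι n
  archimedean q with ≤-total 0ℚ q
  ... | inj₂ p = 0 , subst (q ≤_) (sym ι-0) p
  ... | inj₁ p with ↥ q | ≤ιᶻ↥ q p
  ...   | ℤ.+ n      | r = n , r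
  ...   | -[1+ n ] | r = 0 , ≤-trans r (ιᶻ-mono ℤ.-≤+)

  floorℕ-below : ∀ b q → q < ι b → Σ[ k ∈ ℕ ] (k ≡ 0 ⊎ ι k ≤ q) × q < 1ℚ + ι k
  floorℕ-below zero q p = 0 , inj₁ refl , <-trans p (<-by 1ℚ 0<1 (+-comm 1ℚ (ι 0)))
  floorℕ-below (suc b) q p with q <? ι b
  ... | yes r = floorℕ-below b q r
  ... | no ¬r = b , inj₂ (≮⇒≥ ¬r) , subst (q <_) (ι-suc b) p

  floorℕ-spec : ∀ q → Σ[ k ∈ ℕ ] (k ≡ 0 ⊎ ι k ≤ q) × q < 1ℚ + ι k
  floorℕ-spec q with archimedean q
  ... | n , p = floorℕ-below (suc n) q (≤-<-trans p (<-by 1ℚ 0<1 (trans (ι-suc n) (+-comm 1ℚ (ι n)))))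

  opaque
    -- floorℕ q = 0 for negative q
    floorℕ : ℚ → ℕ
    floorℕ q = proj₁ (floorℕ-spec q)

    floorℕ-cases : ∀ q → floorℕ q ≡ 0 ⊎ ι (floorℕ q) ≤ q
    floorℕ-cases q = proj₁ (proj₂ (floorℕ-spec q))

    floorℕ-≤ : ∀ {q} → 0ℚ ≤ q → ι (floorℕ q) ≤ q
    floorℕ-≤ {q} 0≤q with floorℕ-cases q
    ... | inj₁ e = subst (_≤ q) (sym (trans (cong ι e) ι-0)) 0≤q
    ... | inj₂ p = p

    <floorℕ : ∀ q → q < 1ℚ + ι (floorℕ q)
    <floorℕ q = proj₂ (proj₂ (floorℕ-spec q))

  -- Powers and square roots

  infixr 8 _^_
  _^_ : ℚ → ℕ → ℚ
  a ^ zero  = 1ℚ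
  a ^ suc n = a * a ^ n

  0≤^ : ∀ {a} n → 0ℚ ≤ a → 0ℚ ≤ a ^ n
  0≤^ zero    p = 0≤1
  0≤^ (suc n) p = 0≤* p (0≤^ n p)

  0<^ : ∀ {a} n → 0ℚ < a → 0ℚ < a ^ n
  0<^ zero    p = 0<1
  0<^ (suc n) p = 0<* p (0<^ n p)

  ^-mono-≤ : ∀ {a b} n → 0ℚ ≤ a → a ≤ b → a ^ n ≤ b ^ n
  ^-mono-≤ zero    p q = ≤-refl
  ^-mono-≤ (suc n) p q = *-mono-≤ p (0≤^ n (≤-trans p q)) q (^-mono-≤ n p q)

  *-^ : ∀ a b n → (a * b) ^ n ≡ a ^ n * b ^ n
  *-^ a b zero    = refl
  *-^ a b (suc n) = trans (cong (a * b *_) (*-^ a b n)) (e a b (a ^ n) (b ^ n))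
    where
    e : ∀ a b c d → a * b * (c * d) ≡ a * c * (b * d)
    e = solve-∀ ℚ-ring

  ^-+ : ∀ a m n → a ^ (m ℕ.+ n) ≡ a ^ m * a ^ n
  ^-+ a zero    n = sym (*-identityˡ _)
  ^-+ a (suc m) n = trans (cong (a *_) (^-+ a m n)) (sym (*-assoc a (a ^ m) (a ^ n)))

  1^ : ∀ n → 1ℚ ^ n ≡ 1ℚ
  1^ zero = refl
  1^ (suc n) = trans (*-identityˡ _) (1^ n)

  -- Takes the place of extracting a root, which may be irrational.
  ^-cancel-≤ : ∀ {a b} n → 0ℚ ≤ b → a ^ suc n ≤ b ^ suc n → a ≤ b
  ^-cancel-≤ {a} {b} n 0≤b p with a ≤? b
  ... | yes q = q
  ... | no ¬q = contradiction p (λ r → <-irrefl refl (≤-<-trans r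
        (≤-<-trans (*-monoˡ-≤ 0≤b (^-mono-≤ n 0≤b (<⇒≤ q)))
          (subst₂ _<_ (*-comm (a ^ n) b) (*-comm (a ^ n) a) (*-monoˡ-< (0<^ n (≤-<-trans 0≤b q)) q)))))
    where
    q : b < a
    q = ≰⇒> ¬q

  ι-^ : ∀ a n → ι (a ℕ.^ n) ≡ ι a ^ n
  ι-^ a zero    = ι-1
  ι-^ a (suc n) = trans (ι-* a (a ℕ.^ n)) (cong (ι a *_) (ι-^ a n))

  -- Turns the first-order growth 1 + p κ τ of the potential into a p-th power, the form in which
  -- the budget of the walk is kept.
  bernoulli : ∀ a n → 0ℚ ≤ a → 1ℚ + ι n * a ≤ (1ℚ + a) ^ n
  bernoulli a zero    p = ≤-reflexive (trans (cong (λ z → 1ℚ + z * a) ι-0) (e a))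
    where
    e : ∀ a → 1ℚ + 0ℚ * a ≡ 1ℚ
    e = solve-∀ ℚ-ring
  bernoulli a (suc n) p = ≤-trans (≤-by (ι n * (a * a)) (0≤* (0≤ι n) (0≤sq a)) (trans (e a (ι n)) (cong (λ z → 1ℚ + z * a + ι n * (a * a)) (sym (ι-suc n)))))
    (*-monoˡ-≤ (0≤+ 0≤1 p) (bernoulli a n p))
    where
    e : ∀ a b → (1ℚ + a) * (1ℚ + b * a) ≡ 1ℚ + (1ℚ + b) * a + b * (a * a)
    e = solve-∀ ℚ-ring

  isqrt : ∀ n → Σ[ e ∈ ℕ ] (e ℕ.* e ℕ.≤ n) × (n ℕ.< suc e ℕ.* suc e)
  isqrt zero = 0 , z≤n , s≤s z≤n
  isqrt (suc n) with isqrt n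
  ... | e , p , q with suc e ℕ.* suc e ℕ.≤? suc n
  ...   | yes r = suc e , r , s≤s (ℕP.≤-trans q (ℕP.≤-trans (ℕP.*-monoˡ-≤ (suc e) (ℕP.n≤1+n (suc e))) (ℕP.≤-trans (ℕP.m≤n+m _ (suc e)) (ℕP.≤-reflexive (h e)))))
    where
    h : ∀ e → suc e ℕ.+ suc (suc e) ℕ.* suc e ≡ suc e ℕ.+ suc e ℕ.* suc (suc e)
    h = ℕ-solve-∀
  ...   | no ¬r = e , ℕP.m≤n⇒m≤1+n p , ℕP.≰⇒> ¬r

  -- For D = a / b take g = e / b, where e is the integer square root of a b. As e ≥ 1, also e + 1 ≤
  -- 2e, which accounts for the factor 4.
  √-approx : ∀ {D} → 0ℚ < D → Σ[ g ∈ ℚ ] 0ℚ < g × g * g ≤ D × D ≤ 4ℚ * (g * g)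
  √-approx {q@(mkℚ -[1+ a ] d c)} 0<q = contradiction (≤-trans (<⇒≤ 0<q) ≤-refl) (λ r → negative≢ (ℚ.nonNegative r))
    where
    negative≢ : ¬ ℚ.NonNegative q
    negative≢ ()
  √-approx {q@(mkℚ (ℤ.+ a) d c)} 0<q = g , 0<* 0<e (0<inv 0<b) , g²≤q , q≤4g²
    where
    b e : ℕ
    b = suc d
    e = proj₁ (isqrt (a ℕ.* b))
    0<b : 0ℚ < ι b
    0<b = 0<ι (s≤s z≤n)
    qb≡a : q * ι b ≡ ι a
    qb≡a = *↧≡↥ q
    0<a : 0ℚ < ι a
    0<a = subst (0ℚ <_) qb≡a (0<* 0<q 0<b)
    1≤ab : 1 ℕ.≤ a ℕ.* b
    1≤ab = go a 0<a
      where
      go : ∀ a → 0ℚ < ι a → 1 ℕ.≤ a ℕ.* b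
      go zero    p = contradiction (subst (0ℚ <_) ι-0 p) (<-irrefl refl)
      go (suc _) p = s≤s z≤n
    1≤e : 1 ℕ.≤ e
    1≤e with e | proj₂ (proj₂ (isqrt (a ℕ.* b)))
    ... | zero  | p = contradiction (ℕP.≤-trans (s≤s 1≤ab) p) (λ { (s≤s ()) })
    ... | suc _ | _ = s≤s z≤n
    0<e : 0ℚ < ι e
    0<e = 0<ι 1≤e
    g : ℚ
    g = ι e * inv (ι b)
    gb≡e : g * ι b ≡ ι e
    gb≡e = trans (*-assoc (ι e) (inv (ι b)) (ι b)) (trans (cong (ι e *_) (trans (*-comm (inv (ι b)) (ι b)) (inv-r⁺ 0<b))) (*-identityʳ (ι e)))
    r₁ : ∀ g b → g * g * (b * b) ≡ (g * b) * (g * b)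
    r₁ = solve-∀ ℚ-ring
    r₂ : ∀ q b → q * (b * b) ≡ (q * b) * b
    r₂ = solve-∀ ℚ-ring
    r₃ : ∀ g b → 4ℚ * (g * g) * (b * b) ≡ 4ℚ * ((g * b) * (g * b))
    r₃ = solve-∀ ℚ-ring
    r₄ : ∀ e → (e + e) * (e + e) ≡ 4ℚ * (e * e)
    r₄ = solve-∀ ℚ-ring
    qbb : q * (ι b * ι b) ≡ ι (a ℕ.* b)
    qbb = trans (r₂ q (ι b)) (trans (cong (_* ι b) qb≡a) (sym (ι-* a b)))
    g²≤q : g * g ≤ q
    g²≤q = *-cancelʳ-≤ (0<* 0<b 0<b) (subst₂ _≤_ (trans (ι-* e e) (sym (trans (r₁ g (ι b)) (cong₂ _*_ gb≡e gb≡e)))) (sym qbb) (ι-mono (proj₁ (proj₂ (isqrt (a ℕ.* b))))))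
    ab≤ : a ℕ.* b ℕ.≤ (e ℕ.+ e) ℕ.* (e ℕ.+ e)
    ab≤ = ℕP.≤-trans (ℕP.<⇒≤ (proj₂ (proj₂ (isqrt (a ℕ.* b))))) (ℕP.*-mono-≤ (ℕP.+-monoˡ-≤ e 1≤e) (ℕP.+-monoˡ-≤ e 1≤e))
    q≤4g² : q ≤ 4ℚ * (g * g)
    q≤4g² = *-cancelʳ-≤ (0<* 0<b 0<b) (subst₂ _≤_ (sym qbb)
      (trans (ι-* (e ℕ.+ e) (e ℕ.+ e)) (trans (cong₂ _*_ (ι-+ e e) (ι-+ e e)) (trans (r₄ (ι e)) (sym (trans (r₃ g (ι b)) (cong (4ℚ *_) (cong₂ _*_ gb≡e gb≡e)))))))
      (ι-mono ab≤))

  -- Finite sums and products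

  ∑ : ∀ {n} → (Fin n → ℚ) → ℚ
  ∑ {zero}  f = 0ℚ
  ∑ {suc n} f = f zero + ∑ (f ∘ suc)

  ∏ : ∀ {n} → (Fin n → ℚ) → ℚ
  ∏ {zero}  f = 1ℚ
  ∏ {suc n} f = f zero * ∏ (f ∘ suc)

  ∑-cong : ∀ {n} {f g : Fin n → ℚ} → (∀ i → f i ≡ g i) → ∑ f ≡ ∑ g
  ∑-cong {zero}  e = refl
  ∑-cong {suc n} e = cong₂ _+_ (e zero) (∑-cong (e ∘ suc))

  ∑-lin : ∀ {n} a (f : Fin n → ℚ) b (g : Fin n → ℚ) → ∑ (λ i → a * f i + b * g i) ≡ a * ∑ f + b * ∑ g
  ∑-lin {zero}  a f b g = e a b
    where
    e : ∀ a b → 0ℚ ≡ a * 0ℚ + b * 0ℚ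
    e = solve-∀ ℚ-ring
  ∑-lin {suc n} a f b g = trans (cong ((a * f zero + b * g zero) +_) (∑-lin a (f ∘ suc) b (g ∘ suc))) (e a b (f zero) (g zero) (∑ (f ∘ suc)) (∑ (g ∘ suc)))
    where
    e : ∀ a b x y s t → a * x + b * y + (a * s + b * t) ≡ a * (x + s) + b * (y + t)
    e = solve-∀ ℚ-ring

  ∑-+ : ∀ {n} (f g : Fin n → ℚ) → ∑ (λ i → f i + g i) ≡ ∑ f + ∑ g
  ∑-+ f g = trans (∑-cong (λ i → sym (cong₂ _+_ (*-identityˡ (f i)) (*-identityˡ (g i))))) (trans (∑-lin 1ℚ f 1ℚ g) (cong₂ _+_ (*-identityˡ (∑ f)) (*-identityˡ (∑ g))))

  ∑-*ˡ : ∀ {n} c (f : Fin n → ℚ) → ∑ (λ i → c * f i) ≡ c * ∑ f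
  ∑-*ˡ {zero}  c f = sym (*-zeroʳ c)
  ∑-*ˡ {suc n} c f = trans (cong ((c * f zero) +_) (∑-*ˡ c (f ∘ suc))) (sym (*-distribˡ-+ c (f zero) (∑ (f ∘ suc))))

  ∑-0 : ∀ {n} {f : Fin n → ℚ} → (∀ i → f i ≡ 0ℚ) → ∑ f ≡ 0ℚ
  ∑-0 {zero}  e = refl
  ∑-0 {suc n} e = trans (cong₂ _+_ (e zero) (∑-0 (e ∘ suc))) (+-identityˡ 0ℚ)

  ∑-mono : ∀ {n} {f g : Fin n → ℚ} → (∀ i → f i ≤ g i) → ∑ f ≤ ∑ g
  ∑-mono {zero}  p = ≤-refl
  ∑-mono {suc n} p = +-mono-≤ (p zero) (∑-mono (p ∘ suc))

  0≤∑ : ∀ {n} {f : Fin n → ℚ} → (∀ i → 0ℚ ≤ f i) → 0ℚ ≤ ∑ f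
  0≤∑ {zero}  p = ≤-refl
  0≤∑ {suc n} p = 0≤+ (p zero) (0≤∑ (p ∘ suc))

  ∑-swap : ∀ {m n} (f : Fin m → Fin n → ℚ) → ∑ (λ i → ∑ (f i)) ≡ ∑ (λ j → ∑ (λ i → f i j))
  ∑-swap {zero}  {n} f = sym (∑-0 {n} (λ _ → refl))
  ∑-swap {suc m} {n} f = trans (cong (∑ (f zero) +_) (∑-swap (f ∘ suc))) (sym (∑-+ (f zero) (λ j → ∑ (λ i → f (suc i) j))))

  ∑-const : ∀ n c → ∑ {n} (λ _ → c) ≡ ι n * c
  ∑-const zero    c = trans (sym (*-zeroˡ c)) (cong (_* c) (sym ι-0))
  ∑-const (suc n) c = trans (cong (c +_) (∑-const n c)) (trans (e c (ι n)) (cong (_* c) (sym (ι-suc n))))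
    where
    e : ∀ c n → c + n * c ≡ (1ℚ + n) * c
    e = solve-∀ ℚ-ring

  ∑-punchIn : ∀ {n} i (f : Fin (suc n) → ℚ) → ∑ f ≡ f i + ∑ (f ∘ punchIn i)
  ∑-punchIn zero f = refl
  ∑-punchIn {suc n} (suc i) f = trans (cong (f zero +_) (∑-punchIn i (f ∘ suc))) (e (f zero) (f (suc i)) (∑ (f ∘ suc ∘ punchIn i)))
    where
    e : ∀ a b c → a + (b + c) ≡ b + (a + c)
    e = solve-∀ ℚ-ring

  ∑-single : ∀ {n} i (f : Fin n → ℚ) → (∀ j → j ≢ i → f j ≡ 0ℚ) → ∑ f ≡ f i
  ∑-single {suc n} i f z = trans (∑-punchIn i f) (trans (cong (f i +_) (∑-0 (λ j → z (punchIn i j) (FinP.punchInᵢ≢i i j)))) (+-identityʳ (f i)))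

  ∑-term≤ : ∀ {n} {f : Fin n → ℚ} → (∀ i → 0ℚ ≤ f i) → ∀ i → f i ≤ ∑ f
  ∑-term≤ {suc n} {f} p i = ≤-by (∑ (f ∘ punchIn i)) (0≤∑ (λ j → p (punchIn i j))) (∑-punchIn i f)

  ∑≤0⇒≡0 : ∀ {n} {f : Fin n → ℚ} → (∀ i → 0ℚ ≤ f i) → ∑ f ≤ 0ℚ → ∀ i → f i ≡ 0ℚ
  ∑≤0⇒≡0 p q i = ≤-antisym (≤-trans (∑-term≤ p i) q) (p i)

  ∣∑∣≤∑∣∣ : ∀ {n} (f : Fin n → ℚ) → ∣ ∑ f ∣ ≤ ∑ (λ i → ∣ f i ∣)
  ∣∑∣≤∑∣∣ {zero}  f = ≤-refl
  ∣∑∣≤∑∣∣ {suc n} f = ≤-trans (∣p+q∣≤∣p∣+∣q∣ (f zero) (∑ (f ∘ suc))) (+-mono-≤ (≤-refl {∣ f zero ∣}) (∣∑∣≤∑∣∣ (f ∘ suc)))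

  ∏-cong : ∀ {n} {f g : Fin n → ℚ} → (∀ i → f i ≡ g i) → ∏ f ≡ ∏ g
  ∏-cong {zero}  e = refl
  ∏-cong {suc n} e = cong₂ _*_ (e zero) (∏-cong (e ∘ suc))

  ∏-* : ∀ {n} (f g : Fin n → ℚ) → ∏ (λ i → f i * g i) ≡ ∏ f * ∏ g
  ∏-* {zero}  f g = refl
  ∏-* {suc n} f g = trans (cong (f zero * g zero *_) (∏-* (f ∘ suc) (g ∘ suc))) (e (f zero) (g zero) (∏ (f ∘ suc)) (∏ (g ∘ suc)))
    where
    e : ∀ a b c d → a * b * (c * d) ≡ a * c * (b * d)
    e = solve-∀ ℚ-ring

  ∏-const : ∀ n c → ∏ {n} (λ _ → c) ≡ c ^ n
  ∏-const zero    c = refl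
  ∏-const (suc n) c = cong (c *_) (∏-const n c)

  0≤∏ : ∀ {n} {f : Fin n → ℚ} → (∀ i → 0ℚ ≤ f i) → 0ℚ ≤ ∏ f
  0≤∏ {zero}  p = 0≤1
  0≤∏ {suc n} p = 0≤* (p zero) (0≤∏ (p ∘ suc))

  0<∏ : ∀ {n} {f : Fin n → ℚ} → (∀ i → 0ℚ < f i) → 0ℚ < ∏ f
  0<∏ {zero}  p = 0<1
  0<∏ {suc n} p = 0<* (p zero) (0<∏ (p ∘ suc))

  ∏-mono : ∀ {n} {f g : Fin n → ℚ} → (∀ i → 0ℚ ≤ f i) → (∀ i → f i ≤ g i) → ∏ f ≤ ∏ g
  ∏-mono {zero}  p q = ≤-refl
  ∏-mono {suc n} p q = *-mono-≤ (p zero) (≤-trans (0≤∏ (p ∘ suc)) (∏-mono (p ∘ suc) (q ∘ suc))) (q zero) (∏-mono (p ∘ suc) (q ∘ suc))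

  weighted-average-< : ∀ {n} (w f : Fin n → ℚ) c → (∀ i → 0ℚ ≤ w i) →
    c * ∑ w < ∑ (λ i → w i * f i) → ∃ λ i → c < f i
  weighted-average-< w f c 0≤w p with FinP.any? (λ i → c <? f i)
  ... | yes q = q
  ... | no ¬q = contradiction (≤-<-trans (≤-trans (∑-mono (λ i → subst (w i * f i ≤_) (*-comm (w i) c) (*-monoˡ-≤ (0≤w i) (≮⇒≥ (λ r → ¬q (i , r)))))) (≤-reflexive (∑-*ˡ c w))) p) (<-irrefl refl)

  ∑-mono-< : ∀ {n} {f g : Fin (suc n) → ℚ} → (∀ i → f i < g i) → ∑ f < ∑ g
  ∑-mono-< p = +-mono-<-≤ (p zero) (∑-mono (λ i → <⇒≤ (p (suc i))))

  average-≤ : ∀ {n} (f : Fin (suc n) → ℚ) c → ι (suc n) * c ≤ ∑ f → ∃ λ i → c ≤ f i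
  average-≤ {n} f c p with FinP.any? (λ i → c ≤? f i)
  ... | yes q = q
  ... | no ¬q = contradiction (≤-<-trans p (subst (∑ f <_) (∑-const (suc n) c) (∑-mono-< (λ i → ≰⇒> (λ r → ¬q (i , r)))))) (<-irrefl refl)

  -- Vectors and inner products

  V : ℕ → Set
  V n = Fin n → ℚ

  opaque
    dot : ∀ {n} → V n → V n → ℚ
    dot u v = ∑ (λ i → u i * v i)

    dot-def : ∀ {n} (u v : V n) → dot u v ≡ ∑ (λ i → u i * v i)
    dot-def u v = refl

  dot-comm : ∀ {n} (u v : V n) → dot u v ≡ dot v u
  dot-comm u v = trans (dot-def u v) (trans (∑-cong (λ i → *-comm (u i) (v i))) (sym (dot-def v u)))

  lin : ∀ {n} → ℚ → V n → ℚ → V n → V n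
  lin a u b v i = a * u i + b * v i

  dot-linˡ : ∀ {n} a (u : V n) b v w → dot (lin a u b v) w ≡ a * dot u w + b * dot v w
  dot-linˡ a u b v w = trans (dot-def (lin a u b v) w) (trans (∑-cong (λ i → e a b (u i) (v i) (w i))) (trans (∑-lin a (λ i → u i * w i) b (λ i → v i * w i)) (sym (cong₂ (λ x y → a * x + b * y) (dot-def u w) (dot-def v w)))))
    where
    e : ∀ a b u v w → (a * u + b * v) * w ≡ a * (u * w) + b * (v * w)
    e = solve-∀ ℚ-ring

  dot-linʳ : ∀ {n} w a (u : V n) b v → dot w (lin a u b v) ≡ a * dot w u + b * dot w v
  dot-linʳ w a u b v = trans (dot-comm w _) (trans (dot-linˡ a u b v w) (cong₂ _+_ (cong (a *_) (dot-comm u w)) (cong (b *_) (dot-comm v w))))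

  norm² : ∀ {n} → V n → ℚ
  norm² u = dot u u

  0≤norm² : ∀ {n} (u : V n) → 0ℚ ≤ norm² u
  0≤norm² u = subst (0ℚ ≤_) (sym (dot-def u u)) (0≤∑ (λ i → 0≤sq (u i)))

  norm²-lin : ∀ {n} a (u : V n) b v → norm² (lin a u b v) ≡ a * a * norm² u + 2ℚ * (a * b) * dot u v + b * b * norm² v
  norm²-lin a u b v = trans (dot-linˡ a u b v (lin a u b v)) (trans (cong₂ (λ x y → a * x + b * y) (dot-linʳ u a u b v) (trans (dot-linʳ v a u b v) (cong (λ z → a * z + b * norm² v) (dot-comm v u)))) (e a b (norm² u) (dot u v) (norm² v)))
    where
    e : ∀ a b x y z → a * (a * x + b * y) + b * (a * y + b * z) ≡ a * a * x + 2ℚ * (a * b) * y + b * b * z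
    e = solve-∀ ℚ-ring

  cauchy-schwarz : ∀ {n} (u v : V n) → dot u v * dot u v ≤ norm² u * norm² v
  cauchy-schwarz u v with norm² v ≤? 0ℚ
  ... | yes p = ≤-reflexive (trans (cong₂ _*_ z z) (sym (trans (cong (norm² u *_) (≤-antisym p (0≤norm² v))) (*-zeroʳ (norm² u)))))
    where
    v≡0 : ∀ i → v i ≡ 0ℚ
    v≡0 i with v i ≟ 0ℚ
    ... | yes q = q
    ... | no ¬q = contradiction (∑≤0⇒≡0 (λ j → 0≤sq (v j)) (subst (_≤ 0ℚ) (dot-def v v) p) i) (>⇒≢ (≢0⇒0<sq ¬q))
    z : dot u v ≡ 0ℚ
    z = trans (dot-def u v) (∑-0 (λ i → trans (cong (u i *_) (v≡0 i)) (*-zeroʳ (u i))))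
  ... | no ¬p = *-cancelˡ-≤ (≰⇒> ¬p) (≤-by _ (0≤norm² (lin (norm² v) u (- dot u v) v)) (trans (e (norm² u) (norm² v) (dot u v)) (cong ((norm² v * (dot u v * dot u v)) +_) (sym (norm²-lin (norm² v) u (- dot u v) v)))))
    where
    e : ∀ x z y → z * (x * z) ≡ z * (y * y) + (z * z * x + 2ℚ * (z * (- y)) * y + (- y) * (- y) * z)
    e = solve-∀ ℚ-ring

  δ : ∀ {n} → Fin n → V n
  δ zero    zero    = 1ℚ
  δ zero    (suc i) = 0ℚ
  δ (suc j) zero    = 0ℚ
  δ (suc j) (suc i) = δ j i

  dot-δ : ∀ {n} (j : Fin n) v → dot (δ j) v ≡ v j
  dot-δ {suc n} zero v = trans (dot-def (δ zero) v) (trans (cong₂ _+_ (*-identityˡ (v zero)) (∑-0 (λ i → *-zeroˡ (v (suc i))))) (+-identityʳ (v zero)))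
  dot-δ {suc n} (suc j) v = trans (dot-def (δ (suc j)) v) (trans (cong₂ _+_ (*-zeroˡ (v zero)) (trans (sym (dot-def (δ j) (v ∘ suc))) (dot-δ j (v ∘ suc)))) (+-identityˡ _))

  δ-refl : ∀ {n} (j : Fin n) → δ j j ≡ 1ℚ
  δ-refl zero    = refl
  δ-refl (suc j) = δ-refl j

  δ-≢ : ∀ {n} {i j : Fin n} → i ≢ j → δ i j ≡ 0ℚ
  δ-≢ {i = zero}  {zero}  ne = contradiction refl ne
  δ-≢ {i = zero}  {suc j} ne = refl
  δ-≢ {i = suc i} {zero}  ne = refl
  δ-≢ {i = suc i} {suc j} ne = δ-≢ (ne ∘ cong suc)

  -- Orthogonal families over ℚ

  record Orth {n k} (u : Fin k → V n) : Set where
    constructor mkOrth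
    field
      pos  : ∀ a → 0ℚ < norm² (u a)
      perp : ∀ a b → a ≢ b → dot (u a) (u b) ≡ 0ℚ

  open Orth public

  -- Span as a double annihilator: no coefficients have to be carried around.
  Span : ∀ {n k} → (Fin k → V n) → V n → Set
  Span u v = ∀ f → (∀ a → dot f (u a) ≡ 0ℚ) → dot f v ≡ 0ℚ

  coef : ∀ {n k} → (Fin k → V n) → V n → Fin k → ℚ
  coef u l a = dot l (u a) * inv (norm² (u a))

  proj : ∀ {n k} → (Fin k → V n) → V n → V n
  proj u l i = ∑ (λ a → coef u l a * u a i)

  -- For orthogonal `u` this is the squared length of the projection of `l` to the span; for
  -- `l = δ j` it is the leverage score of column `j`.
  lev : ∀ {n k} → (Fin k → V n) → V n → ℚ
  lev u l = ∑ (λ a → dot l (u a) * dot l (u a) * inv (norm² (u a)))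

  dot-proj : ∀ {n k} (u : Fin k → V n) l f → dot f (proj u l) ≡ ∑ (λ a → coef u l a * dot f (u a))
  dot-proj u l f = trans (dot-def f (proj u l)) (trans (∑-cong (λ i → sym (∑-*ˡ (f i) (λ a → coef u l a * u a i)))) (trans (∑-swap (λ i a → f i * (coef u l a * u a i)))
    (∑-cong (λ a → trans (∑-cong (λ i → e (f i) (coef u l a) (u a i))) (trans (∑-*ˡ (coef u l a) (λ i → f i * u a i)) (cong (coef u l a *_) (sym (dot-def f (u a)))))))))
    where
    e : ∀ a b c → a * (b * c) ≡ b * (a * c)
    e = solve-∀ ℚ-ring

  span-proj : ∀ {n k} (u : Fin k → V n) l → Span u (proj u l)
  span-proj u l f z = trans (dot-proj u l f) (∑-0 (λ a → trans (cong (coef u l a *_) (z a)) (*-zeroʳ (coef u l a))))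

  span-trans : ∀ {n k j} {u : Fin k → V n} {u′ : Fin j → V n} {v} → (∀ a → Span u (u′ a)) → Span u′ v → Span u v
  span-trans p q f z = q f (λ a → p a f z)

  span-member : ∀ {n k} (u : Fin k → V n) a → Span u (u a)
  span-member u a f z = z a

  0≤lev-term : ∀ {n k} (u : Fin k → V n) → ∀ l a → 0ℚ ≤ dot l (u a) * dot l (u a) * inv (norm² (u a))
  0≤lev-term u l a = 0≤* (0≤sq (dot l (u a))) (0≤inv (0≤norm² (u a)))

  0≤lev : ∀ {n k} (u : Fin k → V n) l → 0ℚ ≤ lev u l
  0≤lev u l = 0≤∑ (0≤lev-term u l)

  dot-lev : ∀ {n k} (u : Fin k → V n) l → dot l (proj u l) ≡ lev u l
  dot-lev u l = trans (dot-proj u l l) (∑-cong (λ a → e (dot l (u a)) (inv (norm² (u a)))))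
    where
    e : ∀ a b → a * b * a ≡ a * a * b
    e = solve-∀ ℚ-ring

  module _ {n k} {u : Fin k → V n} (orth : Orth u) where

    dot-proj-member : ∀ l b → dot (u b) (proj u l) ≡ dot l (u b)
    dot-proj-member l b = trans (dot-proj u l (u b)) (trans (∑-single b _ (λ a a≢b → trans (cong (coef u l a *_) (perp orth b a (λ e → a≢b (sym e)))) (*-zeroʳ (coef u l a))))
      (trans (e (dot l (u b)) (inv (norm² (u b))) (norm² (u b))) (trans (cong (dot l (u b) *_) (inv-r⁺ (pos orth b))) (*-identityʳ _))))
      where
      e : ∀ a b c → a * b * c ≡ a * (c * b)
      e = solve-∀ ℚ-ring

    -- The vector `proj u d - d` annihilates every `u a`, hence by the definition of `Span` also
    -- `v`.
    dot-span-proj : ∀ d {v} → Span u v → dot (proj u d) v ≡ dot d v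
    dot-span-proj d {v} s = trans (e₁ (dot (proj u d) v) (dot d v)) (trans (cong (dot d v +_) (trans (sym (dot-linˡ 1ℚ (proj u d) (- 1ℚ) d v)) (s _ (λ a → trans (dot-linˡ 1ℚ (proj u d) (- 1ℚ) d (u a)) (trans (cong (λ z → 1ℚ * z + - 1ℚ * dot d (u a)) (trans (dot-comm (proj u d) (u a)) (dot-proj-member d a))) (e₂ (dot d (u a)))))))) (+-identityʳ (dot d v)))
      where
      e₁ : ∀ x y → x ≡ y + (1ℚ * x + - 1ℚ * y)
      e₁ = solve-∀ ℚ-ring
      e₂ : ∀ x → 1ℚ * x + - 1ℚ * x ≡ 0ℚ
      e₂ = solve-∀ ℚ-ring

    norm²-proj : ∀ l → norm² (proj u l) ≡ lev u l
    norm²-proj l = trans (dot-span-proj l (span-proj u l)) (dot-lev u l)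

    bessel : ∀ l → lev u l ≤ norm² l
    bessel l = ≤-by _ (0≤norm² (lin 1ℚ l (- 1ℚ) (proj u l))) (trans (e (norm² l) (lev u l)) (cong (lev u l +_) (sym (trans (norm²-lin 1ℚ l (- 1ℚ) (proj u l)) (cong₂ (λ x y → 1ℚ * 1ℚ * norm² l + 2ℚ * (1ℚ * - 1ℚ) * x + - 1ℚ * - 1ℚ * y) (dot-lev u l) (norm²-proj l))))))
      where
      e : ∀ x y → x ≡ y + (1ℚ * 1ℚ * x + 2ℚ * (1ℚ * - 1ℚ) * y + - 1ℚ * - 1ℚ * y)
      e = solve-∀ ℚ-ring

  orth-tail : ∀ {n k} {u : Fin (suc k) → V n} → Orth u → Orth (u ∘ suc)
  orth-tail (mkOrth p q) = mkOrth (λ a → p (suc a)) (λ a b ne → q (suc a) (suc b) (λ e → ne (FinP.suc-injective e)))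

  orth-cons : ∀ {n k} {w} {u : Fin k → V n} → 0ℚ < norm² w → (∀ a → dot w (u a) ≡ 0ℚ) → Orth u → Orth (w VF.∷ u)
  orth-cons {w = w} {u} pw z (mkOrth p q) = mkOrth (λ { zero → pw ; (suc a) → p a })
    λ { zero zero ne → contradiction refl ne
      ; zero (suc b) _ → z b
      ; (suc a) zero _ → trans (dot-comm (u a) w) (z a)
      ; (suc a) (suc b) ne → q a b (ne ∘ cong suc) }

  orth-δ : ∀ {n} → Orth (δ {n})
  orth-δ = mkOrth (λ a → subst (0ℚ <_) (sym (trans (dot-δ a (δ a)) (δ-refl a))) 0<1) (λ a b ne → trans (dot-δ a (δ b)) (δ-≢ (λ e → ne (sym e))))

  -- Intersects the span with the hyperplane orthogonal to `l`. If `l` is orthogonal to the tail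
  -- already, the tail will do. Otherwise the tail is cut by induction, and the missing vector `w`
  -- is the combination of `u zero` and the projection of `l` to the tail that is orthogonal to `l`.
  -- It is orthogonal to the cut tail `t′`, because that projection acts on the span of the tail as
  -- `l` does.
  cut : ∀ {n k} (u : Fin (suc k) → V n) → Orth u → ∀ l → 0ℚ < lev u l →
    Σ[ u′ ∈ (Fin k → V n) ] Orth u′ × (∀ a → Span u (u′ a)) × (∀ a → dot l (u′ a) ≡ 0ℚ)
  cut {n} {k} u o l 0<lev with lev (u ∘ suc) l ≤? 0ℚ
  ... | yes p = u ∘ suc , orth-tail o , (λ a → span-member u (suc a)) , l⊥
    where
    l⊥ : ∀ a → dot l (u (suc a)) ≡ 0ℚ
    l⊥ a with dot l (u (suc a)) ≟ 0ℚ
    ... | yes z = z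
    ... | no ¬z = contradiction (∑≤0⇒≡0 (0≤lev-term (u ∘ suc) l) p a) (>⇒≢ (0<* (≢0⇒0<sq ¬z) (0<inv (pos o (suc a)))))
  cut {n} {zero} u o l 0<lev | no ¬p = contradiction ≤-refl ¬p
  cut {n} {suc k} u o l 0<lev | no ¬p = w VF.∷ t′ , orth-cons 0<w w⊥ o′ ,
      (λ { zero → span-w ; (suc a) f z → span-t′ a f (λ b → z (suc b)) }) , (λ { zero → l⊥w ; (suc a) → l⊥t′ a })
    where
    t : Fin (suc k) → V n
    t = u ∘ suc
    ih : Σ[ u′ ∈ (Fin k → V n) ] Orth u′ × (∀ a → Span t (u′ a)) × (∀ a → dot l (u′ a) ≡ 0ℚ)
    ih = cut t (orth-tail o) l (≰⇒> ¬p)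
    t′ = proj₁ ih
    o′ = proj₁ (proj₂ ih)
    span-t′ = proj₁ (proj₂ (proj₂ ih))
    l⊥t′ = proj₂ (proj₂ (proj₂ ih))
    p = proj t l
    λt = lev t l
    lu = dot l (u zero)
    w : V n
    w = lin lu p (- λt) (u zero)
    u⊥span : ∀ {v} → Span t v → dot (u zero) v ≡ 0ℚ
    u⊥span s = s (u zero) (λ a → perp o zero (suc a) (λ ()))
    l⊥w : dot l w ≡ 0ℚ
    l⊥w = trans (dot-linʳ l lu p (- λt) (u zero)) (trans (cong (λ z → lu * z + - λt * lu) (dot-lev t l)) (e lu λt))
      where
      e : ∀ a b → a * b + - b * a ≡ 0ℚ
      e = solve-∀ ℚ-ring
    0<w : 0ℚ < norm² w
    0<w = subst (0ℚ <_) (sym (trans (norm²-lin lu p (- λt) (u zero)) (trans (cong₂ (λ x y → lu * lu * x + 2ℚ * (lu * - λt) * y + - λt * - λt * norm² (u zero)) (norm²-proj (orth-tail o) l) (trans (dot-comm p (u zero)) (u⊥span (span-proj t l)))) (e lu λt (norm² (u zero))))))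
       (0<+ (0<* (0<* (≰⇒> ¬p) (≰⇒> ¬p)) (pos o zero)) (0≤* (0≤sq lu) (<⇒≤ (≰⇒> ¬p))))
      where
      e : ∀ a b c → a * a * b + 2ℚ * (a * - b) * 0ℚ + - b * - b * c ≡ b * b * c + a * a * b
      e = solve-∀ ℚ-ring
    w⊥ : ∀ a → dot w (t′ a) ≡ 0ℚ
    w⊥ a = trans (dot-linˡ lu p (- λt) (u zero) (t′ a)) (trans (cong₂ (λ x y → lu * x + - λt * y) (trans (dot-span-proj (orth-tail o) l (span-t′ a)) (l⊥t′ a)) (u⊥span (span-t′ a))) (e lu λt))
      where
      e : ∀ a b → a * 0ℚ + - b * 0ℚ ≡ 0ℚ
      e = solve-∀ ℚ-ring
    span-w : Span u w
    span-w f z = trans (dot-linʳ f lu p (- λt) (u zero)) (trans (cong₂ (λ x y → lu * x + - λt * y) (span-proj t l f (λ a → z (suc a))) (z zero)) (e lu λt))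
      where
      e : ∀ a b → a * 0ℚ + - b * 0ℚ ≡ 0ℚ
      e = solve-∀ ℚ-ring

  -- Counting by cells

  -- Classes are described by a relation between pairs of members, each member paired with itself
  -- included. No class needs a name or a representative, and refining a class means strengthening
  -- `P`.
  CountBound : {A : Set} → (A → A → Set) → ℚ → Set
  CountBound P X = ∀ M → Unique M → (∀ {x y} → x ∈ M → y ∈ M → P x y) → ι (length M) ≤ X

  module _ {A : Set} where

    CountBound-mono : {P Q : A → A → Set} {X : ℚ} → (∀ {x y} → P x y → Q x y) → CountBound Q X → CountBound P X
    CountBound-mono i c M u p = c M u (λ x∈ y∈ → i (p x∈ y∈))

    length-filter-split : {P : A → Set} (P? : ∀ x → Dec (P x)) (M : List A) →
      length M ≡ length (filter P? M) ℕ.+ length (filter (λ x → ¬? (P? x)) M)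
    length-filter-split P? []      = refl
    length-filter-split P? (x ∷ M) with P? x
    ... | yes _ = cong suc (length-filter-split P? M)
    ... | no  _ = trans (cong suc (length-filter-split P? M)) (sym (ℕP.+-suc _ _))

    CountBound-split : {P : A → A → Set} {Q : A → Set} (Q? : ∀ x → Dec (Q x)) {X Y : ℚ} →
      CountBound (λ x y → P x y × Q x × Q y) X → CountBound (λ x y → P x y × ¬ Q x × ¬ Q y) Y →
      CountBound P (X + Y)
    CountBound-split {P} {Q} Q? {X} {Y} cX cY M u p = subst (_≤ X + Y) (sym (trans (cong ι (length-filter-split Q? M)) (ι-+ (length M₁) (length M₂)))) (+-mono-≤
        (cX M₁ (UniqueP.filter⁺ Q? u) (λ x∈ y∈ → let (x∈M , qx) = ∈-filter⁻ Q? x∈ ; (y∈M , qy) = ∈-filter⁻ Q? y∈ in p x∈M y∈M , qx , qy))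
        (cY M₂ (UniqueP.filter⁺ ¬Q? u) (λ x∈ y∈ → let (x∈M , qx) = ∈-filter⁻ ¬Q? {xs = M} x∈ ; (y∈M , qy) = ∈-filter⁻ ¬Q? {xs = M} y∈ in p x∈M y∈M , qx , qy)))
      where
      ¬Q? : ∀ x → Dec (¬ Q x)
      ¬Q? x = ¬? (Q? x)
      M₁ M₂ : List A
      M₁ = filter Q? M
      M₂ = filter ¬Q? M

    CountBound-absurd : {P : A → A → Set} {X : ℚ} → 0ℚ ≤ X → (∀ {x} → ¬ P x x) → CountBound P X
    CountBound-absurd {X = X} 0≤X n []      u p = subst (_≤ X) (sym ι-0) 0≤X
    CountBound-absurd 0≤X n (x ∷ M) u p = contradiction (p (here refl) (here refl)) n

    CountBound-fibres : ∀ R {P : A → A → Set} (f : A → ℕ) {X : ℚ} → 0ℚ ≤ X →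
      CountBound (λ x y → P x y × f x ≡ f y) X → (∀ {x y} → P x y → f x ℕ.< R) → CountBound P (ι R * X)
    CountBound-fibres zero    f {X} 0≤X c b = CountBound-absurd (0≤* (0≤ι 0) 0≤X) (λ p → ℕP.n≮0 (b p))
    CountBound-fibres (suc R) {P} f {X} 0≤X c b = subst (CountBound P) (sym (trans (cong (_* X) (ι-suc R)) (e (ι R) X)))
        (CountBound-split (λ x → f x ℕP.≟ R)
          (CountBound-mono (λ { (p , e , e′) → p , trans e (sym e′) }) c)
          (CountBound-fibres R f 0≤X (CountBound-mono (λ { ((p , _) , e) → p , e }) c)
            (λ { (p , ne , _) → ℕP.≤∧≢⇒< (ℕP.≤-pred (b p)) ne })))
      where
      e : ∀ r x → (1ℚ + r) * x ≡ x + r * x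
      e = solve-∀ ℚ-ring

    -- Relative to the first point of the list and shifted by `β`, all values of `f` lie in [0, 2β]
    -- and have at most ⌊2β⌋ + 1 integer parts; equal integer parts mean a difference of at most 1.
    CountBound-cells : {P : A → A → Set} (f : A → ℚ) {X β : ℚ} → 0ℚ ≤ X → 0ℚ ≤ β →
      (∀ {x y} → P x y → ∣ f x - f y ∣ ≤ β) → CountBound (λ x y → P x y × ∣ f x - f y ∣ ≤ 1ℚ) X →
      CountBound P ((2ℚ * β + 1ℚ) * X)
    CountBound-cells f {X} {β} 0≤X 0≤β b c [] u p = subst (_≤ (2ℚ * β + 1ℚ) * X) (sym ι-0) (0≤* (0≤+ (0≤* 0≤2 0≤β) 0≤1) 0≤X)
    CountBound-cells {P} f {X} {β} 0≤X 0≤β b c M@(x₀ ∷ _) u p =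
        ≤-trans (CountBound-fibres R {P′} cell 0≤X (CountBound-mono same c) cell< M u p′) (*-monoʳ-≤ 0≤X R≤)
      where
      P′ : A → A → Set
      P′ x y = P x y × ∣ f x - f x₀ ∣ ≤ β × ∣ f y - f x₀ ∣ ≤ β
      p′ : ∀ {x y} → x ∈ M → y ∈ M → P′ x y
      p′ x∈ y∈ = p x∈ y∈ , b (p x∈ (here refl)) , b (p y∈ (here refl))
      R : ℕ
      R = suc (floorℕ (2ℚ * β))
      arg : A → ℚ
      arg x = f x - f x₀ + β
      cell : A → ℕ
      cell x = floorℕ (arg x)
      e₁ : ∀ d b → d + b ≡ 0ℚ + (b - (- d))
      e₁ = solve-∀ ℚ-ring
      e₂ : ∀ d b → 2ℚ * b ≡ (d + b) + (b - d)
      e₂ = solve-∀ ℚ-ring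
      0≤arg : ∀ {x} → ∣ f x - f x₀ ∣ ≤ β → 0ℚ ≤ arg x
      0≤arg {x} q = ≤-by _ (m≤n⇒0≤n-m (≤-trans (-p≤∣p∣ (f x - f x₀)) q)) (e₁ (f x - f x₀) β)
      arg≤ : ∀ {x} → ∣ f x - f x₀ ∣ ≤ β → arg x ≤ 2ℚ * β
      arg≤ {x} q = ≤-by _ (m≤n⇒0≤n-m (≤-trans (p≤∣p∣ (f x - f x₀)) q)) (e₂ (f x - f x₀) β)
      cell< : ∀ {x y} → P′ x y → cell x ℕ.< R
      cell< {x} (_ , q , _) = ι-cancel-< (subst (ι (cell x) <_) (sym (ι-suc _)) (≤-<-trans (floorℕ-≤ (0≤arg q)) (≤-<-trans (arg≤ q) (<floorℕ (2ℚ * β)))))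
      one : ∀ {x y} → 0ℚ ≤ arg y → cell x ≡ cell y → f x - f y ≤ 1ℚ
      one {x} {y} 0≤ e = ≤-by _ (0≤+ (m≤n⇒0≤n-m (<⇒≤ (<floorℕ (arg x)))) (m≤n⇒0≤n-m (floorℕ-≤ 0≤))) (trans (e₃ (f x) (f y) (f x₀) β (ι (cell x))) (cong (λ z → f x - f y + (1ℚ + ι (cell x) - arg x + (arg y - z))) (cong ι e)))
        where
        e₃ : ∀ a c d b k → 1ℚ ≡ a - c + (1ℚ + k - (a - d + b) + (c - d + b - k))
        e₃ = solve-∀ ℚ-ring
      same : ∀ {x y} → P′ x y × cell x ≡ cell y → P x y × ∣ f x - f y ∣ ≤ 1ℚ
      same {x} {y} ((q , qx , qy) , e) = q , ∣∣≤-intro (one {x} {y} (0≤arg qy) e) (subst (_≤ 1ℚ) (e₄ (f y) (f x)) (one {y} {x} (0≤arg qx) (sym e)))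
        where
        e₄ : ∀ a b → a - b ≡ - (b - a)
        e₄ = solve-∀ ℚ-ring
      R≤ : ι R ≤ 2ℚ * β + 1ℚ
      R≤ = subst (_≤ 2ℚ * β + 1ℚ) (trans (+-comm (ι (floorℕ (2ℚ * β))) 1ℚ) (sym (ι-suc (floorℕ (2ℚ * β))))) (+-mono-≤ (floorℕ-≤ (0≤* 0≤2 0≤β)) (≤-refl {1ℚ}))

    -- The functions are treated from the last one to the first; the range of f a need only
    -- be controlled on points lying in the same cells for all later functions.
    CountBound-cells* : ∀ {k} {P : A → A → Set} (f : Fin k → A → ℚ) (β : Fin k → ℚ) {X : ℚ} → 0ℚ ≤ X → (∀ a → 0ℚ ≤ β a) →
      (∀ a {x y} → P x y → (∀ b → a Fin.< b → ∣ f b x - f b y ∣ ≤ 1ℚ) → ∣ f a x - f a y ∣ ≤ β a) →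
      CountBound (λ x y → P x y × (∀ a → ∣ f a x - f a y ∣ ≤ 1ℚ)) X →
      CountBound P (∏ (λ a → 2ℚ * β a + 1ℚ) * X)
    CountBound-cells* {zero}  {P} f β {X} 0≤X 0≤β d c = subst (CountBound P) (sym (*-identityˡ X)) (CountBound-mono (λ p → p , λ ()) c)
    CountBound-cells* {suc k} {P} f β {X} 0≤X 0≤β d c = subst (CountBound P) (e (2ℚ * β zero + 1ℚ) (∏ (λ a → 2ℚ * β (suc a) + 1ℚ)) X)
        (CountBound-cells* (f ∘ suc) (β ∘ suc) (0≤* (0≤+ (0≤* 0≤2 (0≤β zero)) 0≤1) 0≤X) (0≤β ∘ suc)
          (λ a p q → d (suc a) p (λ { zero () ; (suc b) (s≤s l) → q b l }))
          (CountBound-cells (f zero) 0≤X (0≤β zero) (λ { (p , q) → d zero p (λ { zero () ; (suc b) _ → q b }) })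
            (CountBound-mono (λ { ((p , q) , r) → p , λ { zero → r ; (suc a) → q a } }) c)))
      where
      e : ∀ a b c → b * (a * c) ≡ a * b * c
      e = solve-∀ ℚ-ring

  sumℕ : ∀ {k} → (Fin k → ℕ) → ℕ
  sumℕ {zero}  f = 0
  sumℕ {suc k} f = f zero ℕ.+ sumℕ (f ∘ suc)

  ι-sumℕ : ∀ {k} (f : Fin k → ℕ) → ι (sumℕ f) ≡ ∑ (ι ∘ f)
  ι-sumℕ {zero}  f = ι-0
  ι-sumℕ {suc k} f = trans (ι-+ (f zero) _) (cong (ι (f zero) +_) (ι-sumℕ (f ∘ suc)))

  module _ {A : Set} where

    -- There are at most 2^(k+B) tuples of k naturals with sum at most B. The induction is Pascal's
    -- rule: either the first entry is 0 and is dropped, or it is lowered by one together with B.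
    CountBound-simplex : ∀ k B {P : A → A → Set} (g : Fin k → A → ℕ) {X : ℚ} → 0ℚ ≤ X →
      (∀ {x y} → P x y → sumℕ (λ a → g a x) ℕ.≤ B) →
      CountBound (λ x y → P x y × (∀ a → g a x ≡ g a y)) X → CountBound P (2ℚ ^ (k ℕ.+ B) * X)
    CountBound-simplex zero B {P} g {X} 0≤X s c M u p = ≤-trans (CountBound-mono (λ p → p , λ ()) c M u p)
        (subst (_≤ 2ℚ ^ B * X) (*-identityˡ X) (*-monoʳ-≤ 0≤X (subst (_≤ 2ℚ ^ B) (1^ B) (^-mono-≤ B 0≤1 (≤-by 1ℚ 0≤1 refl)))))
    CountBound-simplex (suc k) zero {P} g {X} 0≤X s c M u p = ≤-trans
        (CountBound-split {P = P} (λ x → g zero x ℕP.≟ 0)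
          (CountBound-simplex k 0 (g ∘ suc) 0≤X (λ { (q , _) → ℕP.≤-trans (ℕP.m≤n+m _ _) (s q) })
            (CountBound-mono (λ { ((q , e , e′) , r) → q , λ { zero → trans e (sym e′) ; (suc a) → r a } }) c))
          (CountBound-absurd {X = 0ℚ} ≤-refl (λ { (q , ne , _) → ne (ℕP.n≤0⇒n≡0 (ℕP.≤-trans (ℕP.m≤m+n _ _) (s q))) })) M u p)
        (≤-by (2ℚ ^ (k ℕ.+ 0) * X) (0≤* (0≤^ (k ℕ.+ 0) 0≤2) 0≤X) (e (2ℚ ^ (k ℕ.+ 0)) X))
      where
      e : ∀ a x → 2ℚ * a * x ≡ a * x + 0ℚ + a * x
      e = solve-∀ ℚ-ring
    CountBound-simplex (suc k) (suc B) {P} g {X} 0≤X s c M u p = ≤-trans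
        (CountBound-split {P = P} (λ x → g zero x ℕP.≟ 0)
          (CountBound-simplex k (suc B) (g ∘ suc) 0≤X (λ { (q , _) → ℕP.≤-trans (ℕP.m≤n+m _ _) (s q) })
            (CountBound-mono (λ { ((q , e , e′) , r) → q , λ { zero → trans e (sym e′) ; (suc a) → r a } }) c))
          (CountBound-simplex (suc k) B g′ 0≤X (λ { {x} (q , ne , _) → ℕP.≤-pred (ℕP.≤-trans (ℕP.≤-reflexive (cong (ℕ._+ sumℕ (λ a → g (suc a) x)) (ℕP.suc-pred (g zero x) {{ℕ.≢-nonZero ne}}))) (s q)) })
            (CountBound-mono (λ { ((q , ne , ne′) , r) → q , λ { zero → pred-inj ne ne′ (r zero) ; (suc a) → r (suc a) } }) c)) M u p)
        (≤-reflexive (trans (cong (λ z → 2ℚ ^ (k ℕ.+ suc B) * X + 2ℚ ^ z * X) (sym (ℕP.+-suc k B))) (e (2ℚ ^ (k ℕ.+ suc B)) X)))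
      where
      g′ : Fin (suc k) → A → ℕ
      g′ zero    x = ℕ.pred (g zero x)
      g′ (suc a) x = g (suc a) x
      pred-inj : ∀ {a b} → a ≢ 0 → b ≢ 0 → ℕ.pred a ≡ ℕ.pred b → a ≡ b
      pred-inj {zero}  ne _  _ = contradiction refl ne
      pred-inj {suc a} {zero}  _ ne _ = contradiction refl ne
      pred-inj {suc a} {suc b} _ _  e = cong suc e
      e : ∀ a x → a * x + a * x ≡ 2ℚ * a * x
      e = solve-∀ ℚ-ring

    -- Enclosing the ball in a cube would cost a power of √B per coordinate, too much for B of order
    -- k. Instead, a positive integer part of d is at most d², so the integer parts of the positive
    -- parts, and likewise of the negative parts, have sum at most B; the simplex count is applied
    -- to each of the two.
    CountBound-ball : ∀ k B {P : A → A → Set} (f : Fin k → A → ℚ) {X : ℚ} → 0ℚ ≤ X →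
      (∀ {x y} → P x y → ∑ (λ a → (f a x - f a y) * (f a x - f a y)) ≤ ι B) →
      CountBound (λ x y → P x y × (∀ a → ∣ f a x - f a y ∣ ≤ 2ℚ)) X → CountBound P (2ℚ ^ (k ℕ.+ B) * (2ℚ ^ (k ℕ.+ B) * X))
    CountBound-ball k B f {X} 0≤X s c [] u p = subst (_≤ 2ℚ ^ (k ℕ.+ B) * (2ℚ ^ (k ℕ.+ B) * X)) (sym ι-0)
      (0≤* (0≤^ (k ℕ.+ B) 0≤2) (0≤* (0≤^ (k ℕ.+ B) 0≤2) 0≤X))
    CountBound-ball k B {P} f {X} 0≤X s c M@(x₀ ∷ _) u p =
        CountBound-simplex k B {P′} g⁺ (0≤* (0≤^ (k ℕ.+ B) 0≤2) 0≤X) (λ { {x} (_ , q , _) → small (λ a → f a x - f a x₀) q })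
          (CountBound-simplex k B g⁻ 0≤X (λ { {x} ((_ , _ , q) , _) → small (λ a → f a x₀ - f a x) q })
            (CountBound-mono (λ { {x} {y} (((q , _) , r⁺) , r⁻) → q , λ a → near a x y (r⁺ a) (r⁻ a) }) c)) M u
          (λ x∈ y∈ → p x∈ y∈ , s (p x∈ (here refl)) , s (p (here refl) x∈))
      where
      P′ : A → A → Set
      P′ x y = P x y × ∑ (λ a → (f a x - f a x₀) * (f a x - f a x₀)) ≤ ι B × ∑ (λ a → (f a x₀ - f a x) * (f a x₀ - f a x)) ≤ ι B
      g⁺ g⁻ : Fin k → A → ℕ
      g⁺ a x = floorℕ (f a x - f a x₀)
      g⁻ a x = floorℕ (f a x₀ - f a x)
      floor≤sq : ∀ d → ι (floorℕ d) ≤ d * d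
      floor≤sq d with floorℕ d | floorℕ-cases d
      ... | zero  | _      = subst (_≤ d * d) (sym ι-0) (0≤sq d)
      ... | suc j | inj₂ q = ≤-trans q (subst (_≤ d * d) (*-identityˡ d) (*-monoʳ-≤ (≤-trans (0≤ι (suc j)) q) (≤-trans (1≤ι (s≤s z≤n)) q)))
      small : (d : Fin k → ℚ) → ∑ (λ a → d a * d a) ≤ ι B → sumℕ (λ a → floorℕ (d a)) ℕ.≤ B
      small d q = ι-cancel (subst (_≤ ι B) (sym (ι-sumℕ (λ a → floorℕ (d a)))) (≤-trans (∑-mono (λ a → floor≤sq (d a))) q))
      -- Both integer parts vanish on all of (-1, 1), hence the cell width 2 instead of 1.
      half : ∀ d e → floorℕ d ≡ floorℕ e → floorℕ (- d) ≡ floorℕ (- e) → d - e ≤ 2ℚ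
      half d e r⁺ r⁻ with floorℕ-cases e
      ... | inj₂ q = ≤-by _ (0≤+ (0≤+ (m≤n⇒0≤n-m (<⇒≤ (subst (λ z → d < 1ℚ + ι z) r⁺ (<floorℕ d)))) (m≤n⇒0≤n-m q)) 0≤1) (lem d e (ι (floorℕ e)))
        where
        lem : ∀ d e k → 2ℚ ≡ d - e + (1ℚ + k - d + (e - k) + 1ℚ)
        lem = solve-∀ ℚ-ring
      ... | inj₁ z with floorℕ-cases (- d)
      ...   | inj₁ z′ = ≤-by _ (0≤+ (m≤n⇒0≤n-m (<⇒≤ (subst (λ j → d < 1ℚ + ι j) (trans r⁺ z) (<floorℕ d)))) (m≤n⇒0≤n-m (<⇒≤ (subst (λ j → - e < 1ℚ + ι j) (trans (sym r⁻) z′) (<floorℕ (- e)))))) (trans (lem d e) (cong₂ (λ i j → d - e + (1ℚ + i - d + (1ℚ + j - - e))) (sym ι-0) (sym ι-0)))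
        where
        lem : ∀ d e → 2ℚ ≡ d - e + (1ℚ + 0ℚ - d + (1ℚ + 0ℚ - - e))
        lem = solve-∀ ℚ-ring
      ...   | inj₂ q = ≤-by _ (0≤+ (0≤+ (m≤n⇒0≤n-m (<⇒≤ (subst (λ j → - e < 1ℚ + ι j) (sym r⁻) (<floorℕ (- e))))) (m≤n⇒0≤n-m q)) 0≤1) (lem d e (ι (floorℕ (- d))))
        where
        lem : ∀ d e k → 2ℚ ≡ d - e + (1ℚ + k - - e + (- d - k) + 1ℚ)
        lem = solve-∀ ℚ-ring
      near : ∀ a x y → g⁺ a x ≡ g⁺ a y → g⁻ a x ≡ g⁻ a y → ∣ f a x - f a y ∣ ≤ 2ℚ
      near a x y r⁺ r⁻ = ∣∣≤-intro (subst (_≤ 2ℚ) (e₁ (f a x) (f a y) (f a x₀)) (half (f a x - f a x₀) (f a y - f a x₀) r⁺ r⁻′)) (subst (_≤ 2ℚ) (e₂ (f a x) (f a y) (f a x₀)) (half (f a y - f a x₀) (f a x - f a x₀) (sym r⁺) (sym r⁻′)))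
        where
        e₀ : ∀ c d → d - c ≡ - (c - d)
        e₀ = solve-∀ ℚ-ring
        r⁻′ : floorℕ (- (f a x - f a x₀)) ≡ floorℕ (- (f a y - f a x₀))
        r⁻′ = trans (cong floorℕ (sym (e₀ (f a x) (f a x₀)))) (trans r⁻ (cong floorℕ (e₀ (f a y) (f a x₀))))
        e₁ : ∀ x y z → (x - z) - (y - z) ≡ x - y
        e₁ = solve-∀ ℚ-ring
        e₂ : ∀ x y z → (y - z) - (x - z) ≡ - (x - y)
        e₂ = solve-∀ ℚ-ring

  -- Gram-Schmidt vectors and the choice of columns

  dot-congʳ : ∀ {n} (u : V n) {v w : V n} → (∀ i → v i ≡ w i) → dot u v ≡ dot u w
  dot-congʳ u {v} {w} e = trans (dot-def u v) (trans (∑-cong (λ i → cong (u i *_) (e i))) (sym (dot-def u w)))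

  lev≤ : ∀ {n k} (u : Fin k → V n) → Orth u → ∀ d → (∀ a → dot (u a) d * dot (u a) d ≤ norm² (u a)) → lev u d ≤ ι k
  lev≤ {k = k} u o d p = ≤-trans (∑-mono (λ a → subst (dot d (u a) * dot d (u a) * inv (norm² (u a)) ≤_) (inv-r⁺ (pos o a))
      (*-monoʳ-≤ (<⇒≤ (0<inv (pos o a))) (subst (_≤ norm² (u a)) (cong₂ _*_ (dot-comm (u a) d) (dot-comm (u a) d)) (p a)))))
    (≤-reflexive (trans (∑-const k 1ℚ) (*-identityʳ (ι k))))

  -- Since q a is orthogonal to every b a′ with a < a′, it bounds from below the distance of b a
  -- from their span; this distance is the length of the Gram–Schmidt vector q′ a.
  gram-schmidt : ∀ {n} K k → k ℕ.≤ K → (b q : Fin k → V n) → (∀ a → 0ℚ < norm² (q a)) →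
    (∀ a → dot (q a) (b a) ≡ norm² (q a)) → (∀ a a′ → a Fin.< a′ → dot (q a) (b a′) ≡ 0ℚ) →
    Σ[ q′ ∈ (Fin k → V n) ] Orth q′ × (∀ a → Span b (q′ a)) × (∀ a → norm² (q a) ≤ norm² (q′ a)) × (∀ a → norm² (q′ a) ≤ norm² (b a)) ×
      (∀ a d → (∀ a′ → a Fin.< a′ → dot (q′ a′) d * dot (q′ a′) d ≤ norm² (q′ a′)) →
        (dot (q′ a) d - dot (b a) d) * (dot (q′ a) d - dot (b a) d) ≤ norm² (b a) * ι K)
  gram-schmidt K zero k≤K b q 0<q e z = (λ ()) , mkOrth (λ ()) (λ ()) , (λ ()) , (λ ()) , (λ ()) , (λ ())
  gram-schmidt {n} K (suc k) k≤K b q 0<q e z =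
      q₀ VF.∷ t , orth-cons 0<q₀ q₀⊥t o , (λ { zero → span₀ ; (suc a) f y → sp a f (λ a′ → y (suc a′)) }) ,
      (λ { zero → long₀ ; (suc a) → long a }) , (λ { zero → short₀ ; (suc a) → short a }) ,
      (λ { zero d p → control₀ d (λ a → p (suc a) (s≤s z≤n)) ; (suc a) d p → control a d (λ a′ l → p (suc a′) (s≤s l)) })
    where
    rec = gram-schmidt K k (ℕP.<⇒≤ k≤K) (b ∘ suc) (q ∘ suc) (0<q ∘ suc) (e ∘ suc) (λ a a′ l → z (suc a) (suc a′) (s≤s l))
    t : Fin k → V n
    t = proj₁ rec
    o : Orth t
    o = proj₁ (proj₂ rec)
    sp = proj₁ (proj₂ (proj₂ rec))
    long = proj₁ (proj₂ (proj₂ (proj₂ rec)))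
    short = proj₁ (proj₂ (proj₂ (proj₂ (proj₂ rec))))
    control = proj₂ (proj₂ (proj₂ (proj₂ (proj₂ rec))))
    p₀ q₀ : V n
    p₀ = proj t (b zero)
    q₀ = lin 1ℚ (b zero) (- 1ℚ) p₀
    q₀⊥t : ∀ a → dot q₀ (t a) ≡ 0ℚ
    q₀⊥t a = trans (dot-linˡ 1ℚ (b zero) (- 1ℚ) p₀ (t a)) (trans (cong (λ y → 1ℚ * dot (b zero) (t a) + - 1ℚ * y) (trans (dot-comm p₀ (t a)) (dot-proj-member o (b zero) a))) (r (dot (b zero) (t a))))
      where
      r : ∀ x → 1ℚ * x + - 1ℚ * x ≡ 0ℚ
      r = solve-∀ ℚ-ring
    span₀ : Span b q₀
    span₀ f y = trans (dot-linʳ f 1ℚ (b zero) (- 1ℚ) p₀) (trans (cong₂ (λ u v → 1ℚ * u + - 1ℚ * v) (y zero) (span-proj t (b zero) f (λ a → sp a f (λ a′ → y (suc a′))))) refl)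
    qq₀ : dot (q zero) q₀ ≡ norm² (q zero)
    qq₀ = trans (dot-linʳ (q zero) 1ℚ (b zero) (- 1ℚ) p₀) (trans (cong₂ (λ u v → 1ℚ * u + - 1ℚ * v) (e zero) (span-proj t (b zero) (q zero) (λ a → sp a (q zero) (λ a′ → z zero (suc a′) (s≤s z≤n))))) (r (norm² (q zero))))
      where
      r : ∀ x → 1ℚ * x + - 1ℚ * 0ℚ ≡ x
      r = solve-∀ ℚ-ring
    long₀ : norm² (q zero) ≤ norm² q₀
    long₀ = *-cancelˡ-≤ (0<q zero) (subst (_≤ norm² (q zero) * norm² q₀) (cong₂ _*_ qq₀ qq₀) (cauchy-schwarz (q zero) q₀))
    0<q₀ : 0ℚ < norm² q₀
    0<q₀ = <-≤-trans (0<q zero) long₀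
    short₀ : norm² q₀ ≤ norm² (b zero)
    short₀ = ≤-by (lev t (b zero)) (0≤lev t (b zero)) (sym (trans (cong (_+ lev t (b zero)) (trans (norm²-lin 1ℚ (b zero) (- 1ℚ) p₀) (cong₂ (λ x y → 1ℚ * 1ℚ * norm² (b zero) + 2ℚ * (1ℚ * - 1ℚ) * x + - 1ℚ * - 1ℚ * y) (dot-lev t (b zero)) (norm²-proj o (b zero))))) (r (norm² (b zero)) (lev t (b zero)))))
      where
      r : ∀ x y → 1ℚ * 1ℚ * x + 2ℚ * (1ℚ * - 1ℚ) * y + - 1ℚ * - 1ℚ * y + y ≡ x
      r = solve-∀ ℚ-ring
    -- The difference is -⟨p₀, d⟩ = -⟨p₀, proj t d⟩. Lying in the cell of the later vectors, `d` has
    -- a projection to their span of squared length at most 1 per vector.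
    control₀ : ∀ d → (∀ a → dot (t a) d * dot (t a) d ≤ norm² (t a)) → (dot q₀ d - dot (b zero) d) * (dot q₀ d - dot (b zero) d) ≤ norm² (b zero) * ι K
    control₀ d p = subst (_≤ norm² (b zero) * ι K) (sym eq) (≤-trans (cauchy-schwarz p₀ (proj t d))
        (*-mono-≤ (0≤norm² p₀) (0≤ι K) (≤-trans (≤-reflexive (norm²-proj o (b zero))) (bessel o (b zero)))
          (≤-trans (≤-reflexive (norm²-proj o d)) (≤-trans (lev≤ t o d p) (ι-mono (ℕP.<⇒≤ k≤K))))))
      where
      r : ∀ x y → (1ℚ * x + - 1ℚ * y - x) * (1ℚ * x + - 1ℚ * y - x) ≡ y * y
      r = solve-∀ ℚ-ring
      eq : (dot q₀ d - dot (b zero) d) * (dot q₀ d - dot (b zero) d) ≡ dot p₀ (proj t d) * dot p₀ (proj t d)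
      eq = trans (cong (λ y → (y - dot (b zero) d) * (y - dot (b zero) d)) (dot-linˡ 1ℚ (b zero) (- 1ℚ) p₀ d))
          (trans (r (dot (b zero) d) (dot p₀ d)) (cong (λ y → y * y) (trans (dot-comm p₀ d) (trans (sym (dot-span-proj o d (span-proj t (b zero)))) (dot-comm (proj t d) p₀)))))

  -- The leverages lev u (δ j) sum to k, so some column has leverage at least k / n; cut the span of u by it and iterate.
  choose-columns : ∀ {n} k (u : Fin k → V (suc n)) → Orth u →
    Σ[ js ∈ (Fin k → Fin (suc n)) ] Σ[ v ∈ (Fin k → V (suc n)) ]
      Orth v × (∀ a → Span u (v a)) × (∀ a → v a (js a) ≡ norm² (v a)) × (∀ a a′ → a Fin.< a′ → v a′ (js a) ≡ 0ℚ) ×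
      (∀ a → norm² (v a) ≤ 1ℚ) × ι (k ℕ.!) ≤ ∏ (λ a → ι (suc n) * norm² (v a))
  choose-columns zero u o = (λ ()) , (λ ()) , mkOrth (λ ()) (λ ()) , (λ ()) , (λ ()) , (λ ()) , (λ ()) , ≤-reflexive ι-1
  choose-columns {n} (suc k) u o = (j VF.∷ js) , (v₀ VF.∷ v) , orth-cons 0<v₀ v₀⊥v ov ,
      (λ { zero → span-proj u (δ j) ; (suc a) → spuv a }) ,
      (λ { zero → trans (sym (dot-δ j v₀)) (trans (dot-lev u (δ j)) (sym nv₀)) ; (suc a) → diag a }) ,
      (λ { zero zero () ; zero (suc a′) _ → vj a′ ; (suc a) zero () ; (suc a) (suc a′) (s≤s l) → tri a a′ l }) ,
      (λ { zero → subst (_≤ 1ℚ) (sym nv₀) (≤-trans (bessel o (δ j)) (≤-reflexive (trans (dot-δ j (δ j)) (δ-refl j)))) ; (suc a) → v≤1 a }) ,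
      ≤-trans (≤-reflexive (ι-* (suc k) (k ℕ.!))) (*-mono-≤ (0≤ι (suc k)) (≤-trans (0≤ι (k ℕ.!)) fac) sk≤ fac)
    where
    0<s : 0ℚ < ι (suc n)
    0<s = 0<ι (s≤s z≤n)
    ∑lev : ∑ (λ j → lev u (δ j)) ≡ ι (suc k)
    ∑lev = trans (∑-swap (λ j a → dot (δ j) (u a) * dot (δ j) (u a) * inv (norm² (u a)))) (trans (∑-cong (λ a →
        trans (∑-cong (λ j → trans (cong (λ x → x * x * inv (norm² (u a))) (dot-δ j (u a))) (*-comm (u a j * u a j) (inv (norm² (u a))))))
         (trans (∑-*ˡ (inv (norm² (u a))) (λ j → u a j * u a j)) (trans (cong (inv (norm² (u a)) *_) (sym (dot-def (u a) (u a)))) (trans (*-comm (inv (norm² (u a))) (norm² (u a))) (inv-r⁺ (pos o a)))))))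
         (trans (∑-const (suc k) 1ℚ) (*-identityʳ (ι (suc k)))))
    c : ℚ
    c = inv (ι (suc n)) * ι (suc k)
    sc≡ : ι (suc n) * c ≡ ι (suc k)
    sc≡ = trans (sym (*-assoc (ι (suc n)) (inv (ι (suc n))) (ι (suc k)))) (trans (cong (_* ι (suc k)) (inv-r⁺ 0<s)) (*-identityˡ (ι (suc k))))
    avg : ∃ λ j → c ≤ lev u (δ j)
    avg = average-≤ (λ j → lev u (δ j)) c (≤-reflexive (trans sc≡ (sym ∑lev)))
    j = proj₁ avg
    v₀ : V (suc n)
    v₀ = proj u (δ j)
    nv₀ : norm² v₀ ≡ lev u (δ j)
    nv₀ = norm²-proj o (δ j)
    0<lev : 0ℚ < lev u (δ j)
    0<lev = <-≤-trans (0<* (0<inv 0<s) (0<ι (s≤s z≤n))) (proj₂ avg)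
    0<v₀ : 0ℚ < norm² v₀
    0<v₀ = subst (0ℚ <_) (sym nv₀) 0<lev
    ct = cut u o (δ j) 0<lev
    u′ = proj₁ ct
    sp = proj₁ (proj₂ (proj₂ ct))
    δ⊥ = proj₂ (proj₂ (proj₂ ct))
    rec = choose-columns k u′ (proj₁ (proj₂ ct))
    js = proj₁ rec
    v = proj₁ (proj₂ rec)
    ov = proj₁ (proj₂ (proj₂ rec))
    spv = proj₁ (proj₂ (proj₂ (proj₂ rec)))
    diag = proj₁ (proj₂ (proj₂ (proj₂ (proj₂ rec))))
    tri = proj₁ (proj₂ (proj₂ (proj₂ (proj₂ (proj₂ rec)))))
    v≤1 = proj₁ (proj₂ (proj₂ (proj₂ (proj₂ (proj₂ (proj₂ rec))))))
    fac = proj₂ (proj₂ (proj₂ (proj₂ (proj₂ (proj₂ (proj₂ rec))))))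
    spuv : ∀ a → Span u (v a)
    spuv a = span-trans {u = u} {u′} {v a} sp (spv a)
    δv : ∀ a → dot (δ j) (v a) ≡ 0ℚ
    δv a = spv a (δ j) δ⊥
    vj : ∀ a → v a j ≡ 0ℚ
    vj a = trans (sym (dot-δ j (v a))) (δv a)
    v₀⊥v : ∀ a → dot v₀ (v a) ≡ 0ℚ
    v₀⊥v a = trans (dot-span-proj o (δ j) (spuv a)) (δv a)
    -- With k + 1 vectors left the leverage is at least (k + 1) / s; over all stages these
    -- numerators multiply to a factorial.
    sk≤ : ι (suc k) ≤ ι (suc n) * norm² v₀
    sk≤ = subst₂ _≤_ sc≡ (cong (ι (suc n) *_) (sym nv₀)) (*-monoˡ-≤ (<⇒≤ 0<s) (proj₂ avg))

  -- Rounding integer vectors by hereditary colourings, one binary digit at a time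

  ind sgn : Bool → ℚ
  ind true  = 1ℚ
  ind false = 0ℚ
  sgn true  = 1ℚ
  sgn false = - 1ℚ

  -- Hereditary discrepancy at most `H` in rational form: `T` is the set of kept columns, and one
  -- colouring serves all rows. An arbitrary index type allows for the rows of a single type, or for
  -- rows with repetition.
  Balanced : ∀ {s} {R : Set} → ℚ → (R → V s) → Set
  Balanced {s} H b = ∀ (T : Fin s → Bool) → Σ[ χ ∈ (Fin s → Bool) ] (∀ r → ∣ dot (b r) (λ j → ind (T j) * sgn (χ j)) ∣ ≤ H)

  bit : Bool → ℕ
  bit true  = 1
  bit false = 0

  halve : ℕ → ℕ × Bool
  halve zero    = 0 , false
  halve (suc y) with halve y
  ... | h , false = h , true
  ... | h , true  = suc h , false

  halve-spec : ∀ y → y ≡ proj₁ (halve y) ℕ.+ proj₁ (halve y) ℕ.+ bit (proj₂ (halve y))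
  halve-spec zero    = refl
  halve-spec (suc y) with halve y | halve-spec y
  ... | h , false | e = trans (cong suc (trans e (ℕP.+-identityʳ (h ℕ.+ h)))) (ℕP.+-comm 1 (h ℕ.+ h))
  ... | h , true  | e = trans (cong suc (trans e (ℕP.+-comm (h ℕ.+ h) 1))) (cong suc (sym (trans (ℕP.+-identityʳ _) (ℕP.+-suc h h))))

  -- Only odd values are rounded up, and an odd value stays strictly below the even bound 2Q.
  halve-≤ : ∀ h o c Q → h ℕ.+ h ℕ.+ bit o ℕ.≤ 2 ℕ.* Q → h ℕ.+ bit (o ∧ c) ℕ.≤ Q
  halve-≤ h o c Q p with ℕP.≤-trans p (ℕP.≤-reflexive (cong (Q ℕ.+_) (ℕP.+-identityʳ Q)))
  halve-≤ h false c Q p | q = ℕP.≮⇒≥ λ l → ℕP.<⇒≱ (ℕP.+-mono-< (subst (Q ℕ.<_) (ℕP.+-identityʳ h) l) (subst (Q ℕ.<_) (ℕP.+-identityʳ h) l)) (subst (ℕ._≤ Q ℕ.+ Q) (ℕP.+-identityʳ (h ℕ.+ h)) q)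
  halve-≤ h true  c Q p | q = ℕP.≤-trans (ℕP.+-monoʳ-≤ h (bit≤1 c)) (ℕP.≤-trans (ℕP.≤-reflexive (ℕP.+-comm h 1)) (ℕP.≰⇒> λ l → ℕP.<⇒≱ (ℕP.<-≤-trans (ℕP.n<1+n (h ℕ.+ h)) (ℕP.≤-trans (ℕP.≤-reflexive (ℕP.+-comm 1 (h ℕ.+ h))) q)) (ℕP.+-mono-≤ l l)))
    where
    bit≤1 : ∀ c → bit c ℕ.≤ 1
    bit≤1 true  = ℕP.≤-refl
    bit≤1 false = z≤n

  module _ {s} {R : Set} {H : ℚ} {b : R → V s} (bal : Balanced H b) where

    -- The columns whose last digit is 1 are coloured and rounded up or down accordingly, which
    -- changes ⟨b, y⟩ by at most H and makes every entry even; then y is halved. The errors add up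
    -- to H (1 + 2 + ... + 2^(P-1)). Zero entries are never touched, so the support does not grow.
    round : ∀ P (y : Fin s → ℕ) → (∀ j → y j ℕ.≤ 2 ℕ.^ P) →
      Σ[ v ∈ (Fin s → ℕ) ] (∀ j → v j ℕ.≤ 1) × (∀ j → y j ≡ 0 → v j ≡ 0) ×
        (∀ r → ∣ dot (b r) (ι ∘ y) - 2ℚ ^ P * dot (b r) (ι ∘ v) ∣ ≤ (2ℚ ^ P - 1ℚ) * H)
    round zero y y≤ = y , y≤ , (λ j e → e) , λ r → ≤-reflexive (trans (cong ∣_∣ (e₁ (dot (b r) (ι ∘ y)))) (e₂ H))
      where
      e₁ : ∀ x → x - 1ℚ * x ≡ 0ℚ
      e₁ = solve-∀ ℚ-ring
      e₂ : ∀ h → 0ℚ ≡ (1ℚ - 1ℚ) * h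
      e₂ = solve-∀ ℚ-ring
    round (suc P) y y≤ = v , v≤1 , (λ j e → v0 j (y″0 j e)) , bound
      where
      T : Fin s → Bool
      T j = proj₂ (halve (y j))
      χ : Fin s → Bool
      χ = proj₁ (bal T)
      y″ : Fin s → ℕ
      y″ j = proj₁ (halve (y j)) ℕ.+ bit (T j ∧ χ j)
      y″≤ : ∀ j → y″ j ℕ.≤ 2 ℕ.^ P
      y″≤ j = halve-≤ (proj₁ (halve (y j))) (T j) (χ j) (2 ℕ.^ P) (ℕP.≤-trans (ℕP.≤-reflexive (sym (halve-spec (y j)))) (y≤ j))
      y″0 : ∀ j → y j ≡ 0 → y″ j ≡ 0
      y″0 j e rewrite e = refl
      rec = round P y″ y″≤
      v = proj₁ rec
      v≤1 = proj₁ (proj₂ rec)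
      v0 = proj₁ (proj₂ (proj₂ rec))
      w : V s
      w j = ind (T j) * sgn (χ j)
      digit : ∀ h o c → ι (h ℕ.+ h ℕ.+ bit o) ≡ 2ℚ * ι (h ℕ.+ bit (o ∧ c)) + - 1ℚ * (ind o * sgn c)
      digit h o c = trans (trans (ι-+ (h ℕ.+ h) (bit o)) (cong (_+ ι (bit o)) (ι-+ h h))) (trans (lem o c) (cong (λ z → 2ℚ * z + - 1ℚ * (ind o * sgn c)) (sym (ι-+ h (bit (o ∧ c))))))
        where
        l₁ : ∀ x → x + x + 1ℚ ≡ 2ℚ * (x + 1ℚ) + - 1ℚ * (1ℚ * 1ℚ)
        l₁ = solve-∀ ℚ-ring
        l₂ : ∀ x → x + x + 1ℚ ≡ 2ℚ * (x + 0ℚ) + - 1ℚ * (1ℚ * - 1ℚ)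
        l₂ = solve-∀ ℚ-ring
        l₃ : ∀ x y → x + x + 0ℚ ≡ 2ℚ * (x + 0ℚ) + - 1ℚ * (0ℚ * y)
        l₃ = solve-∀ ℚ-ring
        lem : ∀ o c → ι h + ι h + ι (bit o) ≡ 2ℚ * (ι h + ι (bit (o ∧ c))) + - 1ℚ * (ind o * sgn c)
        lem true  true  = subst (λ z → ι h + ι h + z ≡ 2ℚ * (ι h + z) + - 1ℚ * (1ℚ * 1ℚ)) (sym ι-1) (l₁ (ι h))
        lem true  false = subst₂ (λ z z′ → ι h + ι h + z ≡ 2ℚ * (ι h + z′) + - 1ℚ * (1ℚ * - 1ℚ)) (sym ι-1) (sym ι-0) (l₂ (ι h))
        lem false c     = subst (λ z → ι h + ι h + z ≡ 2ℚ * (ι h + z) + - 1ℚ * (0ℚ * sgn c)) (sym ι-0) (l₃ (ι h) (sgn c))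
      y≡ : ∀ j → ι (y j) ≡ lin 2ℚ (ι ∘ y″) (- 1ℚ) w j
      y≡ j = trans (cong ι (halve-spec (y j))) (digit (proj₁ (halve (y j))) (T j) (χ j))
      bound : ∀ r → ∣ dot (b r) (ι ∘ y) - 2ℚ ^ suc P * dot (b r) (ι ∘ v) ∣ ≤ (2ℚ ^ suc P - 1ℚ) * H
      bound r = subst₂ _≤_ (cong ∣_∣ (sym eq)) (e₂ (2ℚ ^ P) H) (≤-trans (∣p+q∣≤∣p∣+∣q∣ (2ℚ * X) (- W))
          (+-mono-≤ (subst (_≤ 2ℚ * ((2ℚ ^ P - 1ℚ) * H)) (sym (∣p*q∣≡∣p∣*∣q∣ 2ℚ X)) (*-monoˡ-≤ 0≤2 (proj₂ (proj₂ (proj₂ rec)) r)))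
            (subst (_≤ H) (sym (∣-p∣≡∣p∣ W)) (proj₂ (bal T) r))))
        where
        X W : ℚ
        X = dot (b r) (ι ∘ y″) - 2ℚ ^ P * dot (b r) (ι ∘ v)
        W = dot (b r) w
        e₁ : ∀ p y w v → 2ℚ * y + - 1ℚ * w - 2ℚ * p * v ≡ 2ℚ * (y - p * v) + - w
        e₁ = solve-∀ ℚ-ring
        eq : dot (b r) (ι ∘ y) - 2ℚ ^ suc P * dot (b r) (ι ∘ v) ≡ 2ℚ * X + - W
        eq = trans (cong (λ z → z - 2ℚ ^ suc P * dot (b r) (ι ∘ v)) (trans (dot-congʳ (b r) y≡) (dot-linʳ (b r) 2ℚ (ι ∘ y″) (- 1ℚ) w))) (e₁ (2ℚ ^ P) (dot (b r) (ι ∘ y″)) W (dot (b r) (ι ∘ v)))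
        e₂ : ∀ p h → 2ℚ * ((p - 1ℚ) * h) + h ≡ (2ℚ * p - 1ℚ) * h
        e₂ = solve-∀ ℚ-ring

  emb : ∀ {s k} → (Fin k → Fin s) → Vec ℕ k → Fin s → ℕ
  emb {k = zero}  js []      i = 0
  emb {k = suc k} js (c ∷ z) i with i FinP.≟ js zero
  ... | yes _ = c
  ... | no  _ = emb (js ∘ suc) z i

  emb-off : ∀ {s k} (js : Fin k → Fin s) z {i} → (∀ a → i ≢ js a) → emb js z i ≡ 0
  emb-off {k = zero}  js []      p = refl
  emb-off {k = suc k} js (c ∷ z) {i} p with i FinP.≟ js zero
  ... | yes e = contradiction e (p zero)
  ... | no  _ = emb-off (js ∘ suc) z (p ∘ suc)

  emb-≤ : ∀ {s k} (js : Fin k → Fin s) z {N} → (∀ a → Vec.lookup z a ℕ.≤ N) → ∀ i → emb js z i ℕ.≤ N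
  emb-≤ {k = zero}  js []      p i = z≤n
  emb-≤ {k = suc k} js (c ∷ z) p i with i FinP.≟ js zero
  ... | yes _ = p zero
  ... | no  _ = emb-≤ (js ∘ suc) z (p ∘ suc) i

  dot-emb : ∀ {s k} (b : V s) (js : Fin k → Fin s) z → (∀ a a′ → a Fin.< a′ → js a ≢ js a′) →
    dot b (ι ∘ emb js z) ≡ ∑ (λ a → b (js a) * ι (Vec.lookup z a))
  dot-emb {k = zero} b js [] d = trans (dot-def b _) (∑-0 (λ i → trans (cong (b i *_) ι-0) (*-zeroʳ (b i))))
  dot-emb {k = suc k} b js (c ∷ z) d = trans (dot-congʳ b step) (trans (dot-linʳ b (ι c) (δ (js zero)) 1ℚ (ι ∘ emb (js ∘ suc) z))
      (cong₂ _+_ (trans (cong (ι c *_) (trans (dot-comm b (δ (js zero))) (dot-δ (js zero) b))) (*-comm (ι c) (b (js zero))))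
        (trans (*-identityˡ _) (dot-emb b (js ∘ suc) z (λ a a′ l → d (suc a) (suc a′) (s≤s l))))))
    where
    l₁ : ∀ x → x ≡ x * 1ℚ + 1ℚ * 0ℚ
    l₁ = solve-∀ ℚ-ring
    l₂ : ∀ x y → y ≡ x * 0ℚ + 1ℚ * y
    l₂ = solve-∀ ℚ-ring
    step : ∀ i → ι (emb js (c ∷ z) i) ≡ lin (ι c) (δ (js zero)) 1ℚ (ι ∘ emb (js ∘ suc) z) i
    step i with i FinP.≟ js zero
    ... | yes refl = trans (l₁ (ι c)) (cong₂ (λ x y → ι c * x + 1ℚ * y) (sym (δ-refl i)) (sym (trans (cong ι (emb-off (js ∘ suc) z (λ a → d zero (suc a) (s≤s z≤n)))) ι-0)))
    ... | no ne = trans (l₂ (ι c) _) (cong (λ x → ι c * x + 1ℚ * ι (emb (js ∘ suc) z i)) (sym (δ-≢ (λ e → ne (sym e)))))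

  -- The entries run over 0, ..., N - 1, so that there are exactly N^k points.
  box : ∀ k → ℕ → List (Vec ℕ k)
  box zero    N = [] ∷ []
  box (suc k) N = List.cartesianProductWith _∷_ (List.upTo N) (box k N)

  box-unique : ∀ k N → Unique (box k N)
  box-unique zero    N = [] ∷ []
  box-unique (suc k) N = UniqueP.cartesianProductWith⁺ _∷_ (λ e → VecP.∷-injective e) (UniqueP.upTo⁺ N) (box-unique k N)

  length-cartesianProductWith : ∀ {A B C : Set} (f : A → B → C) xs ys →
    length (List.cartesianProductWith f xs ys) ≡ length xs ℕ.* length ys
  length-cartesianProductWith f []       ys = refl
  length-cartesianProductWith f (x ∷ xs) ys = trans (ListP.length-++ (map (f x) ys)) (cong₂ ℕ._+_ (ListP.length-map (f x) ys) (length-cartesianProductWith f xs ys))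

  length-box : ∀ k N → length (box k N) ≡ N ℕ.^ k
  length-box zero    N = refl
  length-box (suc k) N = trans (length-cartesianProductWith _∷_ (List.upTo N) (box k N)) (cong₂ ℕ._*_ (ListP.length-upTo N) (length-box k N))

  box-≤ : ∀ k N {z} → z ∈ box k N → ∀ a → Vec.lookup z a ℕ.≤ N
  box-≤ (suc k) N z∈ a with ∈-cartesianProductWith⁻ _∷_ (List.upTo N) (box k N) z∈
  box-≤ (suc k) N z∈ zero    | c , z , c∈ , _ , refl = ℕP.<⇒≤ (∈-upTo⁻ c∈)
  box-≤ (suc k) N z∈ (suc a) | c , z , _ , z∈′ , refl = box-≤ k N z∈′ a

  CountBound-≡ : ∀ {A : Set} {P : A → A → Set} → (∀ {x y} → P x y → x ≡ y) → CountBound P 1ℚ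
  CountBound-≡ e []          u p = subst (_≤ 1ℚ) (sym ι-0) 0≤1
  CountBound-≡ e (x ∷ [])    u p = ≤-reflexive ι-1
  CountBound-≡ e (x ∷ y ∷ M) ((x≢y ∷ _) ∷ _) p = contradiction (e (p (here refl) (there (here refl)))) x≢y

  ^-*ℕ : ∀ a m k → a ^ (m ℕ.* k) ≡ (a ^ m) ^ k
  ^-*ℕ a zero    k = sym (1^ k)
  ^-*ℕ a (suc m) k = trans (^-+ a k (m ℕ.* k)) (trans (cong (a ^ k *_) (^-*ℕ a m k)) (sym (*-^ a (a ^ m) k)))

  2^-large : ∀ n → n ℕ.≤ 2 ℕ.^ n
  2^-large zero    = z≤n
  2^-large (suc n) = ℕP.≤-trans (ℕP.+-mono-≤ (ℕP.m^n>0 2 n) (2^-large n)) (ℕP.≤-reflexive (cong (2 ℕ.^ n ℕ.+_) (sym (ℕP.+-identityʳ (2 ℕ.^ n)))))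

  -- Doubling separates distinct naturals by at least 2, so that a cell of width 1 determines the
  -- number.
  ι-near⇒≡ : ∀ m n → ∣ 2ℚ * ι m - 2ℚ * ι n ∣ ≤ 1ℚ → m ≡ n
  ι-near⇒≡ m n p = ℕP.≤-antisym (half m n p) (half n m (subst (_≤ 1ℚ) (∣p-q∣-sym (2ℚ * ι m) (2ℚ * ι n)) p))
    where
    half : ∀ m n → ∣ 2ℚ * ι m - 2ℚ * ι n ∣ ≤ 1ℚ → m ℕ.≤ n
    half m n p = ℕP.≤-pred (ι-cancel-< (≤-<-trans (*-cancelˡ-≤ {2ℚ} {ι m} {ι n + ℚ.½} 0<2 (≤-by _ (0≤+ (m≤n⇒0≤n-m (≤-trans (p≤∣p∣ (2ℚ * ι m - 2ℚ * ι n)) p)) ≤-refl) (e (ι m) (ι n))))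
        (<-by ℚ.½ (positive⁻¹ ℚ.½) (trans (ι-suc n) (e′ (ι n))))))
      where
      e : ∀ m n → 2ℚ * (n + ℚ.½) ≡ 2ℚ * m + (1ℚ - (2ℚ * m - 2ℚ * n) + 0ℚ)
      e = solve-∀ ℚ-ring
      e′ : ∀ n → 1ℚ + n ≡ n + ℚ.½ + ℚ.½
      e′ = solve-∀ ℚ-ring

  norm²≤dim : ∀ {s} (b : V s) → (∀ j → ∣ b j ∣ ≤ 1ℚ) → norm² b ≤ ι s
  norm²≤dim {s} b p = ≤-trans (≤-reflexive (dot-def b b)) (≤-trans (∑-mono (λ j → ∣∣≤⇒sq≤ (p j))) (≤-reflexive (trans (∑-const s (1ℚ * 1ℚ)) (*-identityʳ (ι s)))))

  -- The volume bound by counting lattice points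

  opaque
    -- The cost per coordinate: 5 for the rounding class, 7 for the cells of the frame `q′`, 2^5
    -- twice for the ball with B = 4k (k + B = 5k), and 9 for the integer points within a cell of
    -- the frame `v`.
    K₀ : ℚ
    K₀ = 2ℚ ^ 5 * 2ℚ ^ 5 * ((2ℚ * 2ℚ + 1ℚ) * ((4ℚ + 2ℚ + 1ℚ) * (4ℚ + 4ℚ + 1ℚ)))

    K₀-def : K₀ ≡ 2ℚ ^ 5 * 2ℚ ^ 5 * ((2ℚ * 2ℚ + 1ℚ) * ((4ℚ + 2ℚ + 1ℚ) * (4ℚ + 4ℚ + 1ℚ)))
    K₀-def = refl

    0<K₀ : 0ℚ < K₀
    0<K₀ = 0<* (0<* 0<32 0<32) (0<* (positive⁻¹ (2ℚ * 2ℚ + 1ℚ)) (0<* (positive⁻¹ (4ℚ + 2ℚ + 1ℚ)) (positive⁻¹ (4ℚ + 4ℚ + 1ℚ))))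
      where
      0<32 : 0ℚ < 2ℚ ^ 5
      0<32 = 0<^ 5 0<2

  -- The count is squared, whence `K₀ * K₀`; the two factors 4 are the losses of the approximate
  -- square roots for `q′` and `v`.
  C₂ : ℚ
  C₂ = 4ℚ * 4ℚ * (K₀ * K₀)

  0<C₂ : 0ℚ < C₂
  0<C₂ = 0<* (0<* 0<4 0<4) (0<* 0<K₀ 0<K₀)

  -- The points z ∈ {0,…,N}^k (N = 2^P large) placed on the columns js fall into at most 2^O(k) rounding
  -- classes. A class lies in the parallelepiped ∣b a · d∣ ≤ 2NH, which is cut into boxes along the
  -- Gram–Schmidt frame q′ of b; by Bessel's inequality such a box is covered by 2^O(k) boxes of the frame v,
  -- and the latter contain few integer points because v is triangular on js.
  module LatticeCount {n k : ℕ} (H : ℚ) (1≤H : 1ℚ ≤ H)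
    (b : Fin k → V (suc n)) (b≤1 : ∀ a j → ∣ b a j ∣ ≤ 1ℚ) (bal : Balanced H b)
    (q′ : Fin k → V (suc n)) (oq : Orth q′) (q′≤b : ∀ a → norm² (q′ a) ≤ norm² (b a))
    (control : ∀ a d → (∀ a′ → a Fin.< a′ → dot (q′ a′) d * dot (q′ a′) d ≤ norm² (q′ a′)) →
        (dot (q′ a) d - dot (b a) d) * (dot (q′ a) d - dot (b a) d) ≤ norm² (b a) * ι k)
    (js : Fin k → Fin (suc n)) (v : Fin k → V (suc n)) (ov : Orth v) (spv : ∀ a → Span q′ (v a))
    (diag : ∀ a → v a (js a) ≡ norm² (v a)) (tri : ∀ a a′ → a Fin.< a′ → v a′ (js a) ≡ 0ℚ)
    (v≤1 : ∀ a → norm² (v a) ≤ 1ℚ)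
    where

    s P N : ℕ
    s = suc n
    -- N = 2^P ≥ P exceeds both s k and s: the former absorbs the Gram-Schmidt error in `c-range`,
    -- the latter the additive 1 in the cell counts through `1≤NH/g`.
    P = s ℕ.* k ℕ.+ s
    N = 2 ℕ.^ P

    NQ : ℚ
    NQ = 2ℚ ^ P

    NQ≡ : NQ ≡ ι N
    NQ≡ = sym (trans (ι-^ 2 P) (cong (_^ P) ι-2))

    0≤H : 0ℚ ≤ H
    0≤H = ≤-trans 0≤1 1≤H

    0<NQ : 0ℚ < NQ
    0<NQ = 0<^ P 0<2

    ιP≤NQ : ι P ≤ NQ
    ιP≤NQ = subst (ι P ≤_) (sym NQ≡) (ι-mono (2^-large P))

    NQ≤NQH : NQ ≤ NQ * H
    NQ≤NQH = subst (_≤ NQ * H) (*-identityʳ NQ) (*-monoˡ-≤ (<⇒≤ 0<NQ) 1≤H)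

    A : Set
    A = Vec ℕ k

    js-≢ : ∀ a a′ → a Fin.< a′ → js a ≢ js a′
    js-≢ a a′ l e = >⇒≢ (pos ov a′) (trans (sym (diag a′)) (trans (cong (v a′) (sym e)) (tri a a′ l)))

    E : A → V s
    E z = ι ∘ emb js z

    d : A → A → V s
    d x y = lin 1ℚ (E x) (- 1ℚ) (E y)

    dot-d : ∀ u x y → dot u (d x y) ≡ dot u (E x) - dot u (E y)
    dot-d u x y = trans (dot-linʳ u 1ℚ (E x) (- 1ℚ) (E y)) (e (dot u (E x)) (dot u (E y)))
      where
      e : ∀ a b → 1ℚ * a + - 1ℚ * b ≡ a - b
      e = solve-∀ ℚ-ring

    InBox : A → A → Set
    InBox x y = (∀ a → Vec.lookup x a ℕ.≤ N) × (∀ a → Vec.lookup y a ℕ.≤ N)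

    -- Truncation at N makes `round` applicable to every vector; it changes nothing on the box.
    rounded : ∀ x → Σ[ w ∈ (Fin s → ℕ) ] (∀ j → w j ℕ.≤ 1) × (∀ j → emb js x j ℕ.⊓ N ≡ 0 → w j ≡ 0) ×
        (∀ r → ∣ dot (b r) (λ j → ι (emb js x j ℕ.⊓ N)) - NQ * dot (b r) (ι ∘ w) ∣ ≤ (NQ - 1ℚ) * H)
    rounded x = round bal P (λ j → emb js x j ℕ.⊓ N) (λ j → ℕP.m⊓n≤n (emb js x j) N)

    w : A → Fin s → ℕ
    w x = proj₁ (rounded x)

    -- Coordinates for four successive refinements: the rounded vector, the frame `q′`, the frame
    -- `v`, the point itself. The frames are normalised by the approximate lengths `g` and `h`.
    fᵇ fᶜ fᵈ fᵉ : Fin k → A → ℚ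
    fᵇ a x = 2ℚ * ι (w x (js a))

    Pᵇ : A → A → Set
    Pᵇ x y = InBox x y × (∀ a → ∣ fᵇ a x - fᵇ a y ∣ ≤ 1ℚ)

    w-off : ∀ x j → (∀ a → j ≢ js a) → w x j ≡ 0
    w-off x j ne = proj₁ (proj₂ (proj₂ (rounded x))) j (cong (ℕ._⊓ N) (emb-off js x ne))

    w-same : ∀ {x y} → (∀ a → ∣ fᵇ a x - fᵇ a y ∣ ≤ 1ℚ) → ∀ j → w x j ≡ w y j
    w-same {x} {y} p j with FinP.any? (λ a → j FinP.≟ js a)
    ... | yes (a , refl) = ι-near⇒≡ (w x (js a)) (w y (js a)) (p a)
    ... | no ne = trans (w-off x j (λ a e → ne (a , e))) (sym (w-off y j (λ a e → ne (a , e))))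

    rounding-error : ∀ {x} → (∀ a → Vec.lookup x a ℕ.≤ N) → ∀ r → ∣ dot (b r) (E x) - NQ * dot (b r) (ι ∘ w x) ∣ ≤ NQ * H
    rounding-error {x} x≤ r = ≤-trans (subst (λ z → ∣ z - NQ * dot (b r) (ι ∘ w x) ∣ ≤ (NQ - 1ℚ) * H)
        (dot-congʳ (b r) (λ j → cong ι (ℕP.m≤n⇒m⊓n≡m (emb-≤ js x x≤ j)))) (proj₂ (proj₂ (proj₂ (rounded x))) r))
        (*-monoʳ-≤ {H} {NQ - 1ℚ} {NQ} 0≤H (≤-by 1ℚ 0≤1 (e NQ)))
      where
      e : ∀ x → x ≡ x - 1ℚ + 1ℚ
      e = solve-∀ ℚ-ring

    -- Both points lie within N H of the same multiple N ⟨b r, w⟩ of their common rounding.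
    class-bound : ∀ {x y} → Pᵇ x y → ∀ r → ∣ dot (b r) (d x y) ∣ ≤ 2ℚ * (NQ * H)
    class-bound {x} {y} ((x≤ , y≤) , p) r = subst₂ _≤_ (cong ∣_∣ eq) (e₂ (NQ * H)) (≤-trans (∣p+q∣≤∣p∣+∣q∣ X (- Y))
        (+-mono-≤ (rounding-error x≤ r) (subst (_≤ NQ * H) (sym (∣-p∣≡∣p∣ Y)) (rounding-error y≤ r))))
      where
      X Y : ℚ
      X = dot (b r) (E x) - NQ * dot (b r) (ι ∘ w x)
      Y = dot (b r) (E y) - NQ * dot (b r) (ι ∘ w y)
      e₁ : ∀ x y z → x - z + - (y - z) ≡ x - y
      e₁ = solve-∀ ℚ-ring
      e₂ : ∀ x → x + x ≡ 2ℚ * x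
      e₂ = solve-∀ ℚ-ring
      eq : X + - Y ≡ dot (b r) (d x y)
      eq = trans (cong (λ z → X + - (dot (b r) (E y) - NQ * z)) (dot-congʳ (b r) (λ j → cong ι (sym (w-same p j)))))
         (trans (e₁ (dot (b r) (E x)) (dot (b r) (E y)) (NQ * dot (b r) (ι ∘ w x))) (sym (dot-d (b r) x y)))

    g : Fin k → ℚ
    g a = proj₁ (√-approx (pos oq a))
    0<g : ∀ a → 0ℚ < g a
    0<g a = proj₁ (proj₂ (√-approx (pos oq a)))
    g²≤ : ∀ a → g a * g a ≤ norm² (q′ a)
    g²≤ a = proj₁ (proj₂ (proj₂ (√-approx (pos oq a))))
    ≤4g² : ∀ a → norm² (q′ a) ≤ 4ℚ * (g a * g a)
    ≤4g² a = proj₂ (proj₂ (proj₂ (√-approx (pos oq a))))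
    h : Fin k → ℚ
    h a = proj₁ (√-approx (pos ov a))
    0<h : ∀ a → 0ℚ < h a
    0<h a = proj₁ (proj₂ (√-approx (pos ov a)))
    h²≤ : ∀ a → h a * h a ≤ norm² (v a)
    h²≤ a = proj₁ (proj₂ (proj₂ (√-approx (pos ov a))))
    ≤4h² : ∀ a → norm² (v a) ≤ 4ℚ * (h a * h a)
    ≤4h² a = proj₂ (proj₂ (proj₂ (√-approx (pos ov a))))

    fᶜ a x = dot (q′ a) (E x) * inv (g a)
    fᵈ a x = dot (v a) (E x) * inv (h a)
    fᵉ a x = 2ℚ * ι (Vec.lookup x a)

    scaled : ∀ (u : V s) c → 0ℚ < c → ∀ x y → (dot u (E x) * inv c - dot u (E y) * inv c) * c ≡ dot u (d x y)
    scaled u c 0<c x y = trans (e (dot u (E x)) (dot u (E y)) (inv c) c) (trans (cong ((dot u (E x) - dot u (E y)) *_) (inv-r⁺ 0<c)) (trans (*-identityʳ _) (sym (dot-d u x y))))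
      where
      e : ∀ a b i c → (a * i - b * i) * c ≡ (a - b) * (c * i)
      e = solve-∀ ℚ-ring

    scaled-sq : ∀ (u : V s) c → 0ℚ < c → ∀ x y → let f = dot u (E x) * inv c - dot u (E y) * inv c in f * f * (c * c) ≡ dot u (d x y) * dot u (d x y)
    scaled-sq u c 0<c x y = trans (e (dot u (E x) * inv c - dot u (E y) * inv c) c) (cong₂ _*_ (scaled u c 0<c x y) (scaled u c 0<c x y))
      where
      e : ∀ f c → f * f * (c * c) ≡ (f * c) * (f * c)
      e = solve-∀ ℚ-ring

    cell⇒ : ∀ a {x y} → ∣ fᶜ a x - fᶜ a y ∣ ≤ 1ℚ → dot (q′ a) (d x y) * dot (q′ a) (d x y) ≤ norm² (q′ a)
    cell⇒ a {x} {y} p = ≤-trans (subst₂ _≤_ (scaled-sq (q′ a) (g a) (0<g a) x y) (*-identityˡ (g a * g a)) (*-monoʳ-≤ (0≤sq (g a)) (∣∣≤⇒sq≤ p))) (g²≤ a)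

    b²≤s : ∀ a → norm² (b a) ≤ ι s
    b²≤s a = norm²≤dim (b a) (b≤1 a)

    sk≤NH : ι (s ℕ.* k) ≤ NQ * H
    sk≤NH = ≤-trans (ι-mono (ℕP.m≤m+n (s ℕ.* k) s)) (≤-trans ιP≤NQ NQ≤NQH)

    s≤NH : ι s ≤ NQ * H
    s≤NH = ≤-trans (ι-mono (ℕP.m≤n+m s (s ℕ.* k))) (≤-trans ιP≤NQ NQ≤NQH)

    1≤k : Fin k → 1 ℕ.≤ k
    1≤k a = ℕP.≤-trans (s≤s z≤n) (FinP.toℕ<n a)

    bk≤ : ∀ a → norm² (b a) * ι k ≤ ι (s ℕ.* k) * ι (s ℕ.* k)
    bk≤ a = ≤-trans (*-monoʳ-≤ (0≤ι k) (b²≤s a)) (subst₂ _≤_ (ι-* s k) (ι-* (s ℕ.* k) (s ℕ.* k)) (ι-mono (ℕP.m≤m*n (s ℕ.* k) (s ℕ.* k) {{ℕ.>-nonZero (ℕP.*-mono-≤ {1} {s} {1} {k} (s≤s z≤n) (1≤k a))}})))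

    -- Two of the three N H come from `class-bound`, the third bounds the Gram-Schmidt error.
    βᶜ : Fin k → ℚ
    βᶜ a = (2ℚ + 1ℚ) * (NQ * H) * inv (g a)

    0≤NH : 0ℚ ≤ NQ * H
    0≤NH = 0≤* (<⇒≤ 0<NQ) 0≤H

    c-range : ∀ a {x y} → Pᵇ x y → (∀ a′ → a Fin.< a′ → ∣ fᶜ a′ x - fᶜ a′ y ∣ ≤ 1ℚ) → ∣ fᶜ a x - fᶜ a y ∣ ≤ βᶜ a
    c-range a {x} {y} p q = *-cancelʳ-≤ (0<g a) (subst₂ _≤_ (sym l) (sym r) bound)
      where
      Q B : ℚ
      Q = dot (q′ a) (d x y)
      B = dot (b a) (d x y)
      e : ∀ q b → q ≡ (q - b) + b
      e = solve-∀ ℚ-ring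
      e₂ : ∀ x → x + 2ℚ * x ≡ (2ℚ + 1ℚ) * x
      e₂ = solve-∀ ℚ-ring
      bound : ∣ Q ∣ ≤ (2ℚ + 1ℚ) * (NQ * H)
      bound = subst₂ _≤_ (cong ∣_∣ (sym (e Q B))) (e₂ (NQ * H)) (≤-trans (∣p+q∣≤∣p∣+∣q∣ (Q - B) B)
        (+-mono-≤ (≤-trans (sq≤⇒∣∣≤ {Q - B} (0≤ι (s ℕ.* k)) (≤-trans (control a (d x y) (λ a′ l → cell⇒ a′ {x} {y} (q a′ l))) (bk≤ a))) sk≤NH) (class-bound p a)))
      l : ∣ fᶜ a x - fᶜ a y ∣ * g a ≡ ∣ Q ∣
      l = trans (cong (∣ fᶜ a x - fᶜ a y ∣ *_) (sym (0≤p⇒∣p∣≡p (<⇒≤ (0<g a))))) (trans (sym (∣p*q∣≡∣p∣*∣q∣ (fᶜ a x - fᶜ a y) (g a))) (cong ∣_∣ (scaled (q′ a) (g a) (0<g a) x y)))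
      r : βᶜ a * g a ≡ (2ℚ + 1ℚ) * (NQ * H)
      r = trans (e₃ ((2ℚ + 1ℚ) * (NQ * H)) (inv (g a)) (g a)) (trans (cong ((2ℚ + 1ℚ) * (NQ * H) *_) (inv-r⁺ (0<g a))) (*-identityʳ _))
        where
        e₃ : ∀ x i g → x * i * g ≡ x * (g * i)
        e₃ = solve-∀ ℚ-ring

    Pᶜ : A → A → Set
    Pᶜ x y = Pᵇ x y × (∀ a → ∣ fᶜ a x - fᶜ a y ∣ ≤ 1ℚ)

    -- The vectors `v a` lie in the span of `q′`, so only the projection of `d x y` to this span
    -- counts, and its squared length is at most k within a cell of `q′`. The factor 4 is the loss
    -- in replacing ∣v a∣ by `h a`.
    d-range : ∀ {x y} → Pᶜ x y → ∑ (λ a → (fᵈ a x - fᵈ a y) * (fᵈ a x - fᵈ a y)) ≤ ι (4 ℕ.* k)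
    d-range {x} {y} (_ , p) = ≤-trans (∑-mono term) (≤-trans (≤-reflexive (∑-*ˡ 4ℚ (λ a → dot dd (v a) * dot dd (v a) * inv (norm² (v a))))) (subst (4ℚ * lev v dd ≤_) (sym (trans (ι-* 4 k) (cong (_* ι k) ι-4))) (*-monoˡ-≤ (≤-trans 0≤1 (≤-by (2ℚ + 1ℚ) (0≤+ 0≤2 0≤1) refl)) lev≤k)))
      where
      dd : V s
      dd = d x y
      lev≡ : lev v dd ≡ lev v (proj q′ dd)
      lev≡ = ∑-cong (λ a → cong (λ z → z * z * inv (norm² (v a))) (sym (dot-span-proj oq dd (spv a))))
      lev≤k : lev v dd ≤ ι k
      lev≤k = ≤-trans (≤-reflexive lev≡) (≤-trans (bessel ov (proj q′ dd)) (≤-trans (≤-reflexive (norm²-proj oq dd)) (lev≤ q′ oq dd (λ a → cell⇒ a {x} {y} (p a)))))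
      term : ∀ a → (fᵈ a x - fᵈ a y) * (fᵈ a x - fᵈ a y) ≤ 4ℚ * (dot dd (v a) * dot dd (v a) * inv (norm² (v a)))
      term a = *-cancelʳ-≤ (pos ov a) (≤-trans (*-monoˡ-≤ (0≤sq F) (≤4h² a)) (≤-reflexive (trans (e₁ F (h a)) (trans (cong (4ℚ *_) (trans (scaled-sq (v a) (h a) (0<h a) x y) (cong₂ _*_ (dot-comm (v a) dd) (dot-comm (v a) dd))))
          (trans (cong (4ℚ *_) (trans (sym (*-identityʳ (dot dd (v a) * dot dd (v a)))) (cong (dot dd (v a) * dot dd (v a) *_) (sym (inv-r⁺ (pos ov a)))))) (e₂ (dot dd (v a)) (norm² (v a)) (inv (norm² (v a)))))))))
        where
        F : ℚ
        F = fᵈ a x - fᵈ a y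
        e₁ : ∀ f h → f * f * (4ℚ * (h * h)) ≡ 4ℚ * (f * f * (h * h))
        e₁ = solve-∀ ℚ-ring
        e₂ : ∀ d n i → 4ℚ * (d * d * (n * i)) ≡ 4ℚ * (d * d * i) * n
        e₂ = solve-∀ ℚ-ring

    Pᵈ : A → A → Set
    Pᵈ x y = Pᶜ x y × (∀ a → ∣ fᵈ a x - fᵈ a y ∣ ≤ 2ℚ)

    βᵉ : Fin k → ℚ
    βᵉ a = 4ℚ * inv (h a)

    -- By `tri` the earlier coordinates do not contribute, the later ones cancel by hypothesis, and
    -- `diag` evaluates the one that remains.
    dot-v : ∀ a x y → (∀ a′ → a Fin.< a′ → Vec.lookup x a′ ≡ Vec.lookup y a′) →
      dot (v a) (d x y) ≡ norm² (v a) * (ι (Vec.lookup x a) - ι (Vec.lookup y a))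
    dot-v a x y e = trans (dot-d (v a) x y) (trans (cong₂ _-_ (dot-emb (v a) js x js-≢) (dot-emb (v a) js y js-≢)) (trans (sym (trans (∑-cong (λ a′ → e₁ (v a (js a′)) (ι (Vec.lookup x a′)) (ι (Vec.lookup y a′)))) (trans (∑-lin 1ℚ (λ a′ → v a (js a′) * ι (Vec.lookup x a′)) (- 1ℚ) (λ a′ → v a (js a′) * ι (Vec.lookup y a′))) (e₂ (∑ (λ a′ → v a (js a′) * ι (Vec.lookup x a′))) (∑ (λ a′ → v a (js a′) * ι (Vec.lookup y a′)))))))
        (trans (∑-single a _ other) (cong (_* (ι (Vec.lookup x a) - ι (Vec.lookup y a))) (diag a)))))
      where
      e₁ : ∀ v x y → v * (x - y) ≡ 1ℚ * (v * x) + - 1ℚ * (v * y)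
      e₁ = solve-∀ ℚ-ring
      e₂ : ∀ x y → 1ℚ * x + - 1ℚ * y ≡ x - y
      e₂ = solve-∀ ℚ-ring
      other : ∀ a′ → a′ ≢ a → v a (js a′) * (ι (Vec.lookup x a′) - ι (Vec.lookup y a′)) ≡ 0ℚ
      other a′ ne with FinP.<-cmp a′ a
      ... | tri< l _ _ = trans (cong (_* (ι (Vec.lookup x a′) - ι (Vec.lookup y a′))) (tri a′ a l)) (*-zeroˡ (ι (Vec.lookup x a′) - ι (Vec.lookup y a′)))
      ... | tri≈ _ z _ = contradiction z ne
      ... | tri> _ _ l = trans (cong (λ z → v a (js a′) * (z - ι (Vec.lookup y a′))) (cong ι (e a′ l))) (trans (cong (v a (js a′) *_) (+-inverseʳ (ι (Vec.lookup y a′)))) (*-zeroʳ (v a (js a′))))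

    e-range : ∀ a {x y} → Pᵈ x y → (∀ a′ → a Fin.< a′ → ∣ fᵉ a′ x - fᵉ a′ y ∣ ≤ 1ℚ) → ∣ fᵉ a x - fᵉ a y ∣ ≤ βᵉ a
    e-range a {x} {y} (_ , p) q = *-cancelʳ-≤ (0<* (0<h a) (0<h a)) (≤-trans (*-monoˡ-≤ (0≤∣p∣ (fᵉ a x - fᵉ a y)) (h²≤ a)) (subst₂ _≤_ (sym l) (sym r) (*-monoˡ-≤ 0≤2 vd≤)))
      where
      Z : ℚ
      Z = ι (Vec.lookup x a) - ι (Vec.lookup y a)
      vd : dot (v a) (d x y) ≡ norm² (v a) * Z
      vd = dot-v a x y (λ a′ l → ι-near⇒≡ (Vec.lookup x a′) (Vec.lookup y a′) (q a′ l))
      vd≤ : ∣ norm² (v a) * Z ∣ ≤ 2ℚ * h a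
      vd≤ = subst (_≤ 2ℚ * h a) (trans (cong (∣ fᵈ a x - fᵈ a y ∣ *_) (sym (0≤p⇒∣p∣≡p (<⇒≤ (0<h a))))) (trans (sym (∣p*q∣≡∣p∣*∣q∣ (fᵈ a x - fᵈ a y) (h a))) (cong ∣_∣ (trans (scaled (v a) (h a) (0<h a) x y) vd)))) (*-monoʳ-≤ (<⇒≤ (0<h a)) (p a))
      l : ∣ fᵉ a x - fᵉ a y ∣ * norm² (v a) ≡ 2ℚ * ∣ norm² (v a) * Z ∣
      l = trans (cong (λ z → ∣ z ∣ * norm² (v a)) (e₁ (ι (Vec.lookup x a)) (ι (Vec.lookup y a)))) (trans (cong (_* norm² (v a)) (∣p*q∣≡∣p∣*∣q∣ 2ℚ Z)) (trans (e₂ ∣ Z ∣ (norm² (v a))) (cong (2ℚ *_) (sym (trans (∣p*q∣≡∣p∣*∣q∣ (norm² (v a)) Z) (cong (_* ∣ Z ∣) (0≤p⇒∣p∣≡p (0≤norm² (v a)))))))))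
        where
        e₁ : ∀ x y → 2ℚ * x - 2ℚ * y ≡ 2ℚ * (x - y)
        e₁ = solve-∀ ℚ-ring
        e₂ : ∀ z n → 2ℚ * z * n ≡ 2ℚ * (n * z)
        e₂ = solve-∀ ℚ-ring
      r : βᵉ a * (h a * h a) ≡ 2ℚ * (2ℚ * h a)
      r = trans (e₃ (inv (h a)) (h a)) (trans (cong (λ z → 2ℚ * (2ℚ * h a) * z) (inv-r⁺ (0<h a))) (*-identityʳ _))
        where
        e₃ : ∀ i h → 4ℚ * i * (h * h) ≡ 2ℚ * (2ℚ * h) * (h * i)
        e₃ = solve-∀ ℚ-ring

    0≤inv-g : ∀ a → 0ℚ ≤ inv (g a)
    0≤inv-g a = <⇒≤ (0<inv (0<g a))
    0≤inv-h : ∀ a → 0ℚ ≤ inv (h a)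
    0≤inv-h a = <⇒≤ (0<inv (0<h a))
    0≤βᶜ : ∀ a → 0ℚ ≤ βᶜ a
    0≤βᶜ a = 0≤* (0≤* (0≤+ 0≤2 0≤1) 0≤NH) (0≤inv-g a)
    0≤βᵉ : ∀ a → 0ℚ ≤ βᵉ a
    0≤βᵉ a = 0≤* 0≤4 (0≤inv-h a)

    Xᵉ Xᵈ Xᶜ Xᵇ : ℚ
    Xᵉ = ∏ (λ a → 2ℚ * βᵉ a + 1ℚ) * 1ℚ
    Xᵈ = 2ℚ ^ (5 ℕ.* k) * (2ℚ ^ (5 ℕ.* k) * Xᵉ)
    Xᶜ = ∏ (λ a → 2ℚ * βᶜ a + 1ℚ) * Xᵈ
    Xᵇ = ∏ {k} (λ a → 2ℚ * 2ℚ + 1ℚ) * Xᶜ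

    0≤Xᵉ : 0ℚ ≤ Xᵉ
    0≤Xᵉ = 0≤* (0≤∏ (λ a → 0≤+ (0≤* 0≤2 (0≤βᵉ a)) 0≤1)) 0≤1
    0≤Xᵈ : 0ℚ ≤ Xᵈ
    0≤Xᵈ = 0≤* (0≤^ (5 ℕ.* k) 0≤2) (0≤* (0≤^ (5 ℕ.* k) 0≤2) 0≤Xᵉ)
    0≤Xᶜ : 0ℚ ≤ Xᶜ
    0≤Xᶜ = 0≤* (0≤∏ (λ a → 0≤+ (0≤* 0≤2 (0≤βᶜ a)) 0≤1)) 0≤Xᵈ

    countᵉ : CountBound Pᵈ Xᵉ
    countᵉ = CountBound-cells* fᵉ βᵉ 0≤1 0≤βᵉ e-range (CountBound-≡ (λ { {x} {y} (_ , p) → VPE.Pointwise-≡⇒≡ (VPE.ext (λ a → ι-near⇒≡ (Vec.lookup x a) (Vec.lookup y a) (p a))) }))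

    countᵈ : CountBound Pᶜ Xᵈ
    countᵈ = CountBound-ball k (4 ℕ.* k) fᵈ 0≤Xᵉ d-range countᵉ

    countᶜ : CountBound Pᵇ Xᶜ
    countᶜ = CountBound-cells* fᶜ βᶜ 0≤Xᵈ 0≤βᶜ c-range countᵈ

    countᵇ : CountBound InBox Xᵇ
    countᵇ = CountBound-cells* fᵇ (λ _ → 2ℚ) 0≤Xᶜ (λ _ → 0≤2) (λ a {x} {y} _ _ → b-range a x y) countᶜ
      where
      bnd : ∀ m n → m ℕ.≤ 1 → 2ℚ * ι m - 2ℚ * ι n ≤ 2ℚ
      bnd m n p = ≤-by _ (0≤+ (0≤* 0≤2 (m≤n⇒0≤n-m (subst (ι m ≤_) ι-1 (ι-mono p)))) (0≤* 0≤2 (0≤ι n))) (e (ι m) (ι n))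
        where
        e : ∀ m n → 2ℚ ≡ 2ℚ * m - 2ℚ * n + (2ℚ * (1ℚ - m) + 2ℚ * n)
        e = solve-∀ ℚ-ring
      b-range : ∀ a x y → ∣ fᵇ a x - fᵇ a y ∣ ≤ 2ℚ
      b-range a x y = ∣∣≤-intro (bnd _ _ (proj₁ (proj₂ (rounded x)) (js a))) (subst (_≤ 2ℚ) (e (fᵇ a x) (fᵇ a y)) (bnd (w y (js a)) (w x (js a)) (proj₁ (proj₂ (rounded y)) (js a))))
        where
        e : ∀ x y → y - x ≡ - (x - y)
        e = solve-∀ ℚ-ring

    N^k≤ : NQ ^ k ≤ Xᵇ
    N^k≤ = subst (_≤ Xᵇ) (trans (cong ι (length-box k N)) (trans (ι-^ N k) (cong (_^ k) (sym NQ≡))))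
      (countᵇ (box k N) (box-unique k N) (λ x∈ y∈ → box-≤ k N x∈ , box-≤ k N y∈))

    1≤NH/g : ∀ a → 1ℚ ≤ NQ * H * inv (g a)
    1≤NH/g a = subst (_≤ NQ * H * inv (g a)) (inv-r⁺ (0<g a)) (*-monoʳ-≤ {inv (g a)} {g a} (0≤inv-g a) (≤-trans (sq-cancel-≤ {g a} (0≤ι s)
        (≤-trans (g²≤ a) (≤-trans (q′≤b a) (≤-trans (b²≤s a) (subst (_≤ ι s * ι s) (*-identityʳ (ι s)) (*-monoˡ-≤ (0≤ι s) (1≤ι (s≤s z≤n)))))))) s≤NH))

    1≤1/h : ∀ a → 1ℚ ≤ inv (h a)
    1≤1/h a = subst₂ _≤_ (inv-r⁺ (0<h a)) (*-identityˡ (inv (h a))) (*-monoʳ-≤ {inv (h a)} {h a} (0≤inv-h a) (sq-cancel-≤ {h a} 0≤1 (≤-trans (h²≤ a) (v≤1 a))))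

    c-factor : ∀ a → 2ℚ * βᶜ a + 1ℚ ≤ (4ℚ + 2ℚ + 1ℚ) * (NQ * H * inv (g a))
    c-factor a = ≤-by _ (m≤n⇒0≤n-m (1≤NH/g a)) (e (NQ * H) (inv (g a)))
      where
      e : ∀ x i → (4ℚ + 2ℚ + 1ℚ) * (x * i) ≡ 2ℚ * ((2ℚ + 1ℚ) * x * i) + 1ℚ + (x * i - 1ℚ)
      e = solve-∀ ℚ-ring

    e-factor : ∀ a → 2ℚ * βᵉ a + 1ℚ ≤ (4ℚ + 4ℚ + 1ℚ) * inv (h a)
    e-factor a = ≤-by _ (m≤n⇒0≤n-m (1≤1/h a)) (e (inv (h a)))
      where
      e : ∀ i → (4ℚ + 4ℚ + 1ℚ) * i ≡ 2ℚ * (4ℚ * i) + 1ℚ + (i - 1ℚ)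
      e = solve-∀ ℚ-ring

    y : Fin k → ℚ
    y a = K₀ * (H * (inv (g a) * inv (h a)))

    Xᵇ≤ : Xᵇ ≤ NQ ^ k * ∏ y
    Xᵇ≤ = ≤-trans (*-monoˡ-≤ (0≤∏ {k} (λ _ → 0≤+ (0≤* 0≤2 0≤2) 0≤1)) (*-mono-≤ (0≤∏ (λ a → 0≤+ (0≤* 0≤2 (0≤βᶜ a)) 0≤1))
          (0≤* (0≤^ (5 ℕ.* k) 0≤2) (0≤* (0≤^ (5 ℕ.* k) 0≤2) (≤-trans 0≤∏e (≤-reflexive (sym (*-identityʳ _))))))
          (∏-mono (λ a → 0≤+ (0≤* 0≤2 (0≤βᶜ a)) 0≤1) c-factor)
          (*-monoˡ-≤ (0≤^ (5 ℕ.* k) 0≤2) (*-monoˡ-≤ (0≤^ (5 ℕ.* k) 0≤2) (*-monoʳ-≤ 0≤1 (∏-mono (λ a → 0≤+ (0≤* 0≤2 (0≤βᵉ a)) 0≤1) e-factor))))))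
        (≤-reflexive eq)
      where
      pe : Fin k → ℚ
      pe a = (4ℚ + 4ℚ + 1ℚ) * inv (h a)
      pc : Fin k → ℚ
      pc a = (4ℚ + 2ℚ + 1ℚ) * (NQ * H * inv (g a))
      five q : ℚ
      five = 2ℚ * 2ℚ + 1ℚ
      q = 2ℚ ^ 5
      0≤∏e : 0ℚ ≤ ∏ pe
      0≤∏e = 0≤∏ (λ a → 0≤* (0≤+ (0≤+ 0≤4 0≤4) 0≤1) (0≤inv-h a))
      q^ : 2ℚ ^ (5 ℕ.* k) ≡ ∏ {k} (λ _ → q)
      q^ = trans (^-*ℕ 2ℚ 5 k) (sym (∏-const k q))
      e : ∀ f c q x h i l m → f * (c * (x * h * i) * (q * (q * (l * m)))) ≡ x * (q * q * (f * (c * l)) * (h * (i * m)))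
      e = solve-∀ ℚ-ring
      eq : ∏ {k} (λ a → five) * (∏ pc * (2ℚ ^ (5 ℕ.* k) * (2ℚ ^ (5 ℕ.* k) * (∏ pe * 1ℚ)))) ≡ NQ ^ k * ∏ y
      eq = trans (cong₂ (λ x z → ∏ {k} (λ a → five) * (∏ pc * (x * (x * z)))) q^ (*-identityʳ (∏ pe)))
         (trans (cong (∏ {k} (λ a → five) *_) (trans (cong (∏ pc *_) (trans (cong (∏ {k} (λ _ → q) *_) (sym (∏-* {k} (λ _ → q) pe))) (sym (∏-* {k} (λ _ → q) (λ a → q * pe a))))) (sym (∏-* pc (λ a → q * (q * pe a))))))
         (trans (sym (∏-* {k} (λ a → five) (λ a → pc a * (q * (q * pe a)))))
         (trans (∏-cong (λ a → trans (e five (4ℚ + 2ℚ + 1ℚ) q NQ H (inv (g a)) (4ℚ + 4ℚ + 1ℚ) (inv (h a))) (cong (λ z → NQ * (z * (H * (inv (g a) * inv (h a))))) (sym K₀-def))))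
         (trans (∏-* {k} (λ _ → NQ) y) (cong (_* ∏ y) (∏-const k NQ))))))

    -- N cancels: the box has N^k points, and on the other side only the k factors 2 `βᶜ` + 1 grow
    -- with N, each linearly.
    1≤∏y : 1ℚ ≤ ∏ y
    1≤∏y = *-cancelˡ-≤ (0<^ k 0<NQ) (≤-trans (≤-reflexive (*-identityʳ (NQ ^ k))) (≤-trans N^k≤ Xᵇ≤))

    volume : ∏ (λ a → norm² (q′ a) * (ι s * norm² (v a))) ≤ (C₂ * (H * H * ι s)) ^ k
    volume = ≤-trans (∏-mono (λ a → 0≤* (0≤norm² (q′ a)) (0≤* (0≤ι s) (0≤norm² (v a)))) term) (≤-trans one (≤-reflexive eq))
      where
      z : Fin k → ℚ
      z a = 4ℚ * (g a * g a) * (ι s * (4ℚ * (h a * h a)))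
      term : ∀ a → norm² (q′ a) * (ι s * norm² (v a)) ≤ z a
      term a = *-mono-≤ (0≤norm² (q′ a)) (0≤* (0≤ι s) (0≤* 0≤4 (0≤sq (h a)))) (≤4g² a) (*-monoˡ-≤ (0≤ι s) (≤4h² a))
      0≤∏z : 0ℚ ≤ ∏ z
      0≤∏z = 0≤∏ (λ a → 0≤* (0≤* 0≤4 (0≤sq (g a))) (0≤* (0≤ι s) (0≤* 0≤4 (0≤sq (h a)))))
      one : ∏ z ≤ ∏ z * (∏ y * ∏ y)
      one = subst (_≤ ∏ z * (∏ y * ∏ y)) (*-identityʳ (∏ z)) (*-monoˡ-≤ 0≤∏z (sq-mono-≤ 0≤1 1≤∏y))
      e : ∀ g s h K H i j → 4ℚ * (g * g) * (s * (4ℚ * (h * h))) * (K * (H * (i * j)) * (K * (H * (i * j)))) ≡ 4ℚ * 4ℚ * (K * K) * (H * H * s) * ((g * i) * (g * i) * ((h * j) * (h * j)))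
      e = solve-∀ ℚ-ring
      one* : ∀ x → x * (1ℚ * 1ℚ * (1ℚ * 1ℚ)) ≡ x
      one* = solve-∀ ℚ-ring
      eq : ∏ z * (∏ y * ∏ y) ≡ (C₂ * (H * H * ι s)) ^ k
      eq = trans (cong (∏ z *_) (sym (∏-* y y))) (trans (sym (∏-* z (λ a → y a * y a))) (trans (∏-cong (λ a → trans (e (g a) (ι s) (h a) K₀ H (inv (g a)) (inv (h a)))
         (trans (cong₂ (λ p r → C₂ * (H * H * ι s) * (p * p * (r * r))) (inv-r⁺ (0<g a)) (inv-r⁺ (0<h a))) (one* (C₂ * (H * H * ι s)))))) (∏-const k (C₂ * (H * H * ι s)))))

  -- A squared Lovász-Spencer-Vesztergombi bound for rectangular matrices: the lengths of `q` play
  -- the role of the determinant, and the factorial measures how much volume survives the passage to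
  -- k of the s columns.
  volume-bound : ∀ {n} k (H : ℚ) → 1ℚ ≤ H → (b q : Fin k → V (suc n)) → (∀ a j → ∣ b a j ∣ ≤ 1ℚ) → Balanced H b →
    (∀ a → 0ℚ < norm² (q a)) → (∀ a → dot (q a) (b a) ≡ norm² (q a)) → (∀ a a′ → a Fin.< a′ → dot (q a) (b a′) ≡ 0ℚ) →
    ι (k ℕ.!) * ∏ (λ a → norm² (q a)) ≤ (C₂ * (H * H * ι (suc n))) ^ k
  volume-bound {n} k H 1≤H b q b≤1 bal 0<q diag-q tri-q =
    let (q′ , oq , _ , q≤q′ , q′≤b , control) = gram-schmidt k k ℕP.≤-refl b q 0<q diag-q tri-q
        (js , v , ov , spv , diag , tri , v≤1 , fac) = choose-columns k q′ oq
    in ≤-trans (*-mono-≤ (0≤ι (k ℕ.!)) (0≤∏ (λ a → 0≤norm² (q′ a))) fac (∏-mono (λ a → 0≤norm² (q a)) q≤q′))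
         (≤-trans (≤-reflexive (trans (*-comm (∏ (λ a → ι (suc n) * norm² (v a))) (∏ (λ a → norm² (q′ a)))) (sym (∏-* (λ a → norm² (q′ a)) (λ a → ι (suc n) * norm² (v a))))))
           (LatticeCount.volume H 1≤H b b≤1 bal q′ oq q′≤b control js v ov spv diag tri v≤1))

  -- Factorial inequalities

  -- One term of the expansion of (1 + x)^(a+b), cleared of denominators. The induction is Pascal's
  -- rule, obtained by splitting the leading factor a + b of the factorial.
  !-binomial : ∀ x → 0ℚ ≤ x → ∀ a b → ι ((a ℕ.+ b) ℕ.!) * x ^ b ≤ ι (a ℕ.!) * ι (b ℕ.!) * (1ℚ + x) ^ (a ℕ.+ b)
  !-binomial x 0≤x zero b = subst₂ _≤_ refl (sym (trans (cong (λ z → z * ι (b ℕ.!) * (1ℚ + x) ^ b) ι-1) (cong (_* (1ℚ + x) ^ b) (*-identityˡ (ι (b ℕ.!))))))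
    (*-monoˡ-≤ (0≤ι (b ℕ.!)) (^-mono-≤ b 0≤x (≤-by 1ℚ 0≤1 (+-comm 1ℚ x))))
  !-binomial x 0≤x (suc a) zero = subst (λ k → ι (k ℕ.!) * 1ℚ ≤ ι (suc a ℕ.!) * ι 1 * (1ℚ + x) ^ k) (sym (ℕP.+-identityʳ (suc a)))
    (subst (λ z → ι (suc a ℕ.!) * 1ℚ ≤ z * (1ℚ + x) ^ suc a) (sym (trans (cong (ι (suc a ℕ.!) *_) ι-1) (*-identityʳ (ι (suc a ℕ.!)))))
     (*-monoˡ-≤ (0≤ι (suc a ℕ.!)) (subst (_≤ (1ℚ + x) ^ suc a) (1^ (suc a)) (^-mono-≤ (suc a) 0≤1 (≤-by x 0≤x refl)))))
  !-binomial x 0≤x (suc a) (suc b) = subst₂ _≤_ (sym lhs) (sym rhs) (+-mono-≤ (*-monoˡ-≤ (0≤ι (suc a)) (!-binomial x 0≤x a (suc b))) (*-monoˡ-≤ (0≤* (0≤ι (suc b)) 0≤x) (!-binomial x 0≤x (suc a) b)))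
    where
    n : ℕ
    n = a ℕ.+ suc b
    n≡ : suc a ℕ.+ b ≡ n
    n≡ = sym (ℕP.+-suc a b)
    e₁ : ∀ a b f x p → (a + b) * f * (x * p) ≡ a * (f * (x * p)) + b * x * (f * p)
    e₁ = solve-∀ ℚ-ring
    lhs : ι (suc n ℕ.!) * x ^ suc b ≡ ι (suc a) * (ι (n ℕ.!) * x ^ suc b) + ι (suc b) * x * (ι ((suc a ℕ.+ b) ℕ.!) * x ^ b)
    lhs = trans (cong (_* x ^ suc b) (trans (ι-* (suc n) (n ℕ.!)) (cong (_* ι (n ℕ.!)) (ι-+ (suc a) (suc b))))) (trans (e₁ (ι (suc a)) (ι (suc b)) (ι (n ℕ.!)) x (x ^ b))
       (cong (λ k → ι (suc a) * (ι (n ℕ.!) * x ^ suc b) + ι (suc b) * x * (ι (k ℕ.!) * x ^ b)) (sym n≡)))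
    e₂ : ∀ sa a sb b x y → sa * a * (sb * b) * ((1ℚ + x) * y) ≡ sa * (a * (sb * b) * y) + sb * x * (sa * a * b * y)
    e₂ = solve-∀ ℚ-ring
    rhs : ι (suc a ℕ.!) * ι (suc b ℕ.!) * (1ℚ + x) ^ suc n ≡ ι (suc a) * (ι (a ℕ.!) * ι (suc b ℕ.!) * (1ℚ + x) ^ n) + ι (suc b) * x * (ι (suc a ℕ.!) * ι (b ℕ.!) * (1ℚ + x) ^ (suc a ℕ.+ b))
    rhs = trans (cong₂ (λ u v → u * v * (1ℚ + x) ^ suc n) (ι-* (suc a) (a ℕ.!)) (ι-* (suc b) (b ℕ.!)))
       (trans (e₂ (ι (suc a)) (ι (a ℕ.!)) (ι (suc b)) (ι (b ℕ.!)) x ((1ℚ + x) ^ n))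
         (cong₂ _+_ (cong (λ v → ι (suc a) * (ι (a ℕ.!) * v * (1ℚ + x) ^ n)) (sym (ι-* (suc b) (b ℕ.!))))
           (cong₂ (λ u k → ι (suc b) * x * (u * ι (b ℕ.!) * (1ℚ + x) ^ k)) (sym (ι-* (suc a) (a ℕ.!))) (sym n≡))))

  k!k^k≤[2k]! : ∀ k j → (k ℕ.!) ℕ.* k ℕ.^ j ℕ.≤ (k ℕ.+ j) ℕ.!
  k!k^k≤[2k]! k zero    = ℕP.≤-reflexive (trans (ℕP.*-identityʳ _) (cong ℕ._! (sym (ℕP.+-identityʳ k))))
  k!k^k≤[2k]! k (suc j) = ℕP.≤-trans (ℕP.≤-reflexive (trans (sym (ℕP.*-assoc (k ℕ.!) k (k ℕ.^ j))) (trans (cong (ℕ._* k ℕ.^ j) (ℕP.*-comm (k ℕ.!) k)) (ℕP.*-assoc k (k ℕ.!) (k ℕ.^ j)))))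
    (ℕP.≤-trans (ℕP.*-mono-≤ (ℕP.≤-trans (ℕP.m≤m+n k j) (ℕP.n≤1+n _)) (k!k^k≤[2k]! k j)) (ℕP.≤-reflexive (cong ℕ._! (sym (ℕP.+-suc k j)))))

  -- Follows from k! k^k ≤ (2k)! ≤ 4^k k!², where the second inequality is `!-binomial` at x = 1.
  k^k≤4^kk! : ∀ k → ι k ^ k ≤ 4ℚ ^ k * ι (k ℕ.!)
  k^k≤4^kk! k = *-cancelˡ-≤ (0<ι (ℕP.1≤n! k)) (≤-trans (≤-trans (≤-reflexive (sym (trans (ι-* (k ℕ.!) (k ℕ.^ k)) (cong (ι (k ℕ.!) *_) (ι-^ k k))))) (ι-mono (k!k^k≤[2k]! k k)))
     (≤-trans (≤-reflexive (sym (trans (cong (ι ((k ℕ.+ k) ℕ.!) *_) (1^ k)) (*-identityʳ _))))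
     (≤-trans (!-binomial 1ℚ 0≤1 k k) (≤-reflexive (trans (cong (ι (k ℕ.!) * ι (k ℕ.!) *_) (trans (^-+ 2ℚ k k) (sym (*-^ 2ℚ 2ℚ k)))) (e (ι (k ℕ.!)) (4ℚ ^ k)))))))
    where
    e : ∀ a b → a * a * b ≡ a * (b * a)
    e = solve-∀ ℚ-ring

  -- Picking rows and splitting them by type

  All-lookup : ∀ {A : Set} {P : A → Set} {xs} → All P xs → ∀ a → P (List.lookup xs a)
  All-lookup (p ∷ _)  zero    = p
  All-lookup (_ ∷ ps) (suc a) = All-lookup ps a

  AllPairs-lookup : ∀ {A : Set} {R : A → A → Set} {xs} → AllPairs R xs → ∀ a a′ → a Fin.< a′ → R (List.lookup xs a) (List.lookup xs a′)
  AllPairs-lookup (p ∷ _)  zero    (suc a′) _ = All-lookup p a′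
  AllPairs-lookup (_ ∷ ps) (suc a) (suc a′) (s≤s l) = AllPairs-lookup ps a a′ l

  module _ {m s : ℕ} (B : Fin m → V s) where

    -- Rows picked so far, latest first, each with its component orthogonal to the rows picked before.
    Pick : Set
    Pick = Fin m × V s

    -- The condition passes to sublists with unchanged vectors. For a sublist these need no longer
    -- be the Gram-Schmidt vectors, but they bound their lengths from below; this is how Fischer's
    -- inequality enters without recomputing anything.
    Staircase : List Pick → Set
    Staircase xs = AllPairs (λ x x′ → dot (proj₂ x) (B (proj₁ x′)) ≡ 0ℚ) xs ×
      All (λ x → dot (proj₂ x) (B (proj₁ x)) ≡ norm² (proj₂ x) × 0ℚ < norm² (proj₂ x)) xs

    vol² : List Pick → ℚ
    vol² []       = 1ℚ
    vol² (x ∷ xs) = norm² (proj₂ x) * vol² xs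

    vol²≡∏ : ∀ xs → vol² xs ≡ ∏ (λ a → norm² (proj₂ (List.lookup xs a)))
    vol²≡∏ []       = refl
    vol²≡∏ (x ∷ xs) = cong (norm² (proj₂ x) *_) (vol²≡∏ xs)

    0≤vol² : ∀ xs → 0ℚ ≤ vol² xs
    0≤vol² []       = 0≤1
    0≤vol² (x ∷ xs) = 0≤* (0≤norm² (proj₂ x)) (0≤vol² xs)

    vol²-filter : {P : Pick → Set} (P? : ∀ x → Dec (P x)) → ∀ xs → vol² xs ≡ vol² (filter P? xs) * vol² (filter (λ x → ¬? (P? x)) xs)
    vol²-filter P? [] = refl
    vol²-filter P? (x ∷ xs) with P? x
    ... | yes _ = trans (cong (norm² (proj₂ x) *_) (vol²-filter P? xs)) (sym (*-assoc (norm² (proj₂ x)) _ _))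
    ... | no  _ = trans (cong (norm² (proj₂ x) *_) (vol²-filter P? xs)) (e (norm² (proj₂ x)) (vol² (filter P? xs)) (vol² (filter (λ x → ¬? (P? x)) xs)))
      where
      e : ∀ a b c → a * (b * c) ≡ b * (a * c)
      e = solve-∀ ℚ-ring

    staircase-filter : {P : Pick → Set} (P? : ∀ x → Dec (P x)) → ∀ {xs} → Staircase xs → Staircase (filter P? xs)
    staircase-filter P? (p , q) = AllPairsP.filter⁺ P? p , AllP.filter⁺ P? q

    module _ (τ : Fin m → ℕ) (Y : ℚ) (0≤Y : 0ℚ ≤ Y) where

      type : Pick → ℕ
      type x = τ (proj₁ x)

      -- Splits off the rows of the largest type and applies `!-binomial` with x the number of
      -- remaining types. Iterated, this is the multinomial inequality k! ≤ t^k ∏ kᵢ!.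
      vol²-types : ∀ t →
        (∀ i xs → i ℕ.< t → Staircase xs → All (λ x → type x ≡ i) xs → ι (length xs ℕ.!) * vol² xs ≤ Y ^ length xs) →
        ∀ xs → Staircase xs → All (λ x → type x ℕ.< t) xs → ι (length xs ℕ.!) * vol² xs ≤ ι t ^ length xs * Y ^ length xs
      vol²-types zero    hyp []       st []      = ≤-reflexive (trans (*-identityʳ (ι 1)) ι-1)
      vol²-types (suc x) hyp xs st τ< = *-cancelʳ-≤ 0<X^b (subst₂ _≤_ (sym lhs) (sym rhs)
          (≤-trans (*-monoʳ-≤ (0≤* (0≤vol² xs₁) (0≤vol² xs₂)) (!-binomial (ι x) (0≤ι x) a b))
           (≤-trans (≤-reflexive mid) (*-monoˡ-≤ (0≤^ (a ℕ.+ b) (0≤+ 0≤1 (0≤ι x))) (*-mono-≤ (0≤* (0≤ι (a ℕ.!)) (0≤vol² xs₁)) (0≤* (0≤^ b (0≤ι x)) (0≤^ b 0≤Y))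
             (hyp x xs₁ ℕP.≤-refl (staircase-filter is? st) (AllP.all-filter is? xs))
             (vol²-types x (λ i ys l → hyp i ys (ℕP.m≤n⇒m≤1+n l)) xs₂ (staircase-filter isn't? st) τ<x))))))
        where
        is? : ∀ p → Dec (type p ≡ x)
        is? p = type p ℕP.≟ x
        isn't? : ∀ p → Dec (¬ type p ≡ x)
        isn't? p = ¬? (is? p)
        xs₁ xs₂ : List Pick
        xs₁ = filter is? xs
        xs₂ = filter isn't? xs
        a b : ℕ
        a = length xs₁
        b = length xs₂
        τ<x : All (λ p → type p ℕ.< x) xs₂
        τ<x = All.zipWith (λ { (ne , l) → ℕP.≤∧≢⇒< (ℕP.≤-pred l) ne }) (AllP.all-filter isn't? xs , AllP.filter⁺ isn't? τ<)
        -- If no type is left then `xs₂` is empty and the power is 0^0 = 1, so the cancellation is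
        -- legitimate.
        0<X^b : 0ℚ < ι x ^ b
        0<X^b = go x xs₂ τ<x
          where
          go : ∀ x xs → All (λ p → type p ℕ.< x) xs → 0ℚ < ι x ^ length xs
          go x       []       _        = 0<1
          go zero    (_ ∷ _)  (() ∷ _)
          go (suc x) xs@(_ ∷ _) _      = 0<^ (length xs) (0<ι (s≤s z≤n))
        len : length xs ≡ a ℕ.+ b
        len = length-filter-split is? xs
        e₁ : ∀ f p q x → f * (p * q) * x ≡ f * x * (p * q)
        e₁ = solve-∀ ℚ-ring
        lhs : ι (length xs ℕ.!) * vol² xs * ι x ^ b ≡ ι ((a ℕ.+ b) ℕ.!) * ι x ^ b * (vol² xs₁ * vol² xs₂)
        lhs = trans (cong₂ (λ k v → ι (k ℕ.!) * v * ι x ^ b) len (vol²-filter is? xs)) (e₁ (ι ((a ℕ.+ b) ℕ.!)) (vol² xs₁) (vol² xs₂) (ι x ^ b))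
        e₂ : ∀ t p q x → t * (p * q) * x ≡ t * (p * (x * q))
        e₂ = solve-∀ ℚ-ring
        rhs : ι (suc x) ^ length xs * Y ^ length xs * ι x ^ b ≡ (1ℚ + ι x) ^ (a ℕ.+ b) * (Y ^ a * (ι x ^ b * Y ^ b))
        rhs = trans (cong₂ (λ z k → z ^ k * Y ^ k * ι x ^ b) (ι-suc x) len) (trans (cong (λ z → (1ℚ + ι x) ^ (a ℕ.+ b) * z * ι x ^ b) (^-+ Y a b)) (e₂ ((1ℚ + ι x) ^ (a ℕ.+ b)) (Y ^ a) (Y ^ b) (ι x ^ b)))
        e₃ : ∀ a b t p q → a * b * t * (p * q) ≡ t * (a * p * (b * q))
        e₃ = solve-∀ ℚ-ring
        mid : ι (a ℕ.!) * ι (b ℕ.!) * (1ℚ + ι x) ^ (a ℕ.+ b) * (vol² xs₁ * vol² xs₂) ≡ (1ℚ + ι x) ^ (a ℕ.+ b) * (ι (a ℕ.!) * vol² xs₁ * (ι (b ℕ.!) * vol² xs₂))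
        mid = e₃ (ι (a ℕ.!)) (ι (b ℕ.!)) ((1ℚ + ι x) ^ (a ℕ.+ b)) (vol² xs₁) (vol² xs₂)

    module _ (w : Fin m → ℚ) (0≤w : ∀ r → 0ℚ ≤ w r) (0<W : 0ℚ < ∑ w) (μ : ℚ) (0<μ : 0ℚ < μ) where

      energy : V s → ℚ
      energy y = ∑ (λ r → w r * (dot (B r) y * dot (B r) y))

      -- After exchanging sums, the weighted sum of the leverages of all rows is the sum of the
      -- normalised energies of the basis vectors. If none of the k vectors has small energy this
      -- exceeds k μ, so some row has leverage above k μ / Σ w. Cutting by that row keeps the
      -- remaining space orthogonal to everything picked.
      pick-rows : ∀ k (u : Fin k → V s) → Orth u → ∀ acc → Staircase acc → All (λ x → ∀ a → dot (B (proj₁ x)) (u a) ≡ 0ℚ) acc →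
        (Σ[ y ∈ V s ] Span u y × 0ℚ < norm² y × energy y ≤ μ * norm² y) ⊎
        (Σ[ xs ∈ List Pick ] length xs ≡ k ℕ.+ length acc × Staircase xs × ι (k ℕ.!) * μ ^ k * vol² acc ≤ ∑ w ^ k * vol² xs)
      pick-rows zero u o acc st _ = inj₂ (acc , refl , st , ≤-reflexive (cong (_* vol² acc) (trans (*-identityʳ (ι 1)) ι-1)))
      pick-rows (suc k) u o acc (st₁ , st₂) perp-acc with FinP.any? (λ a → energy (u a) ≤? μ * norm² (u a))
      ... | yes (a , p) = inj₁ (u a , span-member u a , pos o a , p)
      ... | no ¬p = result (pick-rows k u′ (proj₁ (proj₂ ct)) acc′ st′ perp′)
        where
        W : ℚ
        W = ∑ w
        c : ℚ
        c = ι (suc k) * μ * inv W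
        term : ∀ a → μ < inv (norm² (u a)) * energy (u a)
        term a = subst (_< inv (norm² (u a)) * energy (u a)) (trans (e μ (norm² (u a)) (inv (norm² (u a)))) (trans (cong (μ *_) (inv-r⁺ (pos o a))) (*-identityʳ μ))) (*-monoˡ-< (0<inv (pos o a)) (≰⇒> (λ q → ¬p (a , q))))
          where
          e : ∀ m n i → i * (m * n) ≡ m * (n * i)
          e = solve-∀ ℚ-ring
        ∑lev : ∑ (λ r → w r * lev u (B r)) ≡ ∑ (λ a → inv (norm² (u a)) * energy (u a))
        ∑lev = trans (∑-cong (λ r → sym (∑-*ˡ (w r) (λ a → dot (B r) (u a) * dot (B r) (u a) * inv (norm² (u a)))))) (trans (∑-swap (λ r a → w r * (dot (B r) (u a) * dot (B r) (u a) * inv (norm² (u a)))))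
           (∑-cong (λ a → trans (∑-cong (λ r → e (w r) (dot (B r) (u a)) (inv (norm² (u a))))) (∑-*ˡ (inv (norm² (u a))) (λ r → w r * (dot (B r) (u a) * dot (B r) (u a)))))))
          where
          e : ∀ w d i → w * (d * d * i) ≡ i * (w * (d * d))
          e = solve-∀ ℚ-ring
        cW≡ : c * W ≡ ι (suc k) * μ
        cW≡ = trans (*-assoc (ι (suc k) * μ) (inv W) W) (trans (cong (ι (suc k) * μ *_) (trans (*-comm (inv W) W) (inv-r⁺ 0<W))) (*-identityʳ (ι (suc k) * μ)))
        avg : ∃ λ r → c < lev u (B r)
        avg = weighted-average-< w (λ r → lev u (B r)) c 0≤w (subst₂ _<_ (trans (∑-const (suc k) μ) (sym cW≡)) (sym ∑lev) (∑-mono-< term))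
        r = proj₁ avg
        0<lev : 0ℚ < lev u (B r)
        0<lev = ≤-<-trans (0≤* (0≤* (0≤ι (suc k)) (<⇒≤ 0<μ)) (0≤inv (<⇒≤ 0<W))) (proj₂ avg)
        q : V s
        q = proj u (B r)
        nq : norm² q ≡ lev u (B r)
        nq = norm²-proj o (B r)
        ct = cut u o (B r) 0<lev
        u′ = proj₁ ct
        sp = proj₁ (proj₂ (proj₂ ct))
        B⊥ = proj₂ (proj₂ (proj₂ ct))
        acc′ : List Pick
        acc′ = (r , q) ∷ acc
        st′ : Staircase acc′
        st′ = All.map (λ {x} p → trans (dot-comm q (B (proj₁ x))) (span-proj u (B r) (B (proj₁ x)) p)) perp-acc ∷ st₁ ,
              (trans (dot-comm q (B r)) (trans (dot-lev u (B r)) (sym nq)) , subst (0ℚ <_) (sym nq) 0<lev) ∷ st₂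
        perp′ : All (λ x → ∀ a → dot (B (proj₁ x)) (u′ a) ≡ 0ℚ) acc′
        perp′ = B⊥ ∷ All.map (λ {x} p a → sp a (B (proj₁ x)) p) perp-acc
        kμ≤ : ι (suc k) * μ ≤ W * norm² q
        kμ≤ = subst₂ _≤_ (trans (*-comm W c) cW≡) (cong (W *_) (sym nq)) (*-monoˡ-≤ (<⇒≤ 0<W) (<⇒≤ (proj₂ avg)))
        result : _ → _
        result (inj₁ (y , s′ , rest)) = inj₁ (y , span-trans {u = u} {u′} {y} sp s′ , rest)
        result (inj₂ (xs , len , st″ , v)) = inj₂ (xs , trans len (ℕP.+-suc k (length acc)) , st″ ,
          subst₂ _≤_ (sym lhs) (sym (*-assoc W (W ^ k) (vol² xs))) (≤-trans (*-monoʳ-≤ (0≤* (0≤* (0≤ι (k ℕ.!)) (0≤^ k (<⇒≤ 0<μ))) (0≤vol² acc)) kμ≤)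
            (subst (_≤ W * (W ^ k * vol² xs)) (e₁ W (norm² q) (ι (k ℕ.!)) (μ ^ k) (vol² acc)) (*-monoˡ-≤ (<⇒≤ 0<W) v))))
          where
          e₁ : ∀ W n f p a → W * (f * p * (n * a)) ≡ W * n * (f * p * a)
          e₁ = solve-∀ ℚ-ring
          e₂ : ∀ s f m p a → s * f * (m * p) * a ≡ s * m * (f * p * a)
          e₂ = solve-∀ ℚ-ring
          lhs : ι (suc k ℕ.!) * μ ^ suc k * vol² acc ≡ ι (suc k) * μ * (ι (k ℕ.!) * μ ^ k * vol² acc)
          lhs = trans (cong (λ z → z * μ ^ suc k * vol² acc) (ι-* (suc k) (k ℕ.!))) (e₂ (ι (suc k)) (ι (k ℕ.!)) μ (μ ^ k) (vol² acc))

  -- A direction of small energy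

  -- Two of the factors 4 come from the two uses of k^k ≤ 4^k k!, the third from s² ≤ (2K)²; the
  -- additional 1 makes the contradiction in `too-large` strict.
  C₁ : ℚ
  C₁ = (4ℚ * 4ℚ * 4ℚ + 1ℚ) * C₂

  module _ {m n t : ℕ} (1≤t : 1 ℕ.≤ t) (B : Fin m → V (suc (suc n))) (B≤1 : ∀ r j → ∣ B r j ∣ ≤ 1ℚ)
    (τ : Fin m → ℕ) (τ<t : ∀ r → τ r ℕ.< t) (H : ℚ) (1≤H : 1ℚ ≤ H)
    (bal : ∀ i → i ℕ.< t → Balanced H (λ (x : Σ[ r ∈ Fin m ] τ r ≡ i) → B (proj₁ x)))
    (w : Fin m → ℚ) (0≤w : ∀ r → 0ℚ ≤ w r) (0<W : 0ℚ < ∑ w) where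

    private
      K s : ℕ
      -- The dimension s - 1 of a hyperplane orthogonal to x, in which the rows are picked.
      K = suc n
      s = suc K
      W Y Z μ : ℚ
      W = ∑ w
      Y = C₂ * (H * H * ι s)
      Z = C₂ * (W * (ι t * (H * H)))
      μ = (4ℚ * 4ℚ * 4ℚ + 1ℚ) * Z * inv (ι s)

      0<H : 0ℚ < H
      0<H = <-≤-trans 0<1 1≤H
      0<s : 0ℚ < ι s
      0<s = 0<ι (s≤s z≤n)
      0≤Y : 0ℚ ≤ Y
      0≤Y = 0≤* (<⇒≤ 0<C₂) (0≤* (<⇒≤ (0<* 0<H 0<H)) (0≤ι s))
      0<Z : 0ℚ < Z
      0<Z = 0<* 0<C₂ (0<* 0<W (0<* (0<ι 1≤t) (0<* 0<H 0<H)))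
      0<μ : 0ℚ < μ
      0<μ = 0<* (0<* (positive⁻¹ (4ℚ * 4ℚ * 4ℚ + 1ℚ)) 0<Z) (0<inv 0<s)
      sμ≡ : ι s * μ ≡ (4ℚ * 4ℚ * 4ℚ + 1ℚ) * Z
      sμ≡ = trans (e (ι s) ((4ℚ * 4ℚ * 4ℚ + 1ℚ) * Z) (inv (ι s))) (trans (cong ((4ℚ * 4ℚ * 4ℚ + 1ℚ) * Z *_) (inv-r⁺ 0<s)) (*-identityʳ _))
        where
        e : ∀ s z i → s * (z * i) ≡ z * (s * i)
        e = solve-∀ ℚ-ring

      one-type : ∀ i xs → i ℕ.< t → Staircase B xs → All (λ x → τ (proj₁ x) ≡ i) xs → ι (length xs ℕ.!) * vol² B xs ≤ Y ^ length xs
      one-type i xs i<t (st₁ , st₂) τ≡ = subst (λ v → ι (length xs ℕ.!) * v ≤ Y ^ length xs) (sym (vol²≡∏ B xs))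
        (volume-bound (length xs) H 1≤H (λ a → B (row a)) (λ a → proj₂ (List.lookup xs a)) (λ a → B≤1 (row a))
          (λ T → proj₁ (bal i i<t T) , λ a → proj₂ (bal i i<t T) (row a , All-lookup τ≡ a))
          (λ a → proj₂ (All-lookup st₂ a)) (λ a → proj₁ (All-lookup st₂ a)) (λ a a′ l → AllPairs-lookup st₁ a a′ l))
        where
        row : Fin (length xs) → Fin m
        row a = proj₁ (List.lookup xs a)

      -- Multiplying by a further K! brings in the upper bound on K! times the squared volume. Both
      -- factorials on the left are then replaced by (K/4)^K, and a K-th root leaves K² μ ≤ 16 W t
      -- Y, which is smaller than the choice of μ permits.
      too-large : ∀ xs → length xs ≡ K → Staircase B xs → ¬ ι (K ℕ.!) * μ ^ K * 1ℚ ≤ W ^ K * vol² B xs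
      too-large xs len st p = <-irrefl refl (<-≤-trans (<-by Z 0<Z (e₅ Z)) (≤-trans (≤-reflexive (sym sμ≡)) (*-cancelˡ-≤ 0<s last)))
        where
        f : ℚ
        f = ι (K ℕ.!)
        types : f * vol² B xs ≤ ι t ^ K * Y ^ K
        types = subst (λ k → ι (k ℕ.!) * vol² B xs ≤ ι t ^ k * Y ^ k) len
          (vol²-types B τ Y 0≤Y t one-type xs st (All.universal (λ x → τ<t (proj₁ x)) xs))
        0≤f : 0ℚ ≤ f
        0≤f = 0≤ι (K ℕ.!)
        0≤μ^ : 0ℚ ≤ μ ^ K
        0≤μ^ = 0≤^ K (<⇒≤ 0<μ)
        e₁ : ∀ f W v → f * (W * v) ≡ W * (f * v)
        e₁ = solve-∀ ℚ-ring
        ff : f * (f * μ ^ K) ≤ W ^ K * (ι t ^ K * Y ^ K)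
        ff = ≤-trans (*-monoˡ-≤ 0≤f (subst (_≤ W ^ K * vol² B xs) (*-identityʳ (f * μ ^ K)) p))
           (≤-trans (≤-reflexive (e₁ f (W ^ K) (vol² B xs))) (*-monoˡ-≤ (0≤^ K (<⇒≤ 0<W)) types))
        kk : ι K ^ K * ι K ^ K ≤ 4ℚ ^ K * f * (4ℚ ^ K * f)
        kk = sq-mono-≤ (0≤^ K (0≤ι K)) (k^k≤4^kk! K)
        e₂ : ∀ a f m → a * f * (a * f) * m ≡ a * a * (f * (f * m))
        e₂ = solve-∀ ℚ-ring
        pw : (ι K * ι K * μ) ^ K ≤ (4ℚ * 4ℚ * (W * (ι t * Y))) ^ K
        pw = subst₂ _≤_ (sym (trans (*-^ (ι K * ι K) μ K) (cong (_* μ ^ K) (*-^ (ι K) (ι K) K))))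
            (sym (trans (*-^ (4ℚ * 4ℚ) (W * (ι t * Y)) K) (cong₂ _*_ (*-^ 4ℚ 4ℚ K) (trans (*-^ W (ι t * Y) K) (cong (W ^ K *_) (*-^ (ι t) Y K))))))
            (≤-trans (*-monoʳ-≤ 0≤μ^ kk) (≤-trans (≤-reflexive (e₂ (4ℚ ^ K) f (μ ^ K))) (*-monoˡ-≤ (0≤* (0≤^ K 0≤4) (0≤^ K 0≤4)) ff)))
        KKμ : ι K * ι K * μ ≤ 4ℚ * 4ℚ * (W * (ι t * Y))
        KKμ = ^-cancel-≤ {ι K * ι K * μ} {4ℚ * 4ℚ * (W * (ι t * Y))} n (0≤* (nonNegative⁻¹ (4ℚ * 4ℚ)) (0≤* (<⇒≤ 0<W) (0≤* (0≤ι t) 0≤Y))) pw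
        s≤2K : ι s ≤ 2ℚ * ι K
        s≤2K = subst (ι s ≤_) (trans (ι-+ K K) (e (ι K))) (ι-mono (s≤s (ℕP.≤-trans (ℕP.≤-reflexive (ℕP.+-comm 1 n)) (ℕP.+-monoʳ-≤ n (s≤s z≤n)))))
          where
          e : ∀ x → x + x ≡ 2ℚ * x
          e = solve-∀ ℚ-ring
        e₃ : ∀ k m → 2ℚ * k * (2ℚ * k) * m ≡ 4ℚ * (k * k * m)
        e₃ = solve-∀ ℚ-ring
        e₄ : ∀ W t c h s → 4ℚ * (4ℚ * 4ℚ * (W * (t * (c * (h * h * s))))) ≡ s * (4ℚ * 4ℚ * 4ℚ * (c * (W * (t * (h * h)))))
        e₄ = solve-∀ ℚ-ring
        e₅ : ∀ z → (4ℚ * 4ℚ * 4ℚ + 1ℚ) * z ≡ 4ℚ * 4ℚ * 4ℚ * z + z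
        e₅ = solve-∀ ℚ-ring
        last : ι s * (ι s * μ) ≤ ι s * (4ℚ * 4ℚ * 4ℚ * Z)
        last = ≤-trans (≤-reflexive (sym (*-assoc (ι s) (ι s) μ))) (≤-trans (*-monoʳ-≤ (<⇒≤ 0<μ) (sq-mono-≤ (0≤ι s) s≤2K))
          (≤-trans (≤-reflexive (e₃ (ι K) μ)) (≤-trans (*-monoˡ-≤ 0≤4 KKμ) (≤-reflexive (e₄ W (ι t) C₂ H (ι s))))))

      hyperplane : ∀ x → Σ[ u ∈ (Fin K → V s) ] Orth u × (∀ a → dot x (u a) ≡ 0ℚ)
      hyperplane x with norm² x ≤? 0ℚ
      ... | yes p = δ ∘ suc , orth-tail orth-δ , λ a → dot≡0 (δ (suc a))
        where
        dot≡0 : ∀ v → dot x v ≡ 0ℚ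
        dot≡0 v with dot x v ≟ 0ℚ
        ... | yes z = z
        ... | no ¬z = contradiction (<-≤-trans (≢0⇒0<sq ¬z) (≤-trans (cauchy-schwarz x v) (≤-trans (*-monoʳ-≤ (0≤norm² v) p) (≤-reflexive (*-zeroˡ (norm² v)))))) (<-irrefl refl)
      ... | no ¬p = let (u , o , _ , z) = cut δ orth-δ x (<-≤-trans (≰⇒> ¬p) (≤-reflexive (sym lev≡))) in u , o , z
        where
        lev≡ : lev δ x ≡ norm² x
        lev≡ = trans (∑-cong (λ a → trans (cong₂ (λ d n → d * d * inv n) (trans (dot-comm x (δ a)) (dot-δ a x)) (trans (dot-δ a (δ a)) (δ-refl a))) (trans (cong (x a * x a *_) inv1) (*-identityʳ (x a * x a))))) (sym (dot-def x x))
          where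
          inv1 : inv 1ℚ ≡ 1ℚ
          inv1 = trans (sym (*-identityˡ (inv 1ℚ))) (inv-r⁺ 0<1)

    -- A failure to find y would produce the picks excluded by `too-large`. A unit vector in the
    -- direction of y may be irrational; division by the approximate length puts ∣y∣² between 1 and
    -- 4.
    small-direction : ∀ x → Σ[ y ∈ V (suc (suc n)) ] dot x y ≡ 0ℚ × 1ℚ ≤ norm² y × norm² y ≤ 4ℚ ×
      ι (suc (suc n)) * ∑ (λ r → w r * (dot (B r) y * dot (B r) y)) ≤ C₁ * (ι t * (H * H)) * (∑ w * norm² y)
    small-direction x with hyperplane x
    ... | u , o , x⊥u with pick-rows B w 0≤w 0<W μ 0<μ K u o [] ([] , []) []
    ...   | inj₂ (xs , len , st , p) = contradiction p (too-large xs (trans len (ℕP.+-identityʳ K)) st)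
    ...   | inj₁ (y , sp , 0<y , p) = y′ , x⊥y′ , 1≤y′ , y′≤4 , bound
      where
      g i : ℚ
      g = proj₁ (√-approx 0<y)
      i = inv g
      0<g : 0ℚ < g
      0<g = proj₁ (proj₂ (√-approx 0<y))
      y′ : V s
      y′ = lin i y 0ℚ y
      dot-y′ : ∀ v → dot v y′ ≡ i * dot v y
      dot-y′ v = trans (dot-linʳ v i y 0ℚ y) (e i (dot v y))
        where
        e : ∀ i d → i * d + 0ℚ * d ≡ i * d
        e = solve-∀ ℚ-ring
      norm-y′ : norm² y′ ≡ i * i * norm² y
      norm-y′ = trans (norm²-lin i y 0ℚ y) (e i (norm² y))
        where
        e : ∀ i d → i * i * d + 2ℚ * (i * 0ℚ) * d + 0ℚ * 0ℚ * d ≡ i * i * d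
        e = solve-∀ ℚ-ring
      0≤ii : 0ℚ ≤ i * i
      0≤ii = 0≤sq i
      iigg : i * i * (g * g) ≡ 1ℚ
      iigg = trans (e i g) (cong₂ _*_ (inv-r⁺ 0<g) (inv-r⁺ 0<g))
        where
        e : ∀ i g → i * i * (g * g) ≡ (g * i) * (g * i)
        e = solve-∀ ℚ-ring
      x⊥y′ : dot x y′ ≡ 0ℚ
      x⊥y′ = trans (dot-y′ x) (trans (cong (i *_) (sp x x⊥u)) (*-zeroʳ i))
      1≤y′ : 1ℚ ≤ norm² y′
      1≤y′ = subst₂ _≤_ iigg (sym norm-y′) (*-monoˡ-≤ 0≤ii (proj₁ (proj₂ (proj₂ (√-approx 0<y)))))
      y′≤4 : norm² y′ ≤ 4ℚ
      y′≤4 = ≤-trans (≤-reflexive norm-y′) (≤-trans (*-monoˡ-≤ 0≤ii (proj₂ (proj₂ (proj₂ (√-approx 0<y))))) (≤-reflexive (trans (e (i * i) (g * g)) (trans (cong (4ℚ *_) iigg) (*-identityʳ 4ℚ)))))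
        where
        e : ∀ a b → a * (4ℚ * b) ≡ 4ℚ * (a * b)
        e = solve-∀ ℚ-ring
      en : ∑ (λ r → w r * (dot (B r) y′ * dot (B r) y′)) ≡ i * i * energy B w 0≤w 0<W μ 0<μ y
      en = trans (∑-cong (λ r → trans (cong (λ z → w r * (z * z)) (dot-y′ (B r))) (e (w r) i (dot (B r) y)))) (∑-*ˡ (i * i) (λ r → w r * (dot (B r) y * dot (B r) y)))
        where
        e : ∀ w i d → w * (i * d * (i * d)) ≡ i * i * (w * (d * d))
        e = solve-∀ ℚ-ring
      bound : ι s * ∑ (λ r → w r * (dot (B r) y′ * dot (B r) y′)) ≤ C₁ * (ι t * (H * H)) * (W * norm² y′)
      bound = ≤-trans (≤-reflexive (cong (ι s *_) en)) (≤-trans (*-monoˡ-≤ (0≤ι s) (*-monoˡ-≤ 0≤ii p)) (≤-reflexive (trans (e₁ (ι s) (i * i) μ (norm² y)) (trans (cong (_* (i * i * norm² y)) sμ≡) (trans (e₂ (4ℚ * 4ℚ * 4ℚ + 1ℚ) C₂ W (ι t) (H * H) (i * i * norm² y)) (cong (λ z → C₁ * (ι t * (H * H)) * (W * z)) (sym norm-y′)))))))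
        where
        e₁ : ∀ s i m n → s * (i * (m * n)) ≡ s * m * (i * n)
        e₁ = solve-∀ ℚ-ring
        e₂ : ∀ k c W t h n → k * (c * (W * (t * h))) * n ≡ k * c * (t * h) * (W * n)
        e₂ = solve-∀ ℚ-ring

  -- The potential

  module TwoPoint (a X z η : ℚ) (0≤a : 0ℚ ≤ a) (0≤X : 0ℚ ≤ X) (X≤ : X ≤ η * a) (zz≤ : z * z ≤ η * (a * a)) (0≤η : 0ℚ ≤ η) where

    -- (a + X ± z)^q = even q ± z · odd q
    even odd : ℕ → ℚ
    even zero    = 1ℚ
    even (suc q) = (a + X) * even q + z * z * odd q
    odd zero    = 0ℚ
    odd (suc q) = (a + X) * odd q + even q

    plus : ∀ q → (a + X + z) ^ q ≡ even q + z * odd q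
    plus zero    = e z
      where
      e : ∀ z → 1ℚ ≡ 1ℚ + z * 0ℚ
      e = solve-∀ ℚ-ring
    plus (suc q) = trans (cong ((a + X + z) *_) (plus q)) (e (a + X) z (even q) (odd q))
      where
      e : ∀ b z c d → (b + z) * (c + z * d) ≡ b * c + z * z * d + z * (b * d + c)
      e = solve-∀ ℚ-ring

    minus : ∀ q → (a + X - z) ^ q ≡ even q - z * odd q
    minus zero    = e z
      where
      e : ∀ z → 1ℚ ≡ 1ℚ - z * 0ℚ
      e = solve-∀ ℚ-ring
    minus (suc q) = trans (cong ((a + X - z) *_) (minus q)) (e (a + X) z (even q) (odd q))
      where
      e : ∀ b z c d → (b - z) * (c - z * d) ≡ b * c + z * z * d - z * (b * d + c)
      e = solve-∀ ℚ-ring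

    0≤even : ∀ q → 0ℚ ≤ even q
    0≤odd : ∀ q → 0ℚ ≤ odd q
    0≤even zero    = 0≤1
    0≤even (suc q) = 0≤+ (0≤* (0≤+ 0≤a 0≤X) (0≤even q)) (0≤* (0≤sq z) (0≤odd q))
    0≤odd zero    = ≤-refl
    0≤odd (suc q) = 0≤+ (0≤* (0≤+ 0≤a 0≤X) (0≤odd q)) (0≤even q)

    small-mono : ∀ {q p} → q ℕ.≤ p → 4ℚ * (ι p * ι p) * η ≤ 1ℚ → 4ℚ * (ι q * ι q) * η ≤ 1ℚ
    small-mono {q} {p} l s = ≤-trans (*-monoʳ-≤ 0≤η (*-monoˡ-≤ {4ℚ} {ι q * ι q} {ι p * ι p} 0≤4 (sq-mono-≤ (0≤ι q) (ι-mono l)))) s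

    ιq≤ : ∀ q → ι q ≤ ι q * ι q
    ιq≤ zero    = subst (λ z → z ≤ z * z) (sym ι-0) (≤-reflexive (sym (*-zeroˡ 0ℚ)))
    ιq≤ (suc q) = subst (_≤ ι (suc q) * ι (suc q)) (*-identityʳ (ι (suc q))) (*-monoˡ-≤ (0≤ι (suc q)) (1≤ι (s≤s z≤n)))

    -- The odd part feeds the even part with the factor z² ≤ η a², so both are bounded together. The
    -- smallness of q² η keeps the terms of second order in η within the slack between q² and (q +
    -- 1)².
    bounds : ∀ q → 4ℚ * (ι q * ι q) * η ≤ 1ℚ →
      (even q ≤ a ^ q * (1ℚ + 2ℚ * (ι q * ι q) * η)) × (a * odd q ≤ a ^ q * (2ℚ * ι q))
    bounds zero    _ = ≤-reflexive (trans (e η) (cong (λ z → 1ℚ * (1ℚ + 2ℚ * (z * z) * η)) (sym ι-0))) , ≤-reflexive (trans (e′ a) (cong (λ z → 1ℚ * (2ℚ * z)) (sym ι-0)))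
      where
      e : ∀ η → 1ℚ ≡ 1ℚ * (1ℚ + 2ℚ * (0ℚ * 0ℚ) * η)
      e = solve-∀ ℚ-ring
      e′ : ∀ a → a * 0ℚ ≡ 1ℚ * (2ℚ * 0ℚ)
      e′ = solve-∀ ℚ-ring
    bounds (suc q) s with bounds q (small-mono (ℕP.n≤1+n q) s)
    ... | E , O = even≤ , odd≤
      where
      Q A : ℚ
      Q = ι q
      A = a ^ q
      0≤A : 0ℚ ≤ A
      0≤A = 0≤^ q 0≤a
      0≤Q : 0ℚ ≤ Q
      0≤Q = 0≤ι q
      small : 4ℚ * (Q * Q) * η ≤ 1ℚ
      small = small-mono (ℕP.n≤1+n q) s
      gap : 0ℚ ≤ 1ℚ - 4ℚ * (Q * Q) * η
      gap = m≤n⇒0≤n-m small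
      aX≤ : a + X ≤ (1ℚ + η) * a
      aX≤ = ≤-by _ (m≤n⇒0≤n-m X≤) (e a X η)
        where
        e : ∀ a X η → (1ℚ + η) * a ≡ a + X + (η * a - X)
        e = solve-∀ ℚ-ring
      even≤ : even (suc q) ≤ a ^ suc q * (1ℚ + 2ℚ * (ι (suc q) * ι (suc q)) * η)
      even≤ = ≤-trans (+-mono-≤ (*-mono-≤ (0≤+ 0≤a 0≤X) (0≤* 0≤A (0≤+ 0≤1 (0≤* (0≤* 0≤2 (0≤sq Q)) 0≤η))) aX≤ E)
          (≤-trans (*-monoʳ-≤ (0≤odd q) zz≤) (≤-trans (≤-reflexive (e₀ η a (odd q))) (*-monoˡ-≤ (0≤* 0≤η 0≤a) O))))
        (≤-trans (≤-by (a * A * (η * ((1ℚ - 4ℚ * (Q * Q) * η) + 2ℚ * Q + 2ℚ * (Q * Q) * η)))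
            (0≤* (0≤* 0≤a 0≤A) (0≤* 0≤η (0≤+ (0≤+ gap (0≤* 0≤2 0≤Q)) (0≤* (0≤* 0≤2 (0≤sq Q)) 0≤η)))) (e₁ a A Q η)) (≤-reflexive (cong (λ z → a * A * (1ℚ + 2ℚ * (z * z) * η)) (sym (ι-suc q)))))
        where
        e₀ : ∀ η a o → η * (a * a) * o ≡ η * a * (a * o)
        e₀ = solve-∀ ℚ-ring
        e₁ : ∀ a A Q η → a * A * (1ℚ + 2ℚ * ((1ℚ + Q) * (1ℚ + Q)) * η) ≡ ((1ℚ + η) * a * (A * (1ℚ + 2ℚ * (Q * Q) * η)) + η * a * (A * (2ℚ * Q))) + a * A * (η * ((1ℚ - 4ℚ * (Q * Q) * η) + 2ℚ * Q + 2ℚ * (Q * Q) * η))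
        e₁ = solve-∀ ℚ-ring
      odd≤ : a * odd (suc q) ≤ a ^ suc q * (2ℚ * ι (suc q))
      odd≤ = ≤-trans (≤-reflexive (e₀ a (a + X) (odd q) (even q)))
        (≤-trans (+-mono-≤ (*-mono-≤ (0≤+ 0≤a 0≤X) (0≤* 0≤A (0≤* 0≤2 0≤Q)) aX≤ O) (*-monoˡ-≤ 0≤a E))
        (≤-trans (≤-by (a * A * ((1ℚ - 4ℚ * (Q * Q) * η) + 2ℚ * ((Q * Q - Q) * η)))
            (0≤* (0≤* 0≤a 0≤A) (0≤+ gap (0≤* 0≤2 (0≤* (m≤n⇒0≤n-m (ιq≤ q)) 0≤η)))) (e₁ a A Q η)) (≤-reflexive (cong (λ z → a * A * (2ℚ * z)) (sym (ι-suc q))))))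
        where
        e₀ : ∀ a b o e → a * (b * o + e) ≡ b * (a * o) + a * e
        e₀ = solve-∀ ℚ-ring
        e₁ : ∀ a A Q η → a * A * (2ℚ * (1ℚ + Q)) ≡ ((1ℚ + η) * a * (A * (2ℚ * Q)) + a * (A * (1ℚ + 2ℚ * (Q * Q) * η))) + a * A * ((1ℚ - 4ℚ * (Q * Q) * η) + 2ℚ * ((Q * Q - Q) * η))
        e₁ = solve-∀ ℚ-ring

  module Potential (p : ℕ) (S : ℚ) (0<S : 0ℚ < S) where

    φ : ℚ → ℚ
    φ u = (S + u * u) ^ p

    0<φ : ∀ u → 0ℚ < φ u
    0<φ u = 0<^ p (0<+ 0<S (0≤sq u))

    -- The terms odd in h cancel between u + h and u - h; the rest is of relative size p² h² / S.
    φ-two-point : ∀ u h → 4ℚ * (ι p * ι p) * (h * h) ≤ S →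
      φ (u + h) + φ (u - h) ≤ 2ℚ * φ u + 4ℚ * (ι p * ι p) * inv S * (φ u * (h * h))
    φ-two-point u h small = ≤-trans (≤-reflexive eq) (≤-trans (*-monoˡ-≤ 0≤2 (proj₁ (bounds p small′))) (≤-reflexive (e₆ (φ u) (ι p * ι p) (h * h) (inv S))))
      where
      a X z η : ℚ
      a = S + u * u
      X = h * h
      z = 2ℚ * (u * h)
      η = h * h * inv S
      0≤i : 0ℚ ≤ inv S
      0≤i = <⇒≤ (0<inv 0<S)
      0≤η : 0ℚ ≤ η
      0≤η = 0≤* (0≤sq h) 0≤i
      ηS≡ : η * S ≡ h * h
      ηS≡ = trans (e (h * h) (inv S) S) (trans (cong (h * h *_) (inv-r⁺ 0<S)) (*-identityʳ (h * h)))
        where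
        e : ∀ h i s → h * i * s ≡ h * (s * i)
        e = solve-∀ ℚ-ring
      X≤ : X ≤ η * a
      X≤ = ≤-by (η * (u * u)) (0≤* 0≤η (0≤sq u)) (trans (*-distribˡ-+ η S (u * u)) (cong (_+ η * (u * u)) ηS≡))
      -- This is 4 S u² ≤ (S + u²)², multiplied by η.
      zz≤ : z * z ≤ η * (a * a)
      zz≤ = ≤-by (η * ((S - u * u) * (S - u * u))) (0≤* 0≤η (0≤sq (S - u * u))) (trans (e η S u) (cong (_+ η * ((S - u * u) * (S - u * u))) (trans (cong (λ x → 4ℚ * (u * u) * x) ηS≡) (e′ u h))))
        where
        e : ∀ η S u → η * ((S + u * u) * (S + u * u)) ≡ 4ℚ * (u * u) * (η * S) + η * ((S - u * u) * (S - u * u))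
        e = solve-∀ ℚ-ring
        e′ : ∀ u h → 4ℚ * (u * u) * (h * h) ≡ 2ℚ * (u * h) * (2ℚ * (u * h))
        e′ = solve-∀ ℚ-ring
      small′ : 4ℚ * (ι p * ι p) * η ≤ 1ℚ
      small′ = subst₂ _≤_ (*-assoc (4ℚ * (ι p * ι p)) (h * h) (inv S)) (inv-r⁺ 0<S) (*-monoʳ-≤ 0≤i small)
      open TwoPoint a X z η (<⇒≤ (0<+ 0<S (0≤sq u))) (0≤sq h) X≤ zz≤ 0≤η
      e₁ : ∀ s u h → s + (u + h) * (u + h) ≡ s + u * u + h * h + 2ℚ * (u * h)
      e₁ = solve-∀ ℚ-ring
      e₂ : ∀ s u h → s + (u - h) * (u - h) ≡ s + u * u + h * h - 2ℚ * (u * h)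
      e₂ = solve-∀ ℚ-ring
      e₃ : ∀ c z d → c + z * d + (c - z * d) ≡ 2ℚ * c
      e₃ = solve-∀ ℚ-ring
      eq : φ (u + h) + φ (u - h) ≡ 2ℚ * even p
      eq = trans (cong₂ _+_ (trans (cong (_^ p) (e₁ S u h)) (plus p)) (trans (cong (_^ p) (e₂ S u h)) (minus p))) (e₃ (even p) z (odd p))
      e₆ : ∀ f p h i → 2ℚ * (f * (1ℚ + 2ℚ * p * (h * i))) ≡ 2ℚ * f + 4ℚ * p * i * (f * h)
      e₆ = solve-∀ ℚ-ring

  -- Walking to a vertex of the cube

  dot-punchIn : ∀ {n} j (u v : V (suc n)) → dot u v ≡ u j * v j + dot (u ∘ punchIn j) (v ∘ punchIn j)
  dot-punchIn j u v = trans (dot-def u v) (trans (∑-punchIn j (λ i → u i * v i)) (cong ((u j * v j) +_) (sym (dot-def (u ∘ punchIn j) (v ∘ punchIn j)))))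

  Balanced-punchIn : ∀ {s} {R : Set} {H} {b : R → V (suc s)} j → Balanced H b → Balanced H (λ r → b r ∘ punchIn j)
  Balanced-punchIn {H = H} {b} j bal T = χ ∘ punchIn j , λ r → subst (λ z → ∣ z ∣ ≤ H) (eq r) (proj₂ (bal T′) r)
    where
    T′ : _
    T′ = VF.insertAt T j false
    χ : _
    χ = proj₁ (bal T′)
    e : ∀ b s → b * (0ℚ * s) ≡ 0ℚ
    e = solve-∀ ℚ-ring
    eq : ∀ r → dot (b r) (λ i → ind (T′ i) * sgn (χ i)) ≡ dot (b r ∘ punchIn j) (λ i → ind (T i) * sgn (χ (punchIn j i)))
    eq r = trans (dot-punchIn j (b r) _) (trans (cong₂ _+_ (trans (cong (λ x → b r j * (ind x * sgn (χ j))) (VFP.insertAt-lookup T j false)) (e (b r j) (sgn (χ j))))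
        (dot-congʳ (b r ∘ punchIn j) (λ i → cong (λ x → ind x * sgn (χ (punchIn j i))) (VFP.insertAt-punchIn T j false i)))) (+-identityˡ _))

  -- harmonic s = Σ 1/j over 1 ≤ j < s
  harmonic : ℕ → ℚ
  harmonic zero          = 0ℚ
  harmonic (suc zero)    = 0ℚ
  harmonic (suc (suc s)) = harmonic (suc s) + inv (ι (suc s))

  0≤harmonic : ∀ s → 0ℚ ≤ harmonic s
  0≤harmonic zero          = ≤-refl
  0≤harmonic (suc zero)    = ≤-refl
  0≤harmonic (suc (suc s)) = 0≤+ (0≤harmonic (suc s)) (0≤inv (0≤ι (suc s)))

  ∣∣-bound : ∀ {a b} → ∣ a ∣ ≤ b → a ≤ b × - b ≤ a
  ∣∣-bound {a} {b} p = ≤-trans (p≤∣p∣ a) p , ≤-by _ (m≤n⇒0≤n-m (≤-trans (-p≤∣p∣ a) p)) (e a b)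
    where
    e : ∀ a b → a ≡ - b + (b - - a)
    e = solve-∀ ℚ-ring

  inv-antimono : ∀ {a b} → 0ℚ < a → a ≤ b → inv b ≤ inv a
  inv-antimono {a} {b} 0<a a≤b = *-cancelˡ-≤ 0<a (*-cancelˡ-≤ 0<b (subst₂ _≤_ (sym (trans (e b a (inv b)) (trans (cong (a *_) (inv-r⁺ 0<b)) (*-identityʳ a)))) (sym (trans (cong (b *_) (inv-r⁺ 0<a)) (*-identityʳ b))) a≤b))
    where
    0<b : 0ℚ < b
    0<b = <-≤-trans 0<a a≤b
    e : ∀ b a i → b * (a * i) ≡ a * (b * i)
    e = solve-∀ ℚ-ring

  module Walk {m t : ℕ} (r₀ : Fin m) (1≤t : 1 ℕ.≤ t) (τ : Fin m → ℕ) (τ<t : ∀ r → τ r ℕ.< t) (H : ℚ) (1≤H : 1ℚ ≤ H)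
    (p : ℕ) (S : ℚ) (0<S : 0ℚ < S) (κ : ℚ) (0<κ : 0ℚ < κ) (2C₁pT≤κS : 2ℚ * C₁ * ι p * (ι t * (H * H)) ≤ κ * S)
    (Δ : ℚ) (0<Δ : 0ℚ < Δ) (n : ℕ) (Δ-small : 4ℚ * 4ℚ * (ι p * ι p) * ι n * (Δ * Δ) ≤ S)
    (β₀ Φ₀ : ℚ) (β-low : 1ℚ ≤ 2ℚ * (β₀ - κ)) where

    open Potential p S 0<S

    Φ : (Fin m → ℚ) → ℚ
    Φ u = ∑ (λ r → φ (u r))

    T : ℚ
    T = ι t * (H * H)

    0≤κ : 0ℚ ≤ κ
    0≤κ = <⇒≤ 0<κ

    Rows : ℕ → Set
    Rows s = Fin m → V s

    record System {s : ℕ} (B : Rows s) : Set where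
      field
        entries  : ∀ r j → ∣ B r j ∣ ≤ 1ℚ
        balanced : ∀ i → i ℕ.< t → Balanced H (λ (x : Σ[ r ∈ Fin m ] τ r ≡ i) → B (proj₁ x))

    open System

    system-punchIn : ∀ {s} {B : Rows (suc s)} j → System B → System (λ r → B r ∘ punchIn j)
    system-punchIn j sys = record
      { entries  = λ r i → entries sys r (punchIn j i)
      ; balanced = λ i l → Balanced-punchIn j (balanced sys i l)
      }

    -- β = 1 − κ · clock. A step x ↦ x ± Δy advances the clock by Δ²∣y∣² / s and multiplies Φ by at most
    -- (1 + κΔ²∣y∣² / s)^p; freezing one of s columns advances it by at most 1/(s − 1), whence the harmonic sum.
    β : ∀ {s} → V s → ℚ
    β {s} x = β₀ + κ * (harmonic s - norm² x * inv (ι s))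

    -- The fall of β pays for the growth of Φ. As β starts at 1 and stays at least 1/2, Φ grows by a
    -- factor of at most 2^p altogether.
    record Budget {s} (u : Fin m → ℚ) (x : V s) : Set where
      field
        cube  : ∀ j → ∣ x j ∣ ≤ 1ℚ
        β≤1   : β x ≤ 1ℚ
        bound : Φ u * β x ^ p ≤ Φ₀

    open Budget

    norm²-cube : ∀ {s} (x : V s) → (∀ j → ∣ x j ∣ ≤ 1ℚ) → norm² x * inv (ι s) ≤ 1ℚ
    norm²-cube {zero}  x c = ≤-trans (≤-reflexive (trans (cong (_* inv (ι 0)) (dot-def x x)) (*-zeroˡ (inv (ι 0))))) 0≤1
    norm²-cube {suc s} x c = subst (norm² x * inv (ι (suc s)) ≤_) (inv-r⁺ (0<ι (s≤s z≤n))) (*-monoʳ-≤ (0≤inv (0≤ι (suc s))) (norm²≤dim x c))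

    ½≤β : ∀ {s} (x : V s) → (∀ j → ∣ x j ∣ ≤ 1ℚ) → 1ℚ ≤ 2ℚ * β x
    ½≤β {s} x c = ≤-trans β-low (*-monoˡ-≤ {2ℚ} {β₀ - κ} {β x} 0≤2 (≤-by (κ * (harmonic s + (1ℚ - norm² x * inv (ι s)))) (0≤* 0≤κ (0≤+ (0≤harmonic s) (m≤n⇒0≤n-m (norm²-cube x c)))) (e β₀ κ (harmonic s) (norm² x * inv (ι s)))))
      where
      e : ∀ b k h n → b + k * (h - n) ≡ b - k + k * (h + (1ℚ - n))
      e = solve-∀ ℚ-ring

    0≤β : ∀ {s} (x : V s) → (∀ j → ∣ x j ∣ ≤ 1ℚ) → 0ℚ ≤ β x
    0≤β x c = *-cancelˡ-≤ {2ℚ} {0ℚ} {β x} 0<2 (≤-trans 0≤1 (½≤β x c))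

    0≤Φ : ∀ u → 0ℚ ≤ Φ u
    0≤Φ u = 0≤∑ (λ r → <⇒≤ (0<φ (u r)))

    -- `û` is the discrepancy as the potential sees it. Rounding a frozen column to a sign is not
    -- charged to Φ: it costs at most 2Δ per column, and the last column costs at most 2.
    Outcome : ∀ {s} → Rows s → (Fin m → ℚ) → V s → Set
    Outcome {s} B u x = Σ[ ε ∈ (Fin s → Bool) ] Σ[ û ∈ (Fin m → ℚ) ] Φ û ≤ Φ₀ * 2ℚ ^ p ×
      (∀ r → ∣ u r + dot (B r) (lin 1ℚ (sgn ∘ ε) (- 1ℚ) x) - û r ∣ ≤ 2ℚ + ι s * (2ℚ * Δ))

    final-Φ : ∀ {s u} {x : V s} → Budget u x → Φ u ≤ Φ₀ * 2ℚ ^ p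
    final-Φ {u = u} {x} bd = ≤-trans (subst₂ _≤_ (*-identityʳ (Φ u)) (e (Φ u) (2ℚ ^ p) (β x ^ p)) (*-monoˡ-≤ (0≤Φ u) (subst₂ _≤_ (1^ p) (*-^ 2ℚ (β x) p) (^-mono-≤ p 0≤1 (½≤β x (cube bd))))))
       (*-monoʳ-≤ (0≤^ p 0≤2) (bound bd))
      where
      e : ∀ f t b → f * (t * b) ≡ f * b * t
      e = solve-∀ ℚ-ring

    -- A step changes a coordinate by at most Δ ∣y∣ ≤ 2Δ, so a coordinate that is not frozen stays
    -- in the cube.
    Frozen : ∀ {s} → V s → Fin s → Set
    Frozen x j = 1ℚ - 2ℚ * Δ < ∣ x j ∣

    -- Deleting one of s columns replaces ∣x∣² / s by ∣x′∣² / (s - 1), where ∣x∣² ≤ 1 + ∣x′∣². The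
    -- term 1 / (s - 1) leaving the harmonic sum covers the difference, so β does not increase.
    freeze-budget : ∀ {s u} {x : V (suc (suc s))} j → Budget u x → Budget u (x ∘ punchIn j)
    freeze-budget {s} {u} {x} j bd = record
      { cube  = c′
      ; β≤1   = ≤-trans β′≤β (β≤1 bd)
      ; bound = ≤-trans (*-monoˡ-≤ (0≤Φ u) (^-mono-≤ p (0≤β x′ c′) β′≤β)) (bound bd)
      }
      where
      x′ : V (suc s)
      x′ = x ∘ punchIn j
      c′ : ∀ i → ∣ x′ i ∣ ≤ 1ℚ
      c′ i = cube bd (punchIn j i)
      i₁ i₂ : ℚ
      i₁ = inv (ι (suc s))
      i₂ = inv (ι (suc (suc s)))
      N≤ : norm² x * i₂ ≤ (1ℚ + norm² x′) * i₁
      N≤ = *-mono-≤ (0≤norm² x) (0≤inv (0≤ι (suc s)))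
          (≤-trans (≤-reflexive (dot-punchIn j x x)) (+-mono-≤ (∣∣≤⇒sq≤ (cube bd j)) (≤-refl {norm² x′})))
          (inv-antimono (0<ι (s≤s z≤n)) (ι-mono (ℕP.n≤1+n (suc s))))
      e : ∀ b k h i n n′i → b + k * (h + i - n) ≡ b + k * (h - n′i) + k * (i + n′i - n)
      e = solve-∀ ℚ-ring
      e′ : ∀ n i → (1ℚ + n) * i ≡ i + n * i
      e′ = solve-∀ ℚ-ring
      β′≤β : β x′ ≤ β x
      β′≤β = ≤-by _ (0≤* 0≤κ (m≤n⇒0≤n-m (subst (norm² x * i₂ ≤_) (e′ (norm² x′) i₁) N≤))) (e β₀ κ (harmonic (suc s)) i₁ (norm² x * i₂) (norm² x′ * i₁))

    freeze-outcome : ∀ {s} {B : Rows (suc (suc s))} {u} {x : V (suc (suc s))} j → System B → (∀ i → ∣ x i ∣ ≤ 1ℚ) → Frozen x j →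
      Outcome (λ r → B r ∘ punchIn j) u (x ∘ punchIn j) → Outcome B u x
    freeze-outcome {s} {B} {u} {x} j sys c fr (ε′ , û , Φ≤ , err) = ε , û , Φ≤ , err′
      where
      sign-near : Σ[ e ∈ Bool ] ∣ sgn e - x j ∣ ≤ 2ℚ * Δ
      sign-near with ∣p∣≡p∨∣p∣≡-p (x j)
      ... | inj₁ q = true , ∣∣≤-intro (≤-by _ (m≤n⇒0≤n-m (<⇒≤ (subst (1ℚ - 2ℚ * Δ <_) q fr))) (e₁ (x j) (2ℚ * Δ)))
                      (≤-by (2ℚ * Δ + (1ℚ - x j)) (0≤+ (0≤* 0≤2 (<⇒≤ 0<Δ)) (m≤n⇒0≤n-m (proj₁ (∣∣-bound (c j))))) (e₂ (x j) (2ℚ * Δ)))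
        where
        e₁ : ∀ x d → d ≡ 1ℚ - x + (x - (1ℚ - d))
        e₁ = solve-∀ ℚ-ring
        e₂ : ∀ x d → d ≡ - (1ℚ - x) + (d + (1ℚ - x))
        e₂ = solve-∀ ℚ-ring
      ... | inj₂ q = false , ∣∣≤-intro (≤-by (2ℚ * Δ + (x j - - 1ℚ)) (0≤+ (0≤* 0≤2 (<⇒≤ 0<Δ)) (m≤n⇒0≤n-m (proj₂ (∣∣-bound (c j))))) (e₂ (x j) (2ℚ * Δ)))
                      (≤-by _ (m≤n⇒0≤n-m (<⇒≤ (subst (1ℚ - 2ℚ * Δ <_) q fr))) (e₁ (x j) (2ℚ * Δ)))
        where
        e₁ : ∀ x d → d ≡ - (- 1ℚ - x) + (- x - (1ℚ - d))
        e₁ = solve-∀ ℚ-ring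
        e₂ : ∀ x d → d ≡ - 1ℚ - x + (d + (x - - 1ℚ))
        e₂ = solve-∀ ℚ-ring
      εj : Bool
      εj = proj₁ sign-near
      ε : Fin (suc (suc s)) → Bool
      ε = VF.insertAt ε′ j εj
      err′ : ∀ r → ∣ u r + dot (B r) (lin 1ℚ (sgn ∘ ε) (- 1ℚ) x) - û r ∣ ≤ 2ℚ + ι (suc (suc s)) * (2ℚ * Δ)
      err′ r = subst₂ _≤_ (cong ∣_∣ (sym eq)) (trans (e₂ (ι (suc s)) (2ℚ * Δ)) (cong (λ z → 2ℚ + z * (2ℚ * Δ)) (sym (ι-suc (suc s))))) (≤-trans (∣p+q∣≤∣p∣+∣q∣ (B r j * (sgn εj - x j)) R)
          (+-mono-≤ (≤-trans (≤-reflexive (∣p*q∣≡∣p∣*∣q∣ (B r j) (sgn εj - x j))) (subst (∣ B r j ∣ * ∣ sgn εj - x j ∣ ≤_) (*-identityˡ (2ℚ * Δ)) (*-mono-≤ (0≤∣p∣ (B r j)) (0≤* 0≤2 (<⇒≤ 0<Δ)) (entries sys r j) (proj₂ sign-near)))) (err r)))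
        where
        D′ R : ℚ
        D′ = dot (B r ∘ punchIn j) (lin 1ℚ (sgn ∘ ε′) (- 1ℚ) (x ∘ punchIn j))
        R = u r + D′ - û r
        e₁ : ∀ u b s x d û → u + (b * (1ℚ * s + - 1ℚ * x) + d) - û ≡ b * (s - x) + (u + d - û)
        e₁ = solve-∀ ℚ-ring
        e₂ : ∀ s d → d + (2ℚ + s * d) ≡ 2ℚ + (1ℚ + s) * d
        e₂ = solve-∀ ℚ-ring
        eq : u r + dot (B r) (lin 1ℚ (sgn ∘ ε) (- 1ℚ) x) - û r ≡ B r j * (sgn εj - x j) + R
        eq = trans (cong (λ z → u r + z - û r) (trans (dot-punchIn j (B r) (lin 1ℚ (sgn ∘ ε) (- 1ℚ) x))
             (cong₂ _+_ (cong (λ z → B r j * (1ℚ * sgn z + - 1ℚ * x j)) (VFP.insertAt-lookup ε′ j εj))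
               (dot-congʳ (B r ∘ punchIn j) (λ i → cong (λ z → 1ℚ * sgn z + - 1ℚ * x (punchIn j i)) (VFP.insertAt-punchIn ε′ j εj i))))))
             (e₁ (u r) (B r j) (sgn εj) (x j) D′ (û r))

    record Step {s} (B : Rows s) (u : Fin m → ℚ) (x : V s) : Set where
      field
        u′ : Fin m → ℚ
        x′ : V s
        budget : Budget u′ x′
        progress : norm² x + Δ * Δ ≤ norm² x′
        -- This offset holds the contribution of the columns frozen earlier.
        same : ∀ r → u r - dot (B r) x ≡ u′ r - dot (B r) x′

    0<Φ : ∀ u → 0ℚ < Φ u
    0<Φ u = <-≤-trans (0<φ (u r₀)) (∑-term≤ (λ r → <⇒≤ (0<φ (u r))) r₀)

    Direction : ∀ {s} → Rows s → (Fin m → ℚ) → V s → V s → Set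
    Direction {s} B u x y = dot x y ≡ 0ℚ × 1ℚ ≤ norm² y × norm² y ≤ 4ℚ ×
      ι s * ∑ (λ r → φ (u r) * (dot (B r) y * dot (B r) y)) ≤ C₁ * T * (Φ u * norm² y)

    step-along : ∀ {s′} {B : Rows (suc s′)} {u} {x : V (suc s′)} → suc s′ ℕ.≤ n → System B → Budget u x →
      (∀ j → ¬ Frozen x j) → ∀ y → Direction B u x y → Step B u x
    step-along {s′} {B} {u} {x} s≤n sys bd live y (x⊥y , 1≤y , y≤4 , energy≤) = choose
      where
      s : ℕ
      s = suc s′
      w : Fin m → ℚ
      w r = φ (u r)
      h : Fin m → ℚ
      h r = Δ * dot (B r) y
      0<s : 0ℚ < ι s
      0<s = 0<ι (s≤s z≤n)
      is : ℚ
      is = inv (ι s)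
      0≤is : 0ℚ ≤ is
      0≤is = <⇒≤ (0<inv 0<s)
      ττ : ℚ
      ττ = Δ * Δ * norm² y * is
      0≤ττ : 0ℚ ≤ ττ
      0≤ττ = 0≤* (0≤* (0≤sq Δ) (0≤norm² y)) 0≤is
      h-small : ∀ r → 4ℚ * (ι p * ι p) * (h r * h r) ≤ S
      h-small r = ≤-trans (≤-trans (≤-reflexive (e₁ (ι p * ι p) Δ (dot (B r) y))) (≤-trans (*-monoˡ-≤ (0≤* (0≤* 0≤4 (0≤sq (ι p))) (0≤sq Δ)) By) (≤-reflexive (e₂ (ι p * ι p) (Δ * Δ) (ι n))))) Δ-small
        where
        By : dot (B r) y * dot (B r) y ≤ ι n * 4ℚ
        By = ≤-trans (cauchy-schwarz (B r) y) (*-mono-≤ (0≤norm² (B r)) 0≤4 (≤-trans (norm²≤dim (B r) (entries sys r)) (ι-mono s≤n)) y≤4)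
        e₁ : ∀ p d b → 4ℚ * p * (d * b * (d * b)) ≡ 4ℚ * p * (d * d) * (b * b)
        e₁ = solve-∀ ℚ-ring
        e₂ : ∀ p d n → 4ℚ * p * d * (n * 4ℚ) ≡ 4ℚ * 4ℚ * p * n * d
        e₂ = solve-∀ ℚ-ring
      u⁺ u⁻ : Fin m → ℚ
      u⁺ r = u r + h r
      u⁻ r = u r - h r
      G : ℚ
      G = Φ u * (1ℚ + ι p * (κ * ττ))
      two-point : Φ u⁺ + Φ u⁻ ≤ 2ℚ * G
      two-point = ≤-trans (≤-reflexive (sym (∑-+ (λ r → φ (u⁺ r)) (λ r → φ (u⁻ r))))) (≤-trans (∑-mono (λ r → φ-two-point (u r) (h r) (h-small r)))
         (≤-trans (≤-reflexive (∑-lin 2ℚ w (4ℚ * (ι p * ι p) * inv S) (λ r → w r * (h r * h r)))) (≤-trans (+-mono-≤ (≤-refl {2ℚ * Φ u}) quad) (≤-reflexive (e₄ (Φ u) (ι p * (κ * ττ)))))))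
        where
        e₄ : ∀ f k → 2ℚ * f + 2ℚ * (f * k) ≡ 2ℚ * (f * (1ℚ + k))
        e₄ = solve-∀ ℚ-ring
        E : ℚ
        E = ∑ (λ r → w r * (dot (B r) y * dot (B r) y))
        hh : ∑ (λ r → w r * (h r * h r)) ≡ Δ * Δ * E
        hh = trans (∑-cong (λ r → e (w r) Δ (dot (B r) y))) (∑-*ˡ (Δ * Δ) (λ r → w r * (dot (B r) y * dot (B r) y)))
          where
          e : ∀ w d b → w * (d * b * (d * b)) ≡ d * d * (w * (b * b))
          e = solve-∀ ℚ-ring
        E≤ : E ≤ is * (C₁ * T * (Φ u * norm² y))
        E≤ = *-cancelˡ-≤ 0<s (≤-trans energy≤ (≤-reflexive (sym (trans (sym (*-assoc (ι s) is _)) (trans (cong (_* (C₁ * T * (Φ u * norm² y))) (inv-r⁺ 0<s)) (*-identityˡ _))))))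
        iS : ℚ
        iS = inv S
        0≤iS : 0ℚ ≤ iS
        0≤iS = <⇒≤ (0<inv 0<S)
        κ≥ : iS * (2ℚ * C₁ * ι p * T) ≤ κ
        κ≥ = ≤-trans (*-monoˡ-≤ 0≤iS 2C₁pT≤κS) (≤-reflexive (trans (e iS κ S) (trans (cong (κ *_) (inv-r⁺ 0<S)) (*-identityʳ κ))))
          where
          e : ∀ i k s → i * (k * s) ≡ k * (s * i)
          e = solve-∀ ℚ-ring
        e₅ : ∀ p i dd is c T f y → 4ℚ * (p * p) * i * (dd * (is * (c * T * (f * y)))) ≡ 2ℚ * (p * (f * (dd * y * is))) * (i * (2ℚ * c * p * T))
        e₅ = solve-∀ ℚ-ring
        e₆ : ∀ p f t k → 2ℚ * (p * (f * t)) * k ≡ 2ℚ * (f * (p * (k * t)))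
        e₆ = solve-∀ ℚ-ring
        -- The size of S enters here: 2 C₁ p T / S ≤ κ turns the p² of the two-point estimate into p
        -- κ, the first-order growth of the p-th power of 1 + κτ.
        quad : 4ℚ * (ι p * ι p) * iS * ∑ (λ r → w r * (h r * h r)) ≤ 2ℚ * (Φ u * (ι p * (κ * ττ)))
        quad = ≤-trans (*-monoˡ-≤ (0≤* (0≤* 0≤4 (0≤sq (ι p))) 0≤iS) (≤-trans (≤-reflexive hh) (*-monoˡ-≤ (0≤sq Δ) E≤)))
           (≤-trans (≤-reflexive (e₅ (ι p) iS (Δ * Δ) is C₁ T (Φ u) (norm² y)))
           (≤-trans (*-monoˡ-≤ (0≤* 0≤2 (0≤* (0≤ι p) (0≤* (0≤Φ u) 0≤ττ))) κ≥) (≤-reflexive (e₆ (ι p) (Φ u) ττ κ))))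

      module _ (c : ℚ) (cc : c * c ≡ Δ * Δ) (∣c∣≤Δ : ∣ c ∣ ≤ Δ) (v : Fin m → ℚ) (v≡ : ∀ r → v r ≡ u r + c * dot (B r) y) (Φv≤ : Φ v ≤ G) where

        xc : V s
        xc = lin 1ℚ x c y

        norm-xc : norm² xc ≡ norm² x + Δ * Δ * norm² y
        norm-xc = trans (norm²-lin 1ℚ x c y) (trans (cong₂ (λ d e → 1ℚ * 1ℚ * norm² x + 2ℚ * (1ℚ * c) * d + e * norm² y) x⊥y cc) (e (norm² x) c (Δ * Δ * norm² y)))
          where
          e : ∀ x c z → 1ℚ * 1ℚ * x + 2ℚ * (1ℚ * c) * 0ℚ + z ≡ x + z
          e = solve-∀ ℚ-ring

        cube′ : ∀ j → ∣ xc j ∣ ≤ 1ℚ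
        cube′ j = ≤-trans (∣p+q∣≤∣p∣+∣q∣ (1ℚ * x j) (c * y j)) (≤-trans (+-mono-≤ (≤-trans (≤-reflexive (cong ∣_∣ (*-identityˡ (x j)))) (≮⇒≥ (live j)))
            (≤-trans (≤-reflexive (∣p*q∣≡∣p∣*∣q∣ c (y j))) (*-mono-≤ (0≤∣p∣ c) 0≤2 ∣c∣≤Δ yj≤2))) (≤-reflexive (e Δ)))
          where
          yj≤2 : ∣ y j ∣ ≤ 2ℚ
          yj≤2 = sq≤⇒∣∣≤ {y j} {2ℚ} 0≤2 (≤-trans (∑-term≤ (λ i → 0≤sq (y i)) j) (≤-trans (≤-reflexive (sym (dot-def y y))) y≤4))
          e : ∀ d → 1ℚ - 2ℚ * d + d * 2ℚ ≡ 1ℚ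
          e = solve-∀ ℚ-ring

        β′≡ : β xc ≡ β x - κ * ττ
        β′≡ = trans (cong (λ z → β₀ + κ * (harmonic s - z * is)) norm-xc) (e β₀ κ (harmonic s) (norm² x) (Δ * Δ * norm² y) is)
          where
          e : ∀ b k h x z i → b + k * (h - (x + z) * i) ≡ b + k * (h - x * i) - k * (z * i)
          e = solve-∀ ℚ-ring

        0≤κτ : 0ℚ ≤ κ * ττ
        0≤κτ = 0≤* 0≤κ 0≤ττ

        e₇ : ∀ b k → b ≡ (1ℚ + k) * (b - k) + (k * (1ℚ - b) + k * k)
        e₇ = solve-∀ ℚ-ring

        e₈ : ∀ b k → b ≡ b - k + k
        e₈ = solve-∀ ℚ-ring

        -- Bernoulli bounds the growth of Φ by (1 + κτ)^p, and (1 + κτ)(β - κτ) ≤ β because β ≤ 1.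
        bound′ : Φ v * β xc ^ p ≤ Φ₀
        bound′ = ≤-trans (*-monoʳ-≤ (0≤^ p (0≤β xc cube′)) (≤-trans Φv≤ (*-monoˡ-≤ (0≤Φ u) (bernoulli (κ * ττ) p 0≤κτ))))
          (≤-trans (≤-reflexive (trans (*-assoc (Φ u) ((1ℚ + κ * ττ) ^ p) (β xc ^ p)) (cong (Φ u *_) (sym (*-^ (1ℚ + κ * ττ) (β xc) p)))))
          (≤-trans (*-monoˡ-≤ (0≤Φ u) (^-mono-≤ p (0≤* (0≤+ 0≤1 0≤κτ) (0≤β xc cube′))
            (≤-by (κ * ττ * (1ℚ - β x) + κ * ττ * (κ * ττ)) (0≤+ (0≤* 0≤κτ (m≤n⇒0≤n-m (β≤1 bd))) (0≤sq (κ * ττ))) (trans (e₇ (β x) (κ * ττ)) (cong (λ z → (1ℚ + κ * ττ) * z + (κ * ττ * (1ℚ - β x) + κ * ττ * (κ * ττ))) (sym β′≡)))))) (bound bd)))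

        moved : Step B u x
        moved = record
          { u′ = v
          ; x′ = xc
          ; budget = record { cube = cube′ ; β≤1 = ≤-trans (≤-by (κ * ττ) 0≤κτ (trans (e₈ (β x) (κ * ττ)) (cong (_+ κ * ττ) (sym β′≡)))) (β≤1 bd) ; bound = bound′ }
          ; progress = ≤-trans (+-mono-≤ (≤-refl {norm² x}) (subst (_≤ Δ * Δ * norm² y) (*-identityʳ (Δ * Δ)) (*-monoˡ-≤ (0≤sq Δ) 1≤y))) (≤-reflexive (sym norm-xc))
          ; same = λ r → trans (e₉ (u r) (dot (B r) x) c (dot (B r) y)) (sym (cong₂ _-_ (v≡ r) (dot-linʳ (B r) 1ℚ x c y)))
          }
          where
          e₉ : ∀ u x c y → u - x ≡ u + c * y - (1ℚ * x + c * y)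
          e₉ = solve-∀ ℚ-ring

      choose : Step B u x
      choose with Φ u⁺ ≤? G
      ... | yes q = moved Δ refl (≤-reflexive (0≤p⇒∣p∣≡p (<⇒≤ 0<Δ))) u⁺ (λ r → refl) q
      ... | no ¬q = moved (- Δ) (e₁ Δ) (≤-reflexive (trans (∣-p∣≡∣p∣ Δ) (0≤p⇒∣p∣≡p (<⇒≤ 0<Δ)))) u⁻ (λ r → e₂ (u r) Δ (dot (B r) y))
          (≤-by _ (0≤+ (m≤n⇒0≤n-m two-point) (m≤n⇒0≤n-m (<⇒≤ (≰⇒> ¬q)))) (e₃ (Φ u⁺) (Φ u⁻) G))
        where
        e₁ : ∀ d → - d * - d ≡ d * d
        e₁ = solve-∀ ℚ-ring
        e₂ : ∀ u d b → u - d * b ≡ u + - d * b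
        e₂ = solve-∀ ℚ-ring
        e₃ : ∀ a b g → g ≡ b + (2ℚ * g - (a + b) + (a - g))
        e₃ = solve-∀ ℚ-ring

    step : ∀ {s} {B : Rows (suc (suc s))} {u} {x : V (suc (suc s))} → suc (suc s) ℕ.≤ n → System B → Budget u x →
      (∀ j → ¬ Frozen x j) → Step B u x
    step {B = B} {u} {x} s≤n sys bd live =
      let (y , dir) = small-direction 1≤t B (entries sys) τ τ<t H 1≤H (balanced sys) (λ r → φ (u r)) (λ r → <⇒≤ (0<φ (u r))) (0<Φ u) x
      in step-along s≤n sys bd live y dir

    frozen? : ∀ {s} (x : V s) → ∃ (Frozen x) ⊎ (∀ j → ¬ Frozen x j)
    frozen? x with FinP.any? (λ j → (1ℚ - 2ℚ * Δ) <? ∣ x j ∣)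
    ... | yes q = inj₁ q
    ... | no ¬q = inj₂ (λ j fr → ¬q (j , fr))

    step-outcome : ∀ {s} {B : Rows s} {u} {x} → (st : Step B u x) → Outcome B (Step.u′ st) (Step.x′ st) → Outcome B u x
    step-outcome {s} {B} {u} {x} st (ε , û , Φ≤ , err) = ε , û , Φ≤ , λ r → subst (λ z → ∣ z - û r ∣ ≤ 2ℚ + ι s * (2ℚ * Δ)) (eq r) (err r)
      where
      e : ∀ u e x → u + (1ℚ * e + - 1ℚ * x) ≡ (u - x) + e
      e = solve-∀ ℚ-ring
      split : ∀ r u x → u + dot (B r) (lin 1ℚ (sgn ∘ ε) (- 1ℚ) x) ≡ (u - dot (B r) x) + dot (B r) (sgn ∘ ε)
      split r u x = trans (cong (u +_) (dot-linʳ (B r) 1ℚ (sgn ∘ ε) (- 1ℚ) x)) (e u (dot (B r) (sgn ∘ ε)) (dot (B r) x))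
      eq : ∀ r → Step.u′ st r + dot (B r) (lin 1ℚ (sgn ∘ ε) (- 1ℚ) (Step.x′ st)) ≡ u r + dot (B r) (lin 1ℚ (sgn ∘ ε) (- 1ℚ) x)
      eq r = trans (split r (Step.u′ st r) (Step.x′ st)) (trans (cong (_+ dot (B r) (sgn ∘ ε)) (sym (Step.same st r))) (sym (split r (u r) x)))

    -- As ∣x∣² ≤ s, the inequality on the fuel prevents it from running out. A step adds at least Δ²
    -- to ∣x∣² for one unit of fuel; freezing lowers s by 1 and ∣x∣² by at most 1.
    run : ∀ s fuel {B : Rows s} {u} {x : V s} → s ℕ.≤ n → System B → Budget u x → ι s < norm² x + ι fuel * (Δ * Δ) → Outcome B u x
    run zero fuel {B} {u} {x} s≤n sys bd f = (λ ()) , u , final-Φ bd ,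
      λ r → subst (λ z → ∣ z ∣ ≤ 2ℚ + ι 0 * (2ℚ * Δ)) (sym (trans (cong (λ z → u r + z - u r) (dot-def (B r) _)) (e (u r)))) (0≤+ 0≤2 (0≤* (0≤ι 0) (0≤* 0≤2 (<⇒≤ 0<Δ))))
      where
      e : ∀ u → u + 0ℚ - u ≡ 0ℚ
      e = solve-∀ ℚ-ring
    -- With a single column there need not be a nonzero direction orthogonal to x. Rounding the
    -- coordinate to 1 costs at most 2, the constant in `Outcome`.
    run (suc zero) fuel {B} {u} {x} s≤n sys bd f = (λ _ → true) , u , final-Φ bd , λ r →
      ≤-trans (≤-reflexive (cong ∣_∣ (trans (cong (λ z → u r + z - u r) (dot-def (B r) _)) (e (u r) (B r zero) (x zero)))))
      (≤-trans (≤-reflexive (∣p*q∣≡∣p∣*∣q∣ (B r zero) (1ℚ - x zero))) (≤-trans (*-mono-≤ (0≤∣p∣ (B r zero)) 0≤2 (entries sys r zero) (two (x zero) (cube bd zero)))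
        (≤-by (ι 1 * (2ℚ * Δ)) (0≤* (0≤ι 1) (0≤* 0≤2 (<⇒≤ 0<Δ))) refl)))
      where
      e : ∀ u b x → u + (b * (1ℚ * 1ℚ + - 1ℚ * x) + 0ℚ) - u ≡ b * (1ℚ - x)
      e = solve-∀ ℚ-ring
      two : ∀ x → ∣ x ∣ ≤ 1ℚ → ∣ 1ℚ - x ∣ ≤ 2ℚ
      two x q = ≤-trans (∣p+q∣≤∣p∣+∣q∣ 1ℚ (- x)) (+-mono-≤ (≤-refl {1ℚ}) (≤-trans (≤-reflexive (∣-p∣≡∣p∣ x)) q))
    run (suc (suc s)) zero {B} {u} {x} s≤n sys bd f = contradiction f (λ g → <-irrefl refl (<-≤-trans g (≤-trans (≤-reflexive (trans (cong (λ z → norm² x + z * (Δ * Δ)) ι-0) (e (norm² x) (Δ * Δ)))) (norm²≤dim x (cube bd)))))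
      where
      e : ∀ n d → n + 0ℚ * d ≡ n
      e = solve-∀ ℚ-ring
    run (suc (suc s)) (suc fuel) {B} {u} {x} s≤n sys bd f =
      [ (λ q → freeze-outcome {B = B} {u} {x} (proj₁ q) sys (cube bd) (proj₂ q)
          (run (suc s) (suc fuel) (ℕP.<⇒≤ s≤n) (system-punchIn (proj₁ q) sys) (freeze-budget (proj₁ q) bd) (freeze-fuel (proj₁ q))))
      , (λ live → step-outcome {B = B} {u} {x} (step s≤n sys bd live)
          (run (suc (suc s)) fuel s≤n sys (Step.budget (step s≤n sys bd live)) (step-fuel (step s≤n sys bd live))))
      ]′ (frozen? x)
      where
      freeze-fuel : ∀ j → ι (suc s) < norm² (x ∘ punchIn j) + ι (suc fuel) * (Δ * Δ)
      freeze-fuel j = <-by _ (0<+ (m<n⇒0<n-m f) (m≤n⇒0≤n-m (∣∣≤⇒sq≤ (cube bd j)))) (trans (e (ι (suc s)) (x j * x j) (norm² (x ∘ punchIn j)) F)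
            (cong₂ (λ a b → ι (suc s) + (b + F - a + (1ℚ * 1ℚ - x j * x j))) (sym (ι-suc (suc s))) (sym (dot-punchIn j x x))))
        where
        F : ℚ
        F = ι (suc fuel) * (Δ * Δ)
        e : ∀ s x n g → n + g ≡ s + (x + n + g - (1ℚ + s) + (1ℚ * 1ℚ - x))
        e = solve-∀ ℚ-ring
      step-fuel : ∀ (st : Step B u x) → ι (suc (suc s)) < norm² (Step.x′ st) + ι fuel * (Δ * Δ)
      step-fuel st = <-≤-trans f (≤-by _ (m≤n⇒0≤n-m (Step.progress st)) (trans (e (norm² x) (norm² (Step.x′ st)) (Δ * Δ) (ι fuel)) (cong (λ z → norm² x + z * (Δ * Δ) + (norm² (Step.x′ st) - (norm² x + Δ * Δ))) (sym (ι-suc fuel)))))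
        where
        e : ∀ n n′ d f → n′ + f * d ≡ n + (1ℚ + f) * d + (n′ - (n + d))
        e = solve-∀ ℚ-ring

  -- Logarithms and harmonic sums

  n≤2^⌈log₂n⌉ : ∀ n → n ℕ.≤ 2 ℕ.^ Log.⌈log₂ n ⌉
  n≤2^⌈log₂n⌉ = <-rec _ go
    where
    go : ∀ n → (∀ {k} → k ℕ.< n → k ℕ.≤ 2 ℕ.^ Log.⌈log₂ k ⌉) → n ℕ.≤ 2 ℕ.^ Log.⌈log₂ n ⌉
    go zero          ih = z≤n
    go (suc zero)    ih = ℕP.m^n>0 2 Log.⌈log₂ 1 ⌉
    go (suc (suc n)) ih = ℕP.≤-trans (ℕP.≤-trans (ℕP.≤-reflexive (sym (ℕP.⌊n/2⌋+⌈n/2⌉≡n N))) (ℕP.+-mono-≤ (ℕP.≤-trans (ℕP.⌊n/2⌋≤⌈n/2⌉ N) half≤) half≤))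
        (ℕP.≤-reflexive (trans (cong (2 ℕ.^ l ℕ.+_) (sym (ℕP.+-identityʳ (2 ℕ.^ l)))) (cong (2 ℕ.^_) (suc-l))))
      where
      N l : ℕ
      N = suc (suc n)
      l = Log.⌈log₂ N ⌉ ℕ.∸ 1
      half≤ : ℕ.⌈ N /2⌉ ℕ.≤ 2 ℕ.^ l
      half≤ = subst (λ k → ℕ.⌈ N /2⌉ ℕ.≤ 2 ℕ.^ k) (Log.⌈log₂⌈n/2⌉⌉≡⌈log₂n⌉∸1 N) (ih (ℕP.⌈n/2⌉<n n))
      suc-l : suc l ≡ Log.⌈log₂ N ⌉
      suc-l = ℕP.m+[n∸m]≡n (ℕP.≤-trans (ℕP.≤-reflexive (sym (Log.⌈log₂2^n⌉≡n 1))) (Log.⌈log₂⌉-mono-≤ {2} {N} (s≤s (s≤s z≤n))))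

  1≤⌈log₂n⌉ : ∀ {n} → 2 ℕ.≤ n → 1 ℕ.≤ Log.⌈log₂ n ⌉
  1≤⌈log₂n⌉ p = ℕP.≤-trans (ℕP.≤-reflexive (sym (Log.⌈log₂2^n⌉≡n 1))) (Log.⌈log₂⌉-mono-≤ p)

  harmonic-suc : ∀ n → harmonic n ≤ harmonic (suc n)
  harmonic-suc zero    = ≤-refl
  harmonic-suc (suc n) = ≤-by (inv (ι (suc n))) (0≤inv (0≤ι (suc n))) refl

  harmonic-mono : ∀ {m n} → m ℕ.≤ n → harmonic m ≤ harmonic n
  harmonic-mono {m} {n} p = subst (λ k → harmonic m ≤ harmonic k) (ℕP.m+[n∸m]≡n p) (go (n ℕ.∸ m))
    where
    go : ∀ k → harmonic m ≤ harmonic (m ℕ.+ k)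
    go zero    = ≤-reflexive (cong harmonic (sym (ℕP.+-identityʳ m)))
    go (suc k) = ≤-trans (go k) (subst (λ j → harmonic (m ℕ.+ k) ≤ harmonic j) (sym (ℕP.+-suc m k)) (harmonic-suc (m ℕ.+ k)))

  harmonic-+ : ∀ a k → harmonic (suc a ℕ.+ k) ≤ harmonic (suc a) + ι k * inv (ι (suc a))
  harmonic-+ a zero    = ≤-reflexive (trans (cong harmonic (ℕP.+-identityʳ (suc a))) (trans (e (harmonic (suc a)) (inv (ι (suc a)))) (cong (λ z → harmonic (suc a) + z * inv (ι (suc a))) (sym ι-0))))
    where
    e : ∀ h i → h ≡ h + 0ℚ * i
    e = solve-∀ ℚ-ring
  harmonic-+ a (suc k) = subst (λ j → harmonic j ≤ harmonic (suc a) + ι (suc k) * inv (ι (suc a))) (sym (ℕP.+-suc (suc a) k))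
    (≤-trans (+-mono-≤ (harmonic-+ a k) (inv-antimono (0<ι (s≤s z≤n)) (ι-mono (ℕP.m≤m+n (suc a) k))))
      (≤-reflexive (trans (e (harmonic (suc a)) (ι k) (inv (ι (suc a)))) (cong (λ z → harmonic (suc a) + z * inv (ι (suc a))) (sym (ι-suc k))))))
    where
    e : ∀ h k i → h + k * i + i ≡ h + (1ℚ + k) * i
    e = solve-∀ ℚ-ring

  -- Each dyadic block 1/a + ... + 1/(2a - 1) is at most 1.
  harmonic-2^ : ∀ l → harmonic (2 ℕ.^ l) ≤ ι l
  harmonic-2^ zero    = 0≤ι 0
  harmonic-2^ (suc l) with 2 ℕ.^ l | ℕP.m^n>0 2 l | harmonic-2^ l
  ... | suc a | _ | ih = subst₂ _≤_ (cong (λ k → harmonic (suc a ℕ.+ k)) (sym (ℕP.+-identityʳ (suc a)))) (trans (+-comm (ι l) 1ℚ) (sym (ι-suc l)))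
      (≤-trans (harmonic-+ a (suc a)) (+-mono-≤ ih (≤-reflexive (inv-r⁺ (0<ι (s≤s z≤n))))))

  -- From integer matrices to rational vectors

  ιᶻ-neg : ∀ z → ιᶻ (ℤ.- z) ≡ - ιᶻ z
  ιᶻ-neg z = trans (e (ιᶻ z) (ιᶻ (ℤ.- z))) (trans (cong (_- ιᶻ z) (trans (sym (ιᶻ-+ z (ℤ.- z))) (trans (cong ιᶻ (ℤP.+-inverseʳ z)) ιᶻ-0))) (+-identityˡ (- ιᶻ z)))
    where
    e : ∀ a b → b ≡ a + b - a
    e = solve-∀ ℚ-ring

  ιᶻ-∣∣ : ∀ z → ∣ ιᶻ z ∣ ≡ ι ℤ.∣ z ∣
  ιᶻ-∣∣ (ℤ.+ n)    = 0≤p⇒∣p∣≡p (0≤ι n)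
  ιᶻ-∣∣ (-[1+ n ]) = trans (cong ∣_∣ (ιᶻ-neg (ℤ.+ suc n))) (trans (∣-p∣≡∣p∣ (ι (suc n))) (0≤p⇒∣p∣≡p (0≤ι (suc n))))

  ιᶻ-∑ : ∀ {n} (f : Fin n → ℤ) → ιᶻ (Defs.∑ f) ≡ ∑ (ιᶻ ∘ f)
  ιᶻ-∑ {zero}  f = ιᶻ-0
  ιᶻ-∑ {suc n} f = trans (ιᶻ-+ (f zero) _) (cong (ιᶻ (f zero) +_) (ιᶻ-∑ (f ∘ suc)))

  ιᶻ-sign : ∀ b → ιᶻ (Defs.sign b) ≡ sgn b
  ιᶻ-sign true  = ιᶻ-1
  ιᶻ-sign false = trans (ιᶻ-neg (ℤ.+ 1)) (cong -_ ιᶻ-1)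

  ιᶻ-01 : ∀ b → ιᶻ (if b then ℤ.+ 1 else ℤ.+ 0) ≡ ind b
  ιᶻ-01 true  = ιᶻ-1
  ιᶻ-01 false = ιᶻ-0

  rowOf : ∀ {n} → Subset n → Subset n → V n
  rowOf A S j = ind (Vec.lookup S j) * ind (Vec.lookup A j)

  ιᶻ-apply : ∀ {m n} (F : Fin m → Subset n) S (x : Fin n → Bool) r →
    ιᶻ (Defs.apply (Defs.restrict (Defs.incidence F) S) x r) ≡ dot (rowOf (F r) S) (sgn ∘ x)
  ιᶻ-apply F S x r = trans (ιᶻ-∑ (λ j → (if Vec.lookup S j then (if Vec.lookup (F r) j then ℤ.+ 1 else ℤ.+ 0) else ℤ.+ 0) ℤ.* Defs.sign (x j)))
      (trans (∑-cong (λ j → trans (ιᶻ-* (if Vec.lookup S j then (if Vec.lookup (F r) j then ℤ.+ 1 else ℤ.+ 0) else ℤ.+ 0) (Defs.sign (x j))) (cong₂ _*_ (entry (Vec.lookup S j) (Vec.lookup (F r) j)) (ιᶻ-sign (x j))))) (sym (dot-def (rowOf (F r) S) (sgn ∘ x))))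
    where
    entry : ∀ s a → ιᶻ (if s then (if a then ℤ.+ 1 else ℤ.+ 0) else ℤ.+ 0) ≡ ind s * ind a
    entry true  a = trans (ιᶻ-01 a) (sym (*-identityˡ (ind a)))
    entry false a = trans ιᶻ-0 (sym (*-zeroˡ (ind a)))

  rowOf≤1 : ∀ {n} (A S : Subset n) j → ∣ rowOf A S j ∣ ≤ 1ℚ
  rowOf≤1 A S j = go (Vec.lookup S j) (Vec.lookup A j)
    where
    go : ∀ s a → ∣ ind s * ind a ∣ ≤ 1ℚ
    go true  true  = ≤-refl
    go true  false = 0≤1
    go false true  = 0≤1
    go false false = 0≤1

  -- Keeping the columns `T` of the restriction to `S` amounts to restricting to S ∩ T.
  HerdiscLe⇒Balanced : ∀ {m n H} {F : Fin m → Subset n} → Defs.HerdiscLe (Defs.incidence F) H → ∀ S → Balanced (ι H) (λ r → rowOf (F r) S)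
  HerdiscLe⇒Balanced {n = n} {H} {F} hd S T = proj₁ (hd S′) , λ r → subst (λ z → ∣ z ∣ ≤ ι H) (trans (ιᶻ-apply F S′ (proj₁ (hd S′)) r) (eq r))
      (subst (_≤ ι H) (sym (ιᶻ-∣∣ _)) (ι-mono (proj₂ (hd S′) r)))
    where
    S′ : Subset n
    S′ = Vec.tabulate (λ j → Vec.lookup S j ∧ T j)
    e : ∀ s t a x → ind (s ∧ t) * a * x ≡ ind s * a * (ind t * x)
    e true  t a x = e₁ (ind t) a x
      where
      e₁ : ∀ t a x → t * a * x ≡ 1ℚ * a * (t * x)
      e₁ = solve-∀ ℚ-ring
    e false t a x = e₁ (ind t) a x
      where
      e₁ : ∀ t a x → 0ℚ * a * x ≡ 0ℚ * a * (t * x)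
      e₁ = solve-∀ ℚ-ring
    eq : ∀ r → dot (rowOf (F r) S′) (sgn ∘ proj₁ (hd S′)) ≡ dot (rowOf (F r) S) (λ j → ind (T j) * sgn (proj₁ (hd S′) j))
    eq r = trans (dot-def _ _) (trans (∑-cong (λ j → trans (cong (λ b → ind b * ind (Vec.lookup (F r) j) * sgn (proj₁ (hd S′) j)) (VecP.lookup∘tabulate (λ j → Vec.lookup S j ∧ T j) j))
       (e (Vec.lookup S j) (T j) (ind (Vec.lookup (F r) j)) (sgn (proj₁ (hd S′) j))))) (sym (dot-def _ _)))

  -- An element j of a set would give discrepancy 1 on the single column j.
  HerdiscLe-0⇒empty : ∀ {m n} {F : Fin m → Subset n} → Defs.HerdiscLe (Defs.incidence F) 0 → ∀ r j → Vec.lookup (F r) j ≡ false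
  HerdiscLe-0⇒empty {n = n} {F} hd r j = by-cases (Vec.lookup (F r) j) refl
    where
    T : Fin n → Bool
    T i = does (i FinP.≟ j)
    χ : Fin n → Bool
    χ = proj₁ (HerdiscLe⇒Balanced {F = F} hd ⊤ˢ T)
    f : Fin n → ℚ
    f i = rowOf (F r) ⊤ˢ i * (ind (T i) * sgn (χ i))
    others : ∀ i → i ≢ j → f i ≡ 0ℚ
    others i ne with i FinP.≟ j
    ... | yes e = contradiction e ne
    ... | no  _ = trans (cong (rowOf (F r) ⊤ˢ i *_) (*-zeroˡ (sgn (χ i)))) (*-zeroʳ (rowOf (F r) ⊤ˢ i))
    f≤0 : ∣ f j ∣ ≤ 0ℚ
    f≤0 = subst₂ (λ a b → ∣ a ∣ ≤ b) (trans (dot-def (rowOf (F r) ⊤ˢ) (λ i → ind (T i) * sgn (χ i))) (∑-single j f others)) ι-0 (proj₂ (HerdiscLe⇒Balanced {F = F} hd ⊤ˢ T) r)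
    unit : ∀ a s → ∣ 1ℚ * ind a * (1ℚ * sgn s) ∣ ≤ 0ℚ → a ≡ true → ⊥
    unit true true  p refl = <-irrefl refl (<-≤-trans 0<1 p)
    unit true false p refl = <-irrefl refl (<-≤-trans 0<1 p)
    fj : f j ≡ 1ℚ * ind (Vec.lookup (F r) j) * (1ℚ * sgn (χ j))
    fj with j FinP.≟ j
    ... | yes _ = cong (λ b → ind b * ind (Vec.lookup (F r) j) * (1ℚ * sgn (χ j))) (VecP.lookup-replicate j true)
    ... | no ne = contradiction refl ne
    by-cases : ∀ b → Vec.lookup (F r) j ≡ b → Vec.lookup (F r) j ≡ false
    by-cases false e = e
    by-cases true  e = ⊥-elim (unit (Vec.lookup (F r) j) (χ j) (subst (λ z → ∣ z ∣ ≤ 0ℚ) fj f≤0) e)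

  -- The colouring of a restriction and the choice of parameters

  opaque
    c₁ : ℕ
    c₁ = suc (proj₁ (archimedean C₁))

    C₁≤c₁ : C₁ ≤ ι c₁
    C₁≤c₁ = ≤-trans (proj₂ (archimedean C₁)) (ι-mono (ℕP.n≤1+n _))

    1≤c₁ : 1 ℕ.≤ c₁
    1≤c₁ = s≤s z≤n

  module Union {n m t : ℕ} (2≤n : 2 ℕ.≤ n) (2≤m : 2 ℕ.≤ m) (F : Fin m → Subset n)
    (size : Fin t → ℕ) (Fs : (i : Fin t) → Fin (size i) → Subset n)
    (covered : ∀ r → ∃₂ λ i k → Fs i k ≡ F r) (H : ℕ) (1≤H : 1 ℕ.≤ H)
    (hd : ∀ i → Defs.HerdiscLe (Defs.incidence (Fs i)) H) (S₀ : Subset n) where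

    -- The clock stops by 1 + harmonic n ≤ 2L, so the rate κ = 1/(4L) keeps β ≥ 1/2. S is so large
    -- that the potential grows at rate at most κ.
    p L s Sℕ : ℕ
    p  = Log.⌈log₂ m ⌉
    L  = Log.⌈log₂ n ⌉
    s  = 4 ℕ.* n ℕ.* p
    Sℕ = 8 ℕ.* c₁ ℕ.* t ℕ.* p ℕ.* L ℕ.* (H ℕ.* H)

    1≤p : 1 ℕ.≤ p
    1≤p = 1≤⌈log₂n⌉ 2≤m

    1≤L : 1 ℕ.≤ L
    1≤L = 1≤⌈log₂n⌉ 2≤n

    1≤n : 1 ℕ.≤ n
    1≤n = ℕP.<⇒≤ 2≤n

    r₀ : Fin m
    r₀ = Fin.fromℕ< (ℕP.<⇒≤ 2≤m)

    1≤t : 1 ℕ.≤ t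
    1≤t = ℕP.≤-trans (s≤s z≤n) (FinP.toℕ<n (proj₁ (covered r₀)))

    1≤* : ∀ {a b} → 1 ℕ.≤ a → 1 ℕ.≤ b → 1 ℕ.≤ a ℕ.* b
    1≤* = ℕP.*-mono-≤ {1} {_} {1}

    1≤Sℕ : 1 ℕ.≤ Sℕ
    1≤Sℕ = 1≤* (1≤* (1≤* (1≤* (1≤* {8} (s≤s z≤n) 1≤c₁) 1≤t) 1≤p) 1≤L) (1≤* 1≤H 1≤H)

    S κ Δ T : ℚ
    S = ι Sℕ
    κ = inv (4ℚ * ι L)
    -- Here `s` is the inverse step length 4np, large enough for 16 p² n Δ² ≤ 1 and for a total
    -- rounding error n · 2Δ ≤ 1.
    Δ = inv (ι s)
    T = ι t * (ι H * ι H)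

    1≤S : 1ℚ ≤ S
    1≤S = 1≤ι 1≤Sℕ

    0<4L : 0ℚ < 4ℚ * ι L
    0<4L = 0<* 0<4 (0<ι 1≤L)

    0<κ : 0ℚ < κ
    0<κ = 0<inv 0<4L

    κL : 4ℚ * ι L * κ ≡ 1ℚ
    κL = inv-r⁺ 0<4L

    1≤s : 1 ℕ.≤ s
    1≤s = 1≤* (1≤* {4} (s≤s z≤n) 1≤n) 1≤p

    0<ιs : 0ℚ < ι s
    0<ιs = 0<ι 1≤s

    0<Δ : 0ℚ < Δ
    0<Δ = 0<inv 0<ιs

    sΔ : ι s * Δ ≡ 1ℚ
    sΔ = inv-r⁺ 0<ιs

    ιs≡ : ι s ≡ 4ℚ * ι n * ι p
    ιs≡ = trans (ι-* (4 ℕ.* n) p) (cong (_* ι p) (trans (ι-* 4 n) (cong (_* ι n) ι-4)))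

    ιS≡ : S ≡ 4ℚ * 2ℚ * ι c₁ * ι t * ι p * ι L * (ι H * ι H)
    ιS≡ = trans (ι-* (8 ℕ.* c₁ ℕ.* t ℕ.* p ℕ.* L) (H ℕ.* H)) (cong₂ _*_ (trans (ι-* (8 ℕ.* c₁ ℕ.* t ℕ.* p) L) (cong (_* ι L)
        (trans (ι-* (8 ℕ.* c₁ ℕ.* t) p) (cong (_* ι p) (trans (ι-* (8 ℕ.* c₁) t) (cong (_* ι t) (trans (ι-* 8 c₁) (cong (_* ι c₁) (trans (ι-* 4 2) (cong₂ _*_ ι-4 ι-2)))))))))) (ι-* H H))

    0≤T : 0ℚ ≤ T
    0≤T = 0≤* (0≤ι t) (0≤sq (ι H))

    2C₁pT≤κS : 2ℚ * C₁ * ι p * T ≤ κ * S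
    2C₁pT≤κS = ≤-trans (*-monoʳ-≤ 0≤T (*-monoʳ-≤ (0≤ι p) (*-monoˡ-≤ {2ℚ} 0≤2 C₁≤c₁))) (≤-reflexive (sym (trans (cong (κ *_) ιS≡)
        (trans (e κ (ι c₁) (ι t) (ι p) (ι L) (ι H * ι H)) (trans (cong (2ℚ * ι c₁ * ι p * T *_) κL) (*-identityʳ _))))))
      where
      e : ∀ k c t p l h → k * (4ℚ * 2ℚ * c * t * p * l * h) ≡ 2ℚ * c * p * (t * h) * (4ℚ * l * k)
      e = solve-∀ ℚ-ring

    Δ-small : 4ℚ * 4ℚ * (ι p * ι p) * ι n * (Δ * Δ) ≤ S
    Δ-small = ≤-trans (*-monoʳ-≤ (0≤sq Δ) (*-monoˡ-≤ (0≤* (0≤* 0≤4 0≤4) (0≤sq (ι p)))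
        (subst (_≤ ι n * ι n) (*-identityʳ (ι n)) (*-monoˡ-≤ (0≤ι n) (1≤ι 1≤n))))) (≤-trans (≤-reflexive (trans (e (ι p) (ι n) Δ) (trans (cong (λ z → z * Δ * (z * Δ)) (sym ιs≡)) (cong (λ z → z * z) sΔ)))) 1≤S)
      where
      e : ∀ p n d → 4ℚ * 4ℚ * (p * p) * (n * n) * (d * d) ≡ 4ℚ * n * p * d * (4ℚ * n * p * d)
      e = solve-∀ ℚ-ring

    β₀ Φ₀ : ℚ
    -- Makes β equal to 1 at the origin.
    β₀ = 1ℚ - κ * harmonic n
    Φ₀ = ∑ {m} (λ _ → (S + 0ℚ * 0ℚ) ^ p)

    β-low : 1ℚ ≤ 2ℚ * (β₀ - κ)
    β-low = ≤-by (2ℚ * κ * ((ι L - harmonic n) + (ι L - 1ℚ))) (0≤* (0≤* 0≤2 (<⇒≤ 0<κ)) (0≤+ (m≤n⇒0≤n-m h≤L) (m≤n⇒0≤n-m (1≤ι 1≤L))))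
       (trans (e κ (harmonic n) (ι L)) (trans (cong (λ z → 1ℚ + (1ℚ - z) + 2ℚ * κ * ((ι L - harmonic n) + (ι L - 1ℚ))) κL) (e′ (2ℚ * κ * ((ι L - harmonic n) + (ι L - 1ℚ))))))
      where
      e′ : ∀ x → 1ℚ + (1ℚ - 1ℚ) + x ≡ 1ℚ + x
      e′ = solve-∀ ℚ-ring
      e : ∀ k h l → 2ℚ * (1ℚ - k * h - k) ≡ 1ℚ + (1ℚ - 4ℚ * l * k) + 2ℚ * k * ((l - h) + (l - 1ℚ))
      e = solve-∀ ℚ-ring
      h≤L : harmonic n ≤ ι L
      h≤L = ≤-trans (harmonic-mono (n≤2^⌈log₂n⌉ n)) (harmonic-2^ L)

    τ : Fin m → ℕ
    τ r = toℕ (proj₁ (covered r))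

    τ<t : ∀ r → τ r ℕ.< t
    τ<t r = FinP.toℕ<n (proj₁ (covered r))

    B : Fin m → V n
    B r = rowOf (F r) S₀

    open Walk {m} {t} r₀ 1≤t τ τ<t (ι H) (1≤ι 1≤H) p S (<-≤-trans 0<1 1≤S) κ 0<κ 2C₁pT≤κS Δ 0<Δ n Δ-small β₀ Φ₀ β-low
    open Potential p S (<-≤-trans 0<1 1≤S) using (φ; 0<φ)

    system : System B
    system = record { entries = λ r → rowOf≤1 (F r) S₀ ; balanced = bal }
      where
      bal : ∀ i → i ℕ.< t → Balanced (ι H) (λ (x : Σ[ r ∈ Fin m ] τ r ≡ i) → B (proj₁ x))
      bal i i<t T = proj₁ bl , λ { (r , τr≡i) → use r (proj₁ (covered r)) (FinP.toℕ-injective (trans τr≡i (sym (FinP.toℕ-fromℕ< i<t)))) (proj₁ (proj₂ (covered r))) (proj₂ (proj₂ (covered r))) }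
        where
        bl = HerdiscLe⇒Balanced {F = Fs (Fin.fromℕ< i<t)} (hd (Fin.fromℕ< i<t)) S₀ T
        use : ∀ r i′ → i′ ≡ Fin.fromℕ< i<t → (k : Fin (size i′)) → Fs i′ k ≡ F r → ∣ dot (B r) (λ j → ind (T j) * sgn (proj₁ bl j)) ∣ ≤ ι H
        use r i′ refl k e = subst (λ A → ∣ dot (rowOf A S₀) (λ j → ind (T j) * sgn (proj₁ bl j)) ∣ ≤ ι H) e (proj₂ bl k)

    origin : V n
    origin _ = 0ℚ

    norm²-origin : norm² origin ≡ 0ℚ
    norm²-origin = trans (dot-def origin origin) (∑-0 {n} (λ _ → refl))

    start : Budget (λ _ → 0ℚ) origin
    start = record { cube = λ _ → 0≤1 ; β≤1 = ≤-reflexive β≡1 ; bound = ≤-reflexive (trans (cong (Φ₀ *_) (trans (cong (_^ p) β≡1) (1^ p))) (*-identityʳ Φ₀)) }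
      where
      e : ∀ k h i → 1ℚ - k * h + k * (h - 0ℚ * i) ≡ 1ℚ
      e = solve-∀ ℚ-ring
      β≡1 : β origin ≡ 1ℚ
      β≡1 = trans (cong (λ z → β₀ + κ * (harmonic n - z * inv (ι n))) norm²-origin) (e κ (harmonic n) (inv (ι n)))

    fuel : ℕ
    -- Each step adds at least Δ² = 1/s² to ∣x∣² ≤ n; the extra unit makes the inequality strict.
    fuel = suc (n ℕ.* (s ℕ.* s))

    enough : ι n < norm² origin + ι fuel * (Δ * Δ)
    enough = <-by (Δ * Δ) (0<* 0<Δ 0<Δ) (trans (cong₂ (λ x y → x + y * (Δ * Δ)) norm²-origin (trans (ι-suc (n ℕ.* (s ℕ.* s))) (cong (1ℚ +_) (trans (ι-* n (s ℕ.* s)) (cong (ι n *_) (ι-* s s))))))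
       (trans (e (ι n) (ι s) Δ) (cong (_+ Δ * Δ) (trans (cong (λ z → ι n * (z * z)) sΔ) (*-identityʳ (ι n))))))
      where
      e : ∀ n s d → 0ℚ + (1ℚ + n * (s * s)) * (d * d) ≡ n * (s * d * (s * d)) + d * d
      e = solve-∀ ℚ-ring

    walk : Outcome B (λ _ → 0ℚ) origin
    walk = run n fuel ℕP.≤-refl system start enough

    ε : Fin n → Bool
    ε = proj₁ walk

    û : Fin m → ℚ
    û = proj₁ (proj₂ walk)

    -- A single row is bounded by the whole potential, at most m (2S)^p. As m ≤ 2^p, both the number
    -- of rows and the growth of Φ cost only a factor 2 after the p-th root.
    û²≤4S : ∀ r → û r * û r ≤ 4ℚ * S
    û²≤4S r = ≤-trans (≤-by S 0≤S (+-comm S (û r * û r))) (root p 1≤p (≤-trans (∑-term≤ (λ r → <⇒≤ (0<φ (û r))) r) (≤-trans (proj₁ (proj₂ (proj₂ walk))) Φ≤)))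
      where
      0≤S : 0ℚ ≤ S
      0≤S = ≤-trans 0≤1 1≤S
      root : ∀ p → 1 ℕ.≤ p → (S + û r * û r) ^ p ≤ (4ℚ * S) ^ p → S + û r * û r ≤ 4ℚ * S
      root (suc p) _ q = ^-cancel-≤ p (0≤* 0≤4 0≤S) q
      e₀ : ∀ S → S + 0ℚ * 0ℚ ≡ S
      e₀ = solve-∀ ℚ-ring
      e₁ : ∀ a s b → a * s * b ≡ a * b * s
      e₁ = solve-∀ ℚ-ring
      m≤ : ι m ≤ 2ℚ ^ p
      m≤ = subst (ι m ≤_) (trans (ι-^ 2 p) (cong (_^ p) ι-2)) (ι-mono (n≤2^⌈log₂n⌉ m))
      Φ≤ : Φ₀ * 2ℚ ^ p ≤ (4ℚ * S) ^ p
      Φ≤ = ≤-trans (≤-reflexive (trans (cong (_* 2ℚ ^ p) (trans (∑-const m ((S + 0ℚ * 0ℚ) ^ p)) (cong (λ z → ι m * z ^ p) (e₀ S)))) (e₁ (ι m) (S ^ p) (2ℚ ^ p))))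
         (≤-trans (*-monoʳ-≤ (0≤^ p 0≤S) (*-monoʳ-≤ (0≤^ p 0≤2) m≤)) (≤-reflexive (sym (trans (*-^ 4ℚ S p) (cong (_* S ^ p) (*-^ 2ℚ 2ℚ p))))))

    three : ℚ
    three = 2ℚ + 1ℚ

    near : ∀ r → ∣ dot (B r) (sgn ∘ ε) - û r ∣ ≤ three
    near r = ≤-trans (≤-reflexive (cong (λ z → ∣ z - û r ∣) (sym val))) (≤-trans (proj₂ (proj₂ (proj₂ walk)) r) (+-mono-≤ (≤-refl {2ℚ}) small))
      where
      e₀ : ∀ d z → 0ℚ + (1ℚ * d + - 1ℚ * z) ≡ d - z
      e₀ = solve-∀ ℚ-ring
      val : 0ℚ + dot (B r) (lin 1ℚ (sgn ∘ ε) (- 1ℚ) origin) ≡ dot (B r) (sgn ∘ ε)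
      val = trans (cong (0ℚ +_) (dot-linʳ (B r) 1ℚ (sgn ∘ ε) (- 1ℚ) origin)) (trans (e₀ (dot (B r) (sgn ∘ ε)) (dot (B r) origin))
         (trans (cong (λ z → dot (B r) (sgn ∘ ε) - z) (trans (dot-def (B r) origin) (∑-0 (λ j → *-zeroʳ (B r j))))) (+-identityʳ _)))
      e₁ : ∀ n p d → 4ℚ * n * p * d ≡ n * (2ℚ * d) + 2ℚ * n * d * (2ℚ * p - 1ℚ)
      e₁ = solve-∀ ℚ-ring
      small : ι n * (2ℚ * Δ) ≤ 1ℚ
      small = ≤-by (2ℚ * ι n * Δ * (2ℚ * ι p - 1ℚ)) (0≤* (0≤* (0≤* 0≤2 (0≤ι n)) (<⇒≤ 0<Δ)) (m≤n⇒0≤n-m (≤-trans (1≤ι 1≤p) (≤-by (ι p) (0≤ι p) (e₂ (ι p))))))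
         (trans (sym sΔ) (trans (cong (_* Δ) ιs≡) (e₁ (ι n) (ι p) Δ)))
        where
        e₂ : ∀ p → 2ℚ * p ≡ p + p
        e₂ = solve-∀ ℚ-ring

    -- (∣û∣ + 3)² ≤ 2û² + 18 ≤ 26 S
    val²≤ : ∀ r → dot (B r) (sgn ∘ ε) * dot (B r) (sgn ∘ ε) ≤ ι (26 ℕ.* Sℕ)
    val²≤ r = ≤-trans (≤-by _ (0≤+ (0≤+ (0≤+ (0≤sq (û r - D)) (0≤* 0≤2 (m≤n⇒0≤n-m (∣∣≤⇒sq≤ (near r))))) (0≤* 0≤2 (m≤n⇒0≤n-m (û²≤4S r)))) (0≤* (nonNegative⁻¹ (three * three * 2ℚ)) (m≤n⇒0≤n-m 1≤S))) (e (dot (B r) (sgn ∘ ε)) (û r) S)) (≤-reflexive eq)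
      where
      D : ℚ
      D = dot (B r) (sgn ∘ ε) - û r
      e : ∀ v u S → (4ℚ * 2ℚ + three * three * 2ℚ) * S ≡ v * v + ((u - (v - u)) * (u - (v - u)) + 2ℚ * (three * three - (v - u) * (v - u)) + 2ℚ * (4ℚ * S - u * u) + three * three * 2ℚ * (S - 1ℚ))
      e = solve-∀ ℚ-ring
      26≡ : 4ℚ * 2ℚ + three * three * 2ℚ ≡ ι 26
      26≡ = sym (trans (ι-+ 8 18) (cong₂ _+_ (trans (ι-* 4 2) (cong₂ _*_ ι-4 ι-2)) (trans (ι-* 9 2) (cong₂ _*_ (trans (ι-* 3 3) (cong₂ _*_ ι-3 ι-3)) ι-2))))
        where
        ι-3 : ι 3 ≡ three
        ι-3 = trans (ι-+ 2 1) (cong₂ _+_ ι-2 ι-1)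
      eq : (4ℚ * 2ℚ + three * three * 2ℚ) * S ≡ ι (26 ℕ.* Sℕ)
      eq = trans (cong (_* S) 26≡) (sym (ι-* 26 Sℕ))

    D : ℕ
    D = proj₁ (isqrt (26 ℕ.* Sℕ))

    D²≤ : D ℕ.* D ℕ.≤ 208 ℕ.* c₁ ℕ.* t ℕ.* p ℕ.* L ℕ.* (H ℕ.* H)
    D²≤ = ℕP.≤-trans (proj₁ (proj₂ (isqrt (26 ℕ.* Sℕ)))) (ℕP.≤-reflexive (assoc26 c₁ t p L (H ℕ.* H)))
      where
      assoc26 : ∀ c t p l h → 26 ℕ.* (8 ℕ.* c ℕ.* t ℕ.* p ℕ.* l ℕ.* h) ≡ 208 ℕ.* c ℕ.* t ℕ.* p ℕ.* l ℕ.* h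
      assoc26 = ℕ-solve-∀

    discrepancy : ∀ r → ℤ.∣ Defs.apply (Defs.restrict (Defs.incidence F) S₀) ε r ∣ ℕ.≤ D
    discrepancy r = ℕP.≮⇒≥ λ D<a → ℕP.<⇒≱ (proj₂ (proj₂ (isqrt (26 ℕ.* Sℕ)))) (ℕP.≤-trans (ℕP.*-mono-≤ D<a D<a) a²≤)
      where
      z : ℤ
      z = Defs.apply (Defs.restrict (Defs.incidence F) S₀) ε r
      a²≤ : ℤ.∣ z ∣ ℕ.* ℤ.∣ z ∣ ℕ.≤ 26 ℕ.* Sℕ
      a²≤ = ι-cancel (≤-trans (≤-reflexive (trans (ι-* ℤ.∣ z ∣ ℤ.∣ z ∣) (trans (cong₂ _*_ (sym (ιᶻ-∣∣ z)) (sym (ιᶻ-∣∣ z))) (trans (∣∣-sq (ιᶻ z)) (cong₂ _*_ (ιᶻ-apply F S₀ ε r) (ιᶻ-apply F S₀ ε r)))))) (val²≤ r))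

  -- For H = 0 every set of every system is empty, but F contains two distinct sets.
  1≤herdisc : ∀ {n m t} → 2 ℕ.≤ m → (F : Fin m → Subset n) → (∀ r r′ → F r ≡ F r′ → r ≡ r′) →
    (size : Fin t → ℕ) (Fs : (i : Fin t) → Fin (size i) → Subset n) → (∀ r → ∃₂ λ i k → Fs i k ≡ F r) →
    ∀ H → (∀ i → Defs.HerdiscLe (Defs.incidence (Fs i)) H) → 1 ℕ.≤ H
  1≤herdisc _ F distinct size Fs covered (suc H) hd = s≤s z≤n
  1≤herdisc {m = suc (suc m)} _ F distinct size Fs covered zero hd = contradiction (distinct zero (suc zero) (VPE.Pointwise-≡⇒≡ (VPE.ext (λ j → trans (empty zero j) (sym (empty (suc zero) j)))))) λ ()
    where
    empty : ∀ r j → Vec.lookup (F r) j ≡ false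
    empty r j = let (i , k , e) = covered r in subst (λ A → Vec.lookup A j ≡ false) e (HerdiscLe-0⇒empty {F = Fs i} (hd i) k j)
  1≤herdisc {m = suc zero} (s≤s ()) F distinct size Fs covered zero hd

  herdisc-union : ∀ {n m t} → 2 ℕ.≤ n → 2 ℕ.≤ m → (F : Fin m → Subset n) → (∀ r r′ → F r ≡ F r′ → r ≡ r′) →
    (size : Fin t → ℕ) (Fs : (i : Fin t) → Fin (size i) → Subset n) → (∀ r → ∃₂ λ i k → Fs i k ≡ F r) →
    ∀ H → (∀ i → Defs.HerdiscLe (Defs.incidence (Fs i)) H) →
    ∃ λ D → D ℕ.* D ℕ.≤ 208 ℕ.* c₁ ℕ.* t ℕ.* Log.⌈log₂ m ⌉ ℕ.* Log.⌈log₂ n ⌉ ℕ.* (H ℕ.* H) × Defs.HerdiscLe (Defs.incidence F) D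
  -- The value of `D` is the same for every column set, so the instance at `⊤ˢ` supplies it.
  herdisc-union 2≤n 2≤m F distinct size Fs covered H hd = D ⊤ˢ , D²≤ ⊤ˢ , λ S → ε S , discrepancy S
    where
    open Union 2≤n 2≤m F size Fs covered H (1≤herdisc 2≤m F distinct size Fs covered H hd) hd

open import Defs
open import Data.Nat using (ℕ; _≤_; _*_)
open import Data.Nat.Logarithm using (⌈log₂_⌉)
open import Data.Fin using (Fin)
open import Data.Fin.Subset using (Subset)
open import Data.Product using (∃; ∃₂; _×_; _,_)
open import Relation.Binary.PropositionalEquality using (_≡_)

theorem3 : ∃ λ (C : ℕ) →
    (n m t : ℕ) → 2 ≤ n → 2 ≤ m →
    (F : Fin m → Subset n) → (∀ r r′ → F r ≡ F r′ → r ≡ r′) →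
    (size : Fin t → ℕ) → (Fs : (i : Fin t) → Fin (size i) → Subset n) →
    (∀ r → ∃₂ λ i k → Fs i k ≡ F r) →
    (∀ i k → ∃ λ r → F r ≡ Fs i k) →
    (H : ℕ) → (∀ i → HerdiscLe (incidence (Fs i)) H) →
    ∃ λ (D : ℕ) → D * D ≤ C * t * ⌈log₂ m ⌉ * ⌈log₂ n ⌉ * (H * H)
    × HerdiscLe (incidence F) D
theorem3 = 208 * Discrepancy.c₁ , λ n m t 2≤n 2≤m F distinct size Fs covered _ →
  Discrepancy.herdisc-union 2≤n 2≤m F distinct size Fs covered
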